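{- Let $p>5$ be a prime and $\phi_{\pm}=(1\pm\sqrt{5})/2$. Then \begin{align*} \pounds_2(\phi_{\pm})&\equiv \mp \frac{\sqrt{5}}{10}\left(\frac{p}{5}\right)q_L^2\pmod{p},\\ \pounds_2(\phi^2_{\pm})&\equiv -\frac{1}{2}\left(1\pm \frac{\sqrt{5}}{5}\left(\frac{p}{5}\right)\right)q_L^2 \pmod{p},\\ \pounds_2(-\phi_{\pm})&\equiv -\frac{1}{4}\left(1\pm \frac{\sqrt{5}}{5}\left(\frac{p}{5}\right)\right)q_L^2 \pmod{p},\\ \pounds_3(\phi_{\pm}^2)&\equiv -\frac{2}{15}\left(1\pm\sqrt{5}\left(\frac{p}{5}\right)\right)\left(\frac{1}{2}q_L^3 +B_{p-3}\right) \pmod{p}. \end{align*}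
   Context: For a prime $p$ and a positive integer $d$, the finite polylogarithm is $\pounds_d(x)=\sum_{k=1}^{p-1} x^k/k^d$. $L_n$ is the $n$-th Lucas number ($L_0=2$, $L_1=1$, $L_n=L_{n-1}+L_{n-2}$) and $q_L=(L_p-1)/p$ is the Lucas quotient (equivalently $q_L=(x^p+(1-x)^p-1)/p$ at $x=\phi_{\pm}$). $B_n$ is the $n$-th Bernoulli number and $\left(\frac{\cdot}{p}\right)$... more precisely $\left(\frac{p}{5}\right)$ is the Legendre symbol. Congruences modulo $p$ are taken in the ring of elements of $\mathbb{Q}(\sqrt5)$ integral at all primes above $p$: $a\equiv b\pmod p$ means $(a-b)/p$ is such an element. -}

module Defs where

open import Data.Nat as ℕ using (ℕ; zero; suc; _∸_; _≤ᵇ_; _≡ᵇ_; _%_)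
open import Data.Nat.Divisibility using (_∣_)
open import Data.Nat.Combinatorics using (_C_)
open import Data.Integer as ℤ using (ℤ; +_; -[1+_])
open import Data.Rational as ℚ using (ℚ; 0ℚ; 1ℚ)
open import Data.Bool using (Bool; true; false; if_then_else_; _∨_)
open import Data.Product using (Σ; _×_)
open import Relation.Nullary using (¬_)
open import Relation.Binary.PropositionalEquality using (_≡_)

-- 1/n as a rational (junk value 0 at n = 0; only used for n ≥ 1)
recipℕ : ℕ → ℚ
recipℕ zero    = 0ℚ
recipℕ (suc n) = + 1 ℚ./ suc n

ℕ→ℚ : ℕ → ℚ
ℕ→ℚ n = + n ℚ./ 1

ℤ→ℚ : ℤ → ℚ
ℤ→ℚ z = z ℚ./ 1

sumTo : ℕ → (ℕ → ℚ) → ℚ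
sumTo zero    f = 0ℚ
sumTo (suc n) f = sumTo n f ℚ.+ f n

record Q5 : Set where
  constructor _+√5·_
  field
    re : ℚ
    im : ℚ
open Q5 public

infixl 6 _⊕_ _⊖_
infixl 7 _⊗_

_⊕_ : Q5 → Q5 → Q5
(a +√5· b) ⊕ (c +√5· d) = (a ℚ.+ c) +√5· (b ℚ.+ d)

_⊖_ : Q5 → Q5 → Q5
(a +√5· b) ⊖ (c +√5· d) = (a ℚ.- c) +√5· (b ℚ.- d)

_⊗_ : Q5 → Q5 → Q5
(a +√5· b) ⊗ (c +√5· d) =
  (a ℚ.* c ℚ.+ ℚ→ (+ 5) ℚ.* (b ℚ.* d)) +√5· (a ℚ.* d ℚ.+ b ℚ.* c)
  where ℚ→ : ℤ → ℚ
        ℚ→ z = z ℚ./ 1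

ι : ℚ → Q5
ι r = r +√5· 0ℚ

√5 : Q5
√5 = 0ℚ +√5· 1ℚ

_^5_ : Q5 → ℕ → Q5
x ^5 zero  = ι 1ℚ
x ^5 suc n = x ⊗ (x ^5 n)

sumTo5 : ℕ → (ℕ → Q5) → Q5
sumTo5 zero    f = ι 0ℚ
sumTo5 (suc n) f = sumTo5 n f ⊕ f n

½ : ℚ
½ = + 1 ℚ./ 2

φ₊ : Q5
φ₊ = ½ +√5· ½

φ₋ : Q5
φ₋ = ½ +√5· (ℚ.- ½)

_^ℚ_ : ℚ → ℕ → ℚ
r ^ℚ zero  = 1ℚ
r ^ℚ suc n = r ℚ.* (r ^ℚ n)

finPolylog : (p d : ℕ) → Q5 → Q5
finPolylog p d x =
  sumTo5 (p ∸ 1) (λ i → ι (recipℕ (suc i) ^ℚ d) ⊗ (x ^5 suc i))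

-- Congruence modulo p in the ring of elements of ℚ(√5) integral at all
-- primes above p.  For odd p ≠ 5 this ring is ℤ₍ₚ₎[√5] = ℤ₍ₚ₎ ⊗ 𝒪_K,
-- i.e. a + b√5 with a, b p-integral rationals.

pIntegralℚ : ℕ → ℚ → Set
pIntegralℚ p r = ¬ (p ∣ ℚ.denominatorℕ r)

pIntegral : ℕ → Q5 → Set
pIntegral p x = pIntegralℚ p (re x) × pIntegralℚ p (im x)

_≡_[mod_] : Q5 → Q5 → ℕ → Set
a ≡ b [mod p ] = Σ Q5 (λ c → pIntegral p c × (a ⊖ b ≡ ι (ℕ→ℚ p) ⊗ c))

lucas : ℕ → ℕ
lucas zero          = 2
lucas (suc zero)    = 1
lucas (suc (suc n)) = lucas (suc n) ℕ.+ lucas n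

-- q_L = (L_p - 1)/p   (L_p ≥ 1 for p ≥ 1 so ∸ is subtraction)
qL : ℕ → ℚ
qL p = ℕ→ℚ (lucas p ∸ 1) ℚ.* recipℕ p

-- Bernoulli numbers: B₀ = 1, B_n = -1/(n+1) Σ_{k<n} C(n+1,k) B_k
-- (so B₁ = -1/2).  bTable n k = B_k for k ≤ n.

bTable : ℕ → ℕ → ℚ
bTable zero k = if k ≡ᵇ 0 then 1ℚ else 0ℚ
bTable (suc n) k =
  if k ≤ᵇ n then bTable n k
  else (if k ≡ᵇ suc n then new else 0ℚ)
  where
  new : ℚ
  new = ℚ.- (recipℕ (suc (suc n)) ℚ.*
          sumTo (suc n) (λ j → ℕ→ℚ (suc (suc n) C j) ℚ.* bTable n j))

bernoulli : ℕ → ℚ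
bernoulli n = bTable n n

isSqMod5 : ℕ → Bool
isSqMod5 a = sq 1 ∨ sq 2 ∨ sq 3 ∨ sq 4
  where sq : ℕ → Bool
        sq x = ((x ℕ.* x) % 5) ≡ᵇ (a % 5)

legendre5 : ℕ → ℤ
legendre5 p = if (p % 5) ≡ᵇ 0 then + 0
              else (if isSqMod5 p then + 1 else -[1+ 0 ])

{-# OPTIONS --safe #-}
module Submission where

-- Work in the ring of p-integral elements of ℚ(√5) modulo p, where 1/k is k^(p−2), and let X = xᵖ.  Writing
-- H_k = 1 + 1/2 + … + 1/k, products £ₐ(x)·£_b(x) are evaluated by partial fractions 1/(ab) = (1/a + 1/b)/(a + b),
-- the indices being read modulo p with xᵖ = X; and £_d(1 − x) is expanded by the binomial theorem, using
-- C(p − 1, k) ≡ (−1)ᵏ.  Both give sums of xᵏ weighted by products of H's, and eliminating these yields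
--   £₁(x)² = −2X £₂(x) − 2(1 − X) £₂(1 − x),
--   £₁(x)³ = 6X £₃(x) + 6(1 − X) £₃(1 − x) + 6X²(1 − X) £₃(1 − 1/x) − 2X(1 − X) β,   β = ∑ H_k/k².
-- For x = φ± all arguments occurring are related to x, −x and x² by inversion and duplication, £₁(x) is −q_L, and the
-- resulting linear systems can be solved.  Here β ≡ B_{p−3}, because the moments ∑ aʲ H_a satisfy the Bernoulli
-- recurrence, and X is φ₊ or φ₋ according to p mod 5, by taking the p-th power of ζ + ζ⁻¹ for a fifth root of unity ζ.

open import Defs
open import Level using (0ℓ)
open import Algebra.Bundles using (CommutativeRing)
open import Data.Bool using (true; false; if_then_else_; _∨_)
open import Data.Empty using (⊥-elim)
open import Data.Integer as ℤ using (ℤ; +_; -[1+_])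
import Data.Integer.Properties as ℤₚ
open import Data.Maybe using (Maybe; just; nothing)
open import Data.Nat as ℕ using (ℕ; zero; suc; _<_; _≤_; _∸_; s≤s; z≤n; s<s; z<s)
import Data.Nat.Properties as ℕₚ
open import Data.Nat.Combinatorics using (_C_; nCn≡1; nC1≡n; nCk≡nC[n∸k]; nCk+nC[k+1]≡[n+1]C[k+1])
open import Data.Nat.Coprimality using (prime⇒coprime; coprime-Bézout)
open import Data.Nat.Divisibility using (_∣_; divides; ∣⇒≤; ∣-trans)
open import Data.Nat.GCD using (module Bézout)
open import Data.Nat.Induction using (<-rec)
open import Data.Nat.Primality using (Prime; euclidsLemma; prime⇒irreducible; prime⇒nonTrivial)
open import Data.Product using (∃; _×_; _,_; proj₁; proj₂)
open import Data.Rational as ℚ using (ℚ; 0ℚ; 1ℚ)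
import Data.Rational.Properties as ℚₚ
open import Data.Sum using (_⊎_; inj₁; inj₂; [_,_]′)
open import Relation.Nullary using (¬_; Dec; yes; no)
open import Relation.Binary.PropositionalEquality as ≡ using (_≡_)

-- Two obstructions shape the proof. First, q_L is a quotient by p and cannot be formed modulo p: it
-- is expanded exactly in ℚ(√5) as a sum whose only denominators are 1, ..., p - 1, and only then
-- reduced. Second, the partial fraction formula breaks down when a + b ≡ 0. It is therefore stated
-- as the Leibniz rule for the Euler operator z d/dz, which is a derivation of R[z]/(zᵖ - X) because
-- p = 0 in R, and the coefficient of degree 0, on which that rule is silent, is computed by hand.
-- It vanishes for £₁² and £₁£₂, and equals -Xβ for the product of £₁ with ∑ H_k xᵏ/k; this is the
-- only entry point of the Bernoulli number. X is kept apart from x because p may be inert in ℚ(√5),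
-- in which case xᵖ is the conjugate of x. The golden ratio closes the system since 1 - x and -1/x
-- both are the conjugate y, while 1 + x = x² and 1 + y = y²: reflection, inversion and duplication
-- only ever lead to the arguments x, -x, y, x² and y².

module BinomialCoefficients where
  open import Data.Nat.Combinatorics.Specification using (k>n⇒nCk≡0)
  open ≡.≡-Reasoning

  -- Induction on Pascal's rule. Absorption is what yields p ∣ C(p, k), the exact expansion of q_L,
  -- and the recursion `F-suc` behind the reflection formulas.
  C-absorption : ∀ n k → suc k ℕ.* (suc n C suc k) ≡ suc n ℕ.* (n C k)
  C-absorption zero zero = ≡.refl
  C-absorption zero (suc k) = ≡.trans (≡.cong (suc (suc k) ℕ.*_) (k>n⇒nCk≡0 (s<s (z<s {k})))) (ℕₚ.*-zeroʳ k)
  C-absorption (suc n) zero = ≡.trans (≡.trans (ℕₚ.*-identityˡ _) (nC1≡n (suc (suc n))))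
      (≡.sym (ℕₚ.*-identityʳ _))
  C-absorption (suc n) (suc k) = begin
    suc (suc k) ℕ.* (suc (suc n) C suc (suc k))
      ≡⟨ ≡.cong (suc (suc k) ℕ.*_) (nCk+nC[k+1]≡[n+1]C[k+1] (suc n) (suc k)) ⟨
    suc (suc k) ℕ.* (C₁ ℕ.+ (suc n C suc (suc k)))
      ≡⟨ ℕₚ.*-distribˡ-+ (suc (suc k)) C₁ _ ⟩
    (C₁ ℕ.+ suc k ℕ.* C₁) ℕ.+ suc (suc k) ℕ.* (suc n C suc (suc k))
      ≡⟨ ≡.cong₂ (λ u v → (C₁ ℕ.+ u) ℕ.+ v) (C-absorption n k) (C-absorption n (suc k)) ⟩
    (C₁ ℕ.+ suc n ℕ.* (n C k)) ℕ.+ suc n ℕ.* (n C suc k)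
      ≡⟨ ℕₚ.+-assoc C₁ _ _ ⟩
    C₁ ℕ.+ (suc n ℕ.* (n C k) ℕ.+ suc n ℕ.* (n C suc k))
      ≡⟨ ≡.cong (C₁ ℕ.+_) (ℕₚ.*-distribˡ-+ (suc n) (n C k) (n C suc k)) ⟨
    C₁ ℕ.+ suc n ℕ.* ((n C k) ℕ.+ (n C suc k))
      ≡⟨ ≡.cong (λ u → C₁ ℕ.+ suc n ℕ.* u) (nCk+nC[k+1]≡[n+1]C[k+1] n k) ⟩
    suc (suc n) ℕ.* C₁ ∎
    where
    C₁ = suc n C suc k

  [1+n]Cn≡1+n : ∀ n → suc n C n ≡ suc n
  [1+n]Cn≡1+n n = begin
    suc n C n             ≡⟨ nCk≡nC[n∸k] (ℕₚ.n≤1+n n) ⟩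
    suc n C (suc n ℕ.∸ n) ≡⟨ ≡.cong (suc n C_)
        (≡.trans (ℕₚ.+-∸-assoc 1 (ℕₚ.≤-refl {n})) (≡.cong suc (ℕₚ.n∸n≡0 n))) ⟩
    suc n C 1             ≡⟨ nC1≡n (suc n) ⟩
    suc n                 ∎

-- Ring solving with integer coefficients and ideal membership in a commutative ring

module RingCalculus {c ℓ} (R : CommutativeRing c ℓ) where
  open CommutativeRing R public hiding (zero)
  open import Algebra.Properties.Ring ring public using (-‿distribˡ-*; -‿distribʳ-*; -0#≈0#; -‿involutive; x∙y⁻¹≈ε⇒x≈y)
  open import Algebra.Properties.AbelianGroup +-abelianGroup using (⁻¹-∙-comm)
  open import Algebra.Properties.Semiring.Mult.TCOptimised semiring using (1+×; ×-homo-+; ×1-homo-*)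
    renaming (_×_ to _·_)
  open import Algebra.Properties.Semiring.Exp semiring public using (_^_; ^-congˡ; ^-congʳ; ^-homo-*)
  open import Algebra.Properties.CommutativeSemiring.Exp commutativeSemiring public using (^-distrib-*)
  open import Relation.Binary.Reasoning.Setoid setoid

  -- The multiple used here makes `# 0` and `# 1` reduce to `0#` and `1#`, so that identities on
  -- small numerals hold by `refl`.
  # : ℕ → Carrier
  # n = n · 1#

  #-+ : ∀ m n → # (m ℕ.+ n) ≈ # m + # n
  #-+ = ×-homo-+ 1#

  #-* : ∀ m n → # (m ℕ.* n) ≈ # m * # n
  #-* = ×1-homo-*

  #-suc : ∀ n → # (suc n) ≈ 1# + # n
  #-suc n = 1+× n 1#

  #-cong : ∀ {m n} → m ≡ n → # m ≈ # n
  #-cong ≡.refl = refl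

  ⟦_⟧ : ℤ → Carrier
  ⟦ + n ⟧ = # n
  ⟦ -[1+ n ] ⟧ = - # (suc n)

  ⟦⟧-⊖ : ∀ m n → ⟦ m ℤ.⊖ n ⟧ ≈ # m - # n
  ⟦⟧-⊖ zero zero = sym (-‿inverseʳ 0#)
  ⟦⟧-⊖ zero (suc n) = sym (+-identityˡ _)
  ⟦⟧-⊖ (suc m) zero = sym (trans (+-congˡ -0#≈0#) (+-identityʳ _))
  ⟦⟧-⊖ (suc m) (suc n) = begin
    ⟦ suc m ℤ.⊖ suc n ⟧           ≡⟨ ≡.cong ⟦_⟧ (ℤₚ.[1+m]⊖[1+n]≡m⊖n m n) ⟩
    ⟦ m ℤ.⊖ n ⟧                   ≈⟨ ⟦⟧-⊖ m n ⟩
    # m - # n                   ≈⟨ +-congˡ (+-identityˡ _) ⟨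
    # m + (0# - # n)            ≈⟨ +-congˡ (+-congʳ (-‿inverseʳ 1#)) ⟨
    # m + (1# - 1# - # n)       ≈⟨ +-congˡ (+-assoc _ _ _) ⟩
    # m + (1# + (- 1# - # n))   ≈⟨ +-assoc _ _ _ ⟨
    # m + 1# + (- 1# - # n)     ≈⟨ +-cong (trans (+-comm _ _) (sym (#-suc m)))
        (trans (⁻¹-∙-comm _ _) (-‿cong (sym (#-suc n)))) ⟩
    # (suc m) - # (suc n)       ∎

  ⟦⟧-- : ∀ i → ⟦ ℤ.- i ⟧ ≈ - ⟦ i ⟧
  ⟦⟧-- (+ zero) = sym -0#≈0#
  ⟦⟧-- (+ suc n) = refl
  ⟦⟧-- -[1+ n ] = sym (-‿involutive _)

  ⟦⟧-+ : ∀ i j → ⟦ i ℤ.+ j ⟧ ≈ ⟦ i ⟧ + ⟦ j ⟧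
  ⟦⟧-+ (+ m) (+ n) = #-+ m n
  ⟦⟧-+ (+ m) -[1+ n ] = ⟦⟧-⊖ m (suc n)
  ⟦⟧-+ -[1+ m ] (+ n) = trans (⟦⟧-⊖ n (suc m)) (+-comm _ _)
  ⟦⟧-+ -[1+ m ] -[1+ n ] = begin
    - # (suc (suc (m ℕ.+ n)))   ≈⟨ -‿cong (#-cong (≡.cong suc (ℕₚ.+-suc m n))) ⟨
    - # (suc m ℕ.+ suc n)       ≈⟨ -‿cong (#-+ (suc m) (suc n)) ⟩
    - (# (suc m) + # (suc n))   ≈⟨ ⁻¹-∙-comm _ _ ⟨
    - # (suc m) - # (suc n)     ∎

  ⟦⟧-* : ∀ i j → ⟦ i ℤ.* j ⟧ ≈ ⟦ i ⟧ * ⟦ j ⟧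
  ⟦⟧-* (+ m) (+ n) = trans (reflexive (≡.cong ⟦_⟧ (≡.sym (ℤₚ.pos-* m n)))) (#-* m n)
  ⟦⟧-* (+ m) -[1+ n ] = begin
    ⟦ + m ℤ.* -[1+ n ] ⟧         ≡⟨ ≡.cong ⟦_⟧ (ℤₚ.neg-distribʳ-* (+ m) (+ suc n)) ⟨
    ⟦ ℤ.- (+ m ℤ.* + suc n) ⟧    ≈⟨ ⟦⟧-- (+ m ℤ.* + suc n) ⟩
    - ⟦ + m ℤ.* + suc n ⟧        ≈⟨ -‿cong (⟦⟧-* (+ m) (+ suc n)) ⟩
    - (# m * # (suc n))          ≈⟨ -‿distribʳ-* _ _ ⟩
    # m * - # (suc n)            ∎
  ⟦⟧-* -[1+ m ] (+ n) = begin
    ⟦ -[1+ m ] ℤ.* + n ⟧         ≡⟨ ≡.cong ⟦_⟧ (ℤₚ.neg-distribˡ-* (+ suc m) (+ n)) ⟨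
    ⟦ ℤ.- (+ suc m ℤ.* + n) ⟧    ≈⟨ ⟦⟧-- (+ suc m ℤ.* + n) ⟩
    - ⟦ + suc m ℤ.* + n ⟧        ≈⟨ -‿cong (⟦⟧-* (+ suc m) (+ n)) ⟩
    - (# (suc m) * # n)          ≈⟨ -‿distribˡ-* _ _ ⟩
    - # (suc m) * # n            ∎
  ⟦⟧-* -[1+ m ] -[1+ n ] = begin
    # (suc m ℕ.* suc n)            ≈⟨ #-* (suc m) (suc n) ⟩
    # (suc m) * # (suc n)          ≈⟨ -‿involutive _ ⟨
    - - (# (suc m) * # (suc n))    ≈⟨ -‿cong (-‿distribˡ-* _ _) ⟩
    - (- # (suc m) * # (suc n))    ≈⟨ -‿distribʳ-* _ _ ⟩
    - # (suc m) * - # (suc n)      ∎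

  open import Algebra.Solver.Ring.AlmostCommutativeRing using (fromCommutativeRing; _-Raw-AlmostCommutative⟶_)

  private
    ℤ⟶R : ℤ.+-*-rawRing -Raw-AlmostCommutative⟶ fromCommutativeRing R
    ℤ⟶R = record
      { ⟦_⟧ = ⟦_⟧ ; +-homo = ⟦⟧-+ ; *-homo = ⟦⟧-* ; -‿homo = ⟦⟧-- ; 0-homo = refl ; 1-homo = refl }

    _coeff≟_ : ∀ i j → Maybe (⟦ i ⟧ ≈ ⟦ j ⟧)
    i coeff≟ j with i ℤ.≟ j
    ... | yes ≡.refl = just refl
    ... | no _       = nothing

  open import Algebra.Solver.Ring ℤ.+-*-rawRing (fromCommutativeRing R) ℤ⟶R _coeff≟_ public
    using (solve; _:=_; _:+_; _:*_; _:-_; :-_; _:^_; con; Polynomial)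

  :# : ∀ {n} → ℕ → Polynomial n
  :# k = con (+ k)

  -- Certificates s ≈ 0# for linear combinations s of known equations.
  infixl 6 _⊞_
  infix 7 _⊡_

  _⊡_ : ∀ k {l r} → l ≈ r → k * (l - r) ≈ 0#
  k ⊡ h = trans (*-congˡ (trans (+-congʳ h) (-‿inverseʳ _))) (zeroʳ k)

  _⊞_ : ∀ {s t} → s ≈ 0# → t ≈ 0# → s + t ≈ 0#
  hs ⊞ ht = trans (+-cong hs ht) (+-identityʳ 0#)

  -- Ideal membership as a proof rule: the ring solver checks that `a - b` equals a combination ∑ k
  -- (l - r) of differences of known equations, and the certificate says that this combination
  -- vanishes. In each use below, the factor to the left of `⊡` is the cofactor of the equation to
  -- its right, so the certificate shows how the hypotheses are combined.
  lincomb : ∀ {a b s} → a - b ≈ s → s ≈ 0# → a ≈ b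
  lincomb h hs = x∙y⁻¹≈ε⇒x≈y _ _ (trans h hs)

-- Finite sums and the binomial theorem

module FiniteSums {c ℓ} (R : CommutativeRing c ℓ) where
  open import Data.Nat.Combinatorics.Specification using (k>n⇒nCk≡0)
  open RingCalculus R
  open import Relation.Binary.Reasoning.Setoid setoid

  ∑ : ℕ → (ℕ → Carrier) → Carrier
  ∑ zero    f = 0#
  ∑ (suc n) f = ∑ n f + f n

  ∑-cong : ∀ n {f g} → (∀ k → k < n → f k ≈ g k) → ∑ n f ≈ ∑ n g
  ∑-cong zero    h = refl
  ∑-cong (suc n) h = +-cong (∑-cong n λ k k<n → h k (ℕₚ.m<n⇒m<1+n k<n)) (h n (ℕₚ.n<1+n n))

  ∑-0 : ∀ n {f} → (∀ k → k < n → f k ≈ 0#) → ∑ n f ≈ 0#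
  ∑-0 zero    h = refl
  ∑-0 (suc n) h = trans (+-cong (∑-0 n λ k k<n → h k (ℕₚ.m<n⇒m<1+n k<n)) (h n (ℕₚ.n<1+n n))) (+-identityʳ 0#)

  ∑-+ : ∀ n f g → ∑ n (λ k → f k + g k) ≈ ∑ n f + ∑ n g
  ∑-+ zero    f g = sym (+-identityʳ 0#)
  ∑-+ (suc n) f g = trans (+-congʳ (∑-+ n f g))
    (solve 4 (λ a b u v → (a :+ b) :+ (u :+ v) := (a :+ u) :+ (b :+ v)) refl (∑ n f) (∑ n g) (f n) (g n))

  ∑-*ˡ : ∀ n c f → ∑ n (λ k → c * f k) ≈ c * ∑ n f
  ∑-*ˡ zero    c f = sym (zeroʳ c)
  ∑-*ˡ (suc n) c f = trans (+-congʳ (∑-*ˡ n c f)) (sym (distribˡ c _ _))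

  ∑-lin : ∀ n a b f g → ∑ n (λ k → a * f k + b * g k) ≈ a * ∑ n f + b * ∑ n g
  ∑-lin n a b f g = trans (∑-+ n _ _) (+-cong (∑-*ˡ n a f) (∑-*ˡ n b g))

  ∑-shift : ∀ n f → ∑ (suc n) f ≈ f 0 + ∑ n (λ k → f (suc k))
  ∑-shift zero    f = +-comm _ _
  ∑-shift (suc n) f = trans (+-congʳ (∑-shift n f)) (+-assoc _ _ _)

  ∑-split : ∀ m n f → ∑ (m ℕ.+ n) f ≈ ∑ m f + ∑ n (λ k → f (m ℕ.+ k))
  ∑-split zero    n f = sym (+-identityˡ _)
  ∑-split (suc m) n f = begin
    ∑ (suc (m ℕ.+ n)) f                                                 ≈⟨ ∑-shift (m ℕ.+ n) f ⟩
    f 0 + ∑ (m ℕ.+ n) (λ k → f (suc k))                                 ≈⟨ +-congˡ (∑-split m n _) ⟩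
    f 0 + (∑ m (λ k → f (suc k)) + ∑ n (λ k → f (suc m ℕ.+ k)))         ≈⟨ +-assoc _ _ _ ⟨
    (f 0 + ∑ m (λ k → f (suc k))) + ∑ n (λ k → f (suc m ℕ.+ k))         ≈⟨ +-congʳ (∑-shift m f) ⟨
    ∑ (suc m) f + ∑ n (λ k → f (suc m ℕ.+ k))                           ∎

  ∑-rev : ∀ n f → ∑ n f ≈ ∑ n (λ k → f (n ∸ suc k))
  ∑-rev zero    f = refl
  ∑-rev (suc n) f = begin
    ∑ n f + f n                          ≈⟨ +-comm _ _ ⟩
    f n + ∑ n f                          ≈⟨ +-congˡ (∑-rev n f) ⟩
    f n + ∑ n (λ k → f (n ∸ suc k))      ≈⟨ ∑-shift n (λ k → f (n ∸ k)) ⟨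
    ∑ (suc n) (λ k → f (n ∸ k))          ∎

  ∑-swap : ∀ m n (f : ℕ → ℕ → Carrier) → ∑ m (λ i → ∑ n (f i)) ≈ ∑ n (λ j → ∑ m (λ i → f i j))
  ∑-swap zero    n f = sym (∑-0 n {λ _ → 0#} λ _ _ → refl)
  ∑-swap (suc m) n f = trans (+-congʳ (∑-swap m n f)) (sym (∑-+ n _ (f m)))

  ∑-telescope : ∀ n (f g : ℕ → Carrier) → (∀ k → k < n → g (suc k) ≈ g k + f k) → g n ≈ g 0 + ∑ n f
  ∑-telescope zero    f g h = sym (+-identityʳ (g 0))
  ∑-telescope (suc n) f g h = begin
    g (suc n)             ≈⟨ h n (ℕₚ.n<1+n n) ⟩
    g n + f n             ≈⟨ +-congʳ (∑-telescope n f g λ k k<n → h k (ℕₚ.m<n⇒m<1+n k<n)) ⟩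
    g 0 + ∑ n f + f n     ≈⟨ +-assoc _ _ _ ⟩
    g 0 + ∑ (suc n) f     ∎

  bin : ℕ → ℕ → Carrier
  bin n k = # (n C k)

  bin-pascal : ∀ n k → bin (suc n) (suc k) ≈ bin n k + bin n (suc k)
  bin-pascal n k = trans (#-cong (≡.sym (nCk+nC[k+1]≡[n+1]C[k+1] n k))) (#-+ (n C k) (n C suc k))

  bin-beyond : ∀ n → bin n (suc n) ≈ 0#
  bin-beyond n = #-cong (k>n⇒nCk≡0 (ℕₚ.n<1+n n))

  bin-0 : ∀ n → bin n 0 ≈ 1#
  bin-0 n = refl

  bin-n : ∀ n → bin n n ≈ 1#
  bin-n n = #-cong (nCn≡1 n)

  -- The binomial theorem for the operator 1 + E, where E is the shift of the second argument.
  umbral : (D : ℕ → ℕ → Carrier) → (∀ n j → D (suc n) j ≈ D n j + D n (suc j)) →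
           ∀ n j → D n j ≈ ∑ (suc n) (λ k → bin n k * D 0 (j ℕ.+ k))
  umbral D step zero j = begin
    D 0 j                            ≈⟨ *-identityˡ _ ⟨
    1# * D 0 j                       ≈⟨ *-cong (bin-0 0) (reflexive (≡.cong (D 0) (ℕₚ.+-identityʳ j))) ⟨
    bin 0 0 * D 0 (j ℕ.+ 0)          ≈⟨ +-identityˡ _ ⟨
    ∑ 1 (λ k → bin 0 k * D 0 (j ℕ.+ k))     ∎
  umbral D step (suc n) j = begin
    D (suc n) j
      ≈⟨ step n j ⟩
    D n j + D n (suc j)
      ≈⟨ +-cong (umbral D step n j) (umbral D step n (suc j)) ⟩
    ∑ (suc n) (λ k → bin n k * D 0 (j ℕ.+ k)) + ∑ (suc n) (λ k → bin n k * D 0 (suc j ℕ.+ k))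
      ≈⟨ +-cong extend (∑-cong (suc n) λ k _ → *-congˡ (reflexive (≡.cong (D 0) (≡.sym (ℕₚ.+-suc j k))))) ⟩
    (bin n 0 * D 0 (j ℕ.+ 0) + ∑ (suc n) (λ k → bin n (suc k) * a k)) + ∑ (suc n) (λ k → bin n k * a k)
      ≈⟨ +-assoc _ _ _ ⟩
    bin n 0 * D 0 (j ℕ.+ 0) + (∑ (suc n) (λ k → bin n (suc k) * a k) + ∑ (suc n) (λ k → bin n k * a k))
      ≈⟨ +-cong (*-congʳ (trans (bin-0 n) (sym (bin-0 (suc n))))) (sym (∑-+ (suc n) _ _)) ⟩
    bin (suc n) 0 * D 0 (j ℕ.+ 0) + ∑ (suc n) (λ k → bin n (suc k) * a k + bin n k * a k)
      ≈⟨ +-congˡ (∑-cong (suc n) λ k _ → trans (sym (distribʳ _ _ _))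
          (*-congʳ (trans (+-comm _ _) (sym (bin-pascal n k))))) ⟩
    bin (suc n) 0 * D 0 (j ℕ.+ 0) + ∑ (suc n) (λ k → bin (suc n) (suc k) * a k)
      ≈⟨ ∑-shift (suc n) _ ⟨
    ∑ (suc (suc n)) (λ k → bin (suc n) k * D 0 (j ℕ.+ k)) ∎
    where
    a : ℕ → Carrier
    a k = D 0 (j ℕ.+ suc k)
    extend : ∑ (suc n) (λ k → bin n k * D 0 (j ℕ.+ k)) ≈ bin n 0 * D 0 (j ℕ.+ 0) + ∑ (suc n)
        (λ k → bin n (suc k) * a k)
    extend = begin
      ∑ (suc n) (λ k → bin n k * D 0 (j ℕ.+ k))
        ≈⟨ +-identityʳ _ ⟨
      ∑ (suc n) (λ k → bin n k * D 0 (j ℕ.+ k)) + 0#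
        ≈⟨ +-congˡ (trans (*-congʳ (bin-beyond n)) (zeroˡ _)) ⟨
      ∑ (suc (suc n)) (λ k → bin n k * D 0 (j ℕ.+ k))
        ≈⟨ ∑-shift (suc n) _ ⟩
      bin n 0 * D 0 (j ℕ.+ 0) + ∑ (suc n) (λ k → bin n (suc k) * a k) ∎

  -- `umbral` applied to D n j = (1 + z)ⁿ zʲ, on which the shift of j is multiplication by z.
  binomial : ∀ z n → (1# + z) ^ n ≈ ∑ (suc n) (λ k → bin n k * z ^ k)
  binomial z n = begin
    (1# + z) ^ n                               ≈⟨ *-identityʳ _ ⟨
    D n 0                                      ≈⟨ umbral D step n 0 ⟩
    ∑ (suc n) (λ k → bin n k * (1# * z ^ k))   ≈⟨ ∑-cong (suc n) (λ k _ → *-congˡ (*-identityˡ _)) ⟩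
    ∑ (suc n) (λ k → bin n k * z ^ k)          ∎
    where
    D : ℕ → ℕ → Carrier
    D n j = (1# + z) ^ n * z ^ j
    step : ∀ n j → D (suc n) j ≈ D n j + D n (suc j)
    step n j = solve 3 (λ z u v → (:# 1 :+ z) :* u :* v := u :* v :+ u :* (z :* v))
        refl z ((1# + z) ^ n) (z ^ j)

-- Exact expansion of the Lucas quotient

module LucasQuotient {c ℓ} (R : CommutativeRing c ℓ) where
  open BinomialCoefficients
  open RingCalculus R
  open FiniteSums R
  open import Relation.Binary.Reasoning.Setoid setoid

  module _ {x y : Carrier} (x+y : x + y ≈ 1#) (x*y : x * y ≈ - 1#) where
    binet : ∀ k → # (lucas k) ≈ x ^ k + y ^ k
    binet zero          = refl
    binet (suc zero)    = lincomb (solve 2 (λ x y → :# 1 :- (x :* :# 1 :+ y :* :# 1)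
        := :- :# 1 :* (x :+ y :- :# 1)) refl x y) (- 1# ⊡ x+y)
    binet (suc (suc k)) = lincomb (solve 7 (λ x y v w l l1 l0 → l :- (x :* (x :* v) :+ y :* (y :* w))
        := :# 1 :* (l :- (l1 :+ l0)) :+ :# 1 :* (l1 :- (x :* v :+ y :* w)) :+ :# 1 :* (l0 :- (v :+ w))
        :+ (:- x :* v :- y :* w) :* (x :+ y :- :# 1) :+ (v :+ w) :* (x :* y :- :- :# 1))
        refl x y (x ^ k) (y ^ k) (# (lucas (suc (suc k)))) (# (lucas (suc k))) (# (lucas k)))
        (1# ⊡ #-+ (lucas (suc k)) (lucas k) ⊞ 1# ⊡ binet (suc k) ⊞ 1# ⊡ binet k
        ⊞ (- x * (x ^ k) - y * (y ^ k)) ⊡ x+y ⊞ ((x ^ k) + (y ^ k)) ⊡ x*y)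

    1≤lucas : ∀ k → 1 ≤ lucas k
    1≤lucas zero          = s≤s z≤n
    1≤lucas (suc zero)    = s≤s z≤n
    1≤lucas (suc (suc k)) = ℕₚ.≤-trans (1≤lucas (suc k)) (ℕₚ.m≤m+n _ _)

    -- With y = 1 - x, Binet gives L_p = xᵖ + (1 - x)ᵖ. As p is odd, the last binomial term -xᵖ
    -- cancels the first summand, and C(p, k) = (p/k) C(p - 1, k - 1) lets p be divided out of what
    -- remains after 1. The range of `r-inv` includes p itself, so this is meant for ℚ(√5) and not
    -- for the ring modulo p; the right side involves only the inverses of 1, ..., p - 1.
    lucas-quotient : ∀ m h → suc m ≡ suc (h ℕ.+ h) → (r : ℕ → Carrier)
        → (∀ k → k < suc m → # (suc k) * r k ≈ 1#) →
                     # (lucas (suc m) ∸ 1) * r m ≈ ∑ m (λ k → r k * (bin m k * (- x) ^ suc k))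
    lucas-quotient m h p-odd r r-inv = lincomb
        (solve 12 (λ l l2 r S p v w w2 T T2 b z → l :* r :- S := :- r :* (l2 :- (:# 1 :+ l))
        :+ r :* (l2 :- (v :+ w)) :+ r :* (w :- w2) :+ r :* (w2 :- (T :+ b :* z))
        :+ r :* (T :- (:# 1 :* :# 1 :+ T2)) :+ r :* z :* (b :- :# 1) :+ r :* (z :- :- v) :+ r :* (T2 :- p :* S)
        :+ S :* (p :* r :- :# 1)) refl (# (lucas p ∸ 1)) (# (lucas p)) (r m)
        (∑ m (λ k → r k * (bin m k * (- x) ^ suc k))) (# p) (x ^ p) (y ^ p) ((1# + - x) ^ p)
        (∑ p (λ k → bin p k * (- x) ^ k)) (∑ m (λ k → bin p (suc k) * (- x) ^ suc k)) (bin p p) ((- x) ^ p))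
        (- r m ⊡ trans (#-cong (≡.sym (ℕₚ.m+[n∸m]≡n (1≤lucas p)))) (#-suc (lucas p ∸ 1)) ⊞ r m ⊡ binet p
        ⊞ r m ⊡ ^-congˡ p (lincomb (solve 2 (λ x y → y :- (:# 1 :+ :- x) := :# 1 :* (x :+ y :- :# 1)) refl x y)
        (1# ⊡ x+y)) ⊞ r m ⊡ binomial (- x) p ⊞ r m ⊡ ∑-shift m _ ⊞ (r m * ((- x) ^ p)) ⊡ bin-n p ⊞ r m ⊡ odd
        ⊞ r m ⊡ trans (∑-cong m term) (∑-*ˡ m (# p) _)
        ⊞ ∑ m (λ k → r k * (bin m k * (- x) ^ suc k)) ⊡ r-inv m (ℕₚ.n<1+n m))
      where
      p = suc m
      odd : (- x) ^ p ≈ - x ^ p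
      odd = begin
        (- x) ^ p                          ≡⟨ ≡.cong ((- x) ^_) p-odd ⟩
        - x * (- x) ^ (h ℕ.+ h)            ≈⟨ *-congˡ (even h) ⟩
        - x * x ^ (h ℕ.+ h)                ≈⟨ -‿distribˡ-* _ _ ⟨
        - x ^ suc (h ℕ.+ h)                ≡⟨ ≡.cong (λ q → - x ^ q) p-odd ⟨
        - x ^ p                            ∎
        where
        even : ∀ h → (- x) ^ (h ℕ.+ h) ≈ x ^ (h ℕ.+ h)
        even h = begin
          (- x) ^ (h ℕ.+ h)            ≈⟨ ^-homo-* (- x) h h ⟩
          (- x) ^ h * (- x) ^ h        ≈⟨ ^-distrib-* (- x) (- x) h ⟨
          (- x * - x) ^ h              ≈⟨ ^-congˡ h ((solve 1 (λ x → :- x :* :- x := x :* x) refl x)) ⟩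
          (x * x) ^ h                  ≈⟨ ^-distrib-* x x h ⟩
          x ^ h * x ^ h                ≈⟨ ^-homo-* x h h ⟨
          x ^ (h ℕ.+ h)                ∎
      term : ∀ k → k < m → bin p (suc k) * (- x) ^ suc k ≈ # p * (r k * (bin m k * (- x) ^ suc k))
      term k k<m = lincomb (solve 6 (λ B z p r b K → B :* z :- p :* (r :* (b :* z))
          := :- B :* z :* (K :* r :- :# 1) :+ r :* z :* (K :* B :- p :* b))
          refl (bin p (suc k)) ((- x) ^ suc k) (# p) (r k) (bin m k) (# (suc k)))
          ((- bin p (suc k) * ((- x) ^ suc k)) ⊡ r-inv k (ℕₚ.m<n⇒m<1+n k<m)
          ⊞ (r k * ((- x) ^ suc k)) ⊡ trans (sym (#-* (suc k) (p C suc k)))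
          (trans (#-cong (C-absorption m k)) (#-* p (m C k))))

-- Fermat, Frobenius and Bernoulli-type recurrences in characteristic p

module PrimeCharacteristic {c ℓ} (R : CommutativeRing c ℓ) (n : ℕ) (p-prime : Prime (suc (suc n)))
  (char : CommutativeRing._≈_ R (RingCalculus.# R (suc (suc n))) (CommutativeRing.0# R)) (3<n : 3 < n) where
  open BinomialCoefficients
  open RingCalculus R
  open FiniteSums R
  open import Data.List using (List; []; _∷_)
  open import Data.Nat.DivMod using (_/_; _%_; m≡m%n+[m/n]*n; m%n<n)
  open import Data.Nat.Tactic.RingSolver using (solve-∀)
  open import Relation.Binary.Reasoning.Setoid setoid

  m p : ℕ
  m = suc n
  p = suc m

  #-∣p : ∀ {k} → p ∣ k → # k ≈ 0#
  #-∣p {k} (divides q ≡.refl) = trans (#-* q p) (trans (*-congˡ char) (zeroʳ _))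

  bin-p : ∀ k → k < m → bin p (suc k) ≈ 0#
  bin-p k k<m with euclidsLemma (suc k) (p C suc k) p-prime
      (divides (m C k) (≡.trans (C-absorption m k) (ℕₚ.*-comm p (m C k))))
  ... | inj₁ p∣1+k = ⊥-elim (ℕₚ.<⇒≱ (s<s k<m) (∣⇒≤ p∣1+k))
  ... | inj₂ p∣pCk = #-∣p p∣pCk

  -- For the shift E this is (1 + E)ᵖ = 1 + Eᵖ. It is stated for arbitrary arrays because it serves
  -- twice: for powers in `[1+z]^p`, and for the traces ζᵏ + ζ⁻ᵏ in `Frobenius`.
  umbral-p : (D : ℕ → ℕ → Carrier) → (∀ n j → D (suc n) j ≈ D n j + D n (suc j)) →
             ∀ j → D p j ≈ D 0 j + D 0 (j ℕ.+ p)
  umbral-p D step j = begin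
    D p j
      ≈⟨ umbral D step p j ⟩
    ∑ p (λ k → bin p k * D 0 (j ℕ.+ k)) + bin p p * D 0 (j ℕ.+ p)
      ≈⟨ +-cong (∑-shift m _) (trans (*-congʳ (bin-n p)) (*-identityˡ _)) ⟩
    1# * D 0 (j ℕ.+ 0) + ∑ m (λ k → bin p (suc k) * D 0 (j ℕ.+ suc k)) + D 0 (j ℕ.+ p)
      ≈⟨ +-congʳ (+-cong (trans (*-identityˡ _) (reflexive (≡.cong (D 0) (ℕₚ.+-identityʳ j))))
          (∑-0 m λ k k<m → trans (*-congʳ (bin-p k k<m)) (zeroˡ _))) ⟩
    D 0 j + 0# + D 0 (j ℕ.+ p)
      ≈⟨ +-congʳ (+-identityʳ _) ⟩
    D 0 j + D 0 (j ℕ.+ p) ∎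

  [1+z]^p : ∀ z → (1# + z) ^ p ≈ 1# + z ^ p
  [1+z]^p z = begin
    (1# + z) ^ p                  ≈⟨ *-identityʳ _ ⟨
    (1# + z) ^ p * z ^ 0          ≈⟨ umbral-p D step 0 ⟩
    1# * 1# + 1# * z ^ p          ≈⟨ +-cong (*-identityˡ _) (*-identityˡ _) ⟩
    1# + z ^ p                    ∎
    where
    D : ℕ → ℕ → Carrier
    D n j = (1# + z) ^ n * z ^ j
    step : ∀ n j → D (suc n) j ≈ D n j + D n (suc j)
    step n j = solve 3 (λ z u v → (:# 1 :+ z) :* u :* v := u :* v :+ u :* (z :* v))
        refl z ((1# + z) ^ n) (z ^ j)

  #k^p : ∀ k → # k ^ p ≈ # k
  #k^p zero = zeroˡ _
  #k^p (suc k) = begin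
    # (suc k) ^ p       ≈⟨ ^-congˡ p (#-suc k) ⟩
    (1# + # k) ^ p      ≈⟨ [1+z]^p (# k) ⟩
    1# + # k ^ p        ≈⟨ +-congˡ (#k^p k) ⟩
    1# + # k            ≈⟨ #-suc k ⟨
    # (suc k)           ∎

  #-invertible : ∀ k → k < m → ∃ λ u → # (suc k) * u ≈ 1#
  #-invertible k k<m with coprime-Bézout (prime⇒coprime p-prime (s<s k<m))
  ... | Bézout.+- x y eq = - # y , lincomb
      (solve 4 (λ k x y p → k :* (:- y) :- :# 1 := :- :# 1 :* ((:# 1 :+ y :* k) :- x :* p)
          :+ :- x :* (p :- :# 0)) refl (# (suc k)) (# x) (# y) (# p))
      ((- 1#) ⊡ eq′ ⊞ (- # x) ⊡ char)
    where
    eq′ : 1# + # y * # (suc k) ≈ # x * # p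
    eq′ = trans (+-congˡ (sym (#-* y (suc k))))
        (trans (sym (#-suc (y ℕ.* suc k))) (trans (#-cong eq) (#-* x p)))
  ... | Bézout.-+ x y eq = # y , lincomb
      (solve 4 (λ k x y p → k :* y :- :# 1 := (:- :# 1) :* ((:# 1 :+ x :* p) :- y :* k) :+ x :* (p :- :# 0))
          refl (# (suc k)) (# x) (# y) (# p))
      ((- 1#) ⊡ eq′ ⊞ # x ⊡ char)
    where
    eq′ : 1# + # x * # p ≈ # y * # (suc k)
    eq′ = trans (+-congˡ (sym (#-* x p))) (trans (sym (#-suc (x ℕ.* p))) (trans (#-cong eq) (#-* y (suc k))))

  -- As a power, `inv` is total with value 0 at 0, multiplicative, and dependent on k only through
  -- `# k`. The laws at -k and at 2k (`inv-neg`, `inv-double`) thus come from the laws of exponents.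
  inv : ℕ → Carrier
  inv k = # k ^ n

  -- Fermat gives only k · k · k^(p - 2) = k. Since R may have zero divisors, one factor k is
  -- cancelled with the inverse supplied by Bézout.
  #k*inv : ∀ k → k < m → # (suc k) * inv (suc k) ≈ 1#
  #k*inv k k<m with #-invertible k k<m
  ... | u , ku≈1 = lincomb
    (solve 3 (λ k u i → k :* i :- :# 1 := u :* (k :* (k :* i) :- k) :+ (:# 1 :- k :* i) :* (k :* u :- :# 1))
        refl (# (suc k)) u (inv (suc k)))
    (u ⊡ #k^p (suc k) ⊞ (1# - # (suc k) * inv (suc k)) ⊡ ku≈1)

  inv-unique : ∀ k u → k < m → # (suc k) * u ≈ 1# → u ≈ inv (suc k)
  inv-unique k u k<m h = lincomb
    (solve 3 (λ k u i → u :- i := i :* (k :* u :- :# 1) :+ (:- u) :* (k :* i :- :# 1))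
        refl (# (suc k)) u (inv (suc k)))
    (inv (suc k) ⊡ h ⊞ (- u) ⊡ #k*inv k k<m)

  #-cancel : ∀ k {a b} → k < m → # (suc k) * a ≈ # (suc k) * b → a ≈ b
  #-cancel k {a} {b} k<m h = lincomb
    (solve 4 (λ k i a b → a :- b := i :* (k :* a :- k :* b) :+ (b :- a) :* (k :* i :- :# 1))
        refl (# (suc k)) (inv (suc k)) a b)
    (inv (suc k) ⊡ h ⊞ (b - a) ⊡ #k*inv k k<m)

  sgn : ℕ → Carrier
  sgn k = (- 1#) ^ k

  -- The inner entries of row p vanish, so by Pascal's rule neighbouring entries of row p - 1 are
  -- opposite.
  bin-m : ∀ k → k ≤ m → bin m k ≈ sgn k
  bin-m zero _ = refl
  bin-m (suc k) 1+k≤m = lincomb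
    (solve 4 (λ b s c d → c :- :- :# 1 :* s := (:- :# 1) :* (d :- (b :+ c)) :+ :# 1 :* (d :- :# 0)
        :+ (:- :# 1) :* (b :- s)) refl (bin m k) (sgn k) (bin m (suc k)) (bin p (suc k)))
    ((- 1#) ⊡ bin-pascal m k ⊞ 1# ⊡ bin-p k 1+k≤m ⊞ (- 1#) ⊡ bin-m k (ℕₚ.<⇒≤ 1+k≤m))

  -- The parity of p - 1, read off from C(p - 1, p - 1) = 1.
  sgn-m : sgn m ≈ 1#
  sgn-m = trans (sym (bin-m m ℕₚ.≤-refl)) (bin-n m)

  sgn-n : sgn n ≈ - 1#
  sgn-n = lincomb (solve 1 (λ s → s :- :- :# 1 := (:- :# 1) :* (:- :# 1 :* s :- :# 1)) refl (sgn n))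
      ((- 1#) ⊡ sgn-m)

  sgn² : ∀ k → sgn k * sgn k ≈ 1#
  sgn² zero = *-identityˡ _
  sgn² (suc k) = trans (solve 1 (λ s → (:- :# 1 :* s) :* (:- :# 1 :* s) := s :* s) refl (sgn k)) (sgn² k)

  neg-^ : ∀ z k → (- z) ^ k ≈ sgn k * z ^ k
  neg-^ z k = trans (^-congˡ k (solve 1 (λ z → :- z := :- :# 1 :* z) refl z)) (^-distrib-* _ _ k)

  neg-^p : ∀ z → (- z) ^ p ≈ - (z ^ p)
  neg-^p z = lincomb (solve 3 (λ s w u → u :- :- w := :# 1 :* (u :- (:- :# 1 :* s) :* w)
      :+ (:- w) :* (s :- :# 1)) refl (sgn m) (z ^ p) ((- z) ^ p))
     (1# ⊡ neg-^ z p ⊞ (- (z ^ p)) ⊡ sgn-m)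

  inv-neg : ∀ a b → # a ≈ - # b → inv a ≈ - inv b
  inv-neg a b h = begin
    # a ^ n             ≈⟨ ^-congˡ n h ⟩
    (- # b) ^ n         ≈⟨ neg-^ _ n ⟩
    sgn n * inv b       ≈⟨ *-congʳ sgn-n ⟩
    - 1# * inv b        ≈⟨ solve 1 (λ b → :- :# 1 :* b := :- b) refl (inv b) ⟩
    - inv b             ∎

  #-reflect : ∀ a b → a ℕ.+ b ≡ p → # a ≈ - # b
  #-reflect a b h = lincomb (solve 2 (λ a b → a :- :- b := :# 1 :* (a :+ b :- :# 0)) refl (# a) (# b))
    (1# ⊡ trans (sym (#-+ a b)) (trans (#-cong h) char))

  inv-reflect : ∀ a b → a ℕ.+ b ≡ p → inv a ≈ - inv b
  inv-reflect a b h = inv-neg a b (#-reflect a b h)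

  bin-pred : ∀ k → bin (suc k) k ≈ # (suc k)
  bin-pred k = #-cong ([1+n]Cn≡1+n k)

  -- The left side of the Bernoulli recurrence, whose right side is 1 for N = 0 and 0 otherwise.
  bernoulli-sum : (ℕ → Carrier) → ℕ → Carrier
  bernoulli-sum f N = ∑ (suc N) (λ j → bin (suc N) j * f j)

  -- A triangular system: f_N enters with coefficient C(N + 1, N) = N + 1, which is invertible as
  -- long as N + 1 < p.
  bernoulli-unique : ∀ {f g} → (∀ N → N < m → bernoulli-sum f N ≈ bernoulli-sum g N) → ∀ N → N < m → f N ≈ g N
  bernoulli-unique {f} {g} h = <-rec (λ N → N < m → f N ≈ g N) λ N ih N<m →
    #-cancel N N<m (lincomb
      (solve 6 (λ u v b k f g → k :* f :- k :* g := :# 1 :* ((u :+ b :* f) :- (v :+ b :* g))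
          :+ (:- :# 1) :* (u :- v) :+ (g :- f) :* (b :- k)) refl
        (∑ N (λ j → bin (suc N) j * f j)) (∑ N (λ j → bin (suc N) j * g j)) (bin (suc N) N) (# (suc N)) (f N)
            (g N))
      (1# ⊡ h N N<m ⊞ (- 1#) ⊡ ∑-cong N (λ j j<N → *-congˡ (ih j<N (ℕₚ.<-trans j<N N<m)))
          ⊞ (g N - f N) ⊡ bin-pred N))

  moment : (ℕ → Carrier) → ℕ → Carrier
  moment w j = ∑ p (λ a → w a * # a ^ j)

  -- After exchanging the sums, the inner one is the expansion of (a + 1)^(N + 1) without its top
  -- term. The recurrence for moments thereby becomes a statement on differences, open to
  -- telescoping or summation by parts.
  moment-bernoulli-sum : ∀ w N → bernoulli-sum (moment w) N ≈ ∑ p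
      (λ a → w a * (# (suc a) ^ suc N - # a ^ suc N))
  moment-bernoulli-sum w N = begin
    ∑ (suc N) (λ j → bin (suc N) j * moment w j)
      ≈⟨ ∑-cong (suc N) (λ j _ → sym (∑-*ˡ p _ _)) ⟩
    ∑ (suc N) (λ j → ∑ p (λ a → bin (suc N) j * (w a * # a ^ j)))
      ≈⟨ ∑-swap (suc N) p _ ⟩
    ∑ p (λ a → ∑ (suc N) (λ j → bin (suc N) j * (w a * # a ^ j)))
      ≈⟨ ∑-cong p (λ a _ → trans (∑-cong (suc N) λ j _ → solve 3 (λ b w x → b :* (w :* x) := w :* (b :* x))
          refl (bin (suc N) j) (w a) (# a ^ j)) (∑-*ˡ (suc N) (w a) _)) ⟩
    ∑ p (λ a → w a * ∑ (suc N) (λ j → bin (suc N) j * # a ^ j))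
      ≈⟨ ∑-cong p (λ a _ → *-congˡ (inner a)) ⟩
    ∑ p (λ a → w a * (# (suc a) ^ suc N - # a ^ suc N)) ∎
    where
    inner : ∀ a → ∑ (suc N) (λ j → bin (suc N) j * # a ^ j) ≈ # (suc a) ^ suc N - # a ^ suc N
    inner a = lincomb
      (solve 5 (λ s t u x b → s :- (t :- x) := (:- :# 1) :* (t :- u) :+ (:- :# 1) :* (u :- (s :+ b :* x))
          :+ (:- x) :* (b :- :# 1)) refl
        (∑ (suc N) (λ j → bin (suc N) j * # a ^ j)) (# (suc a) ^ suc N) ((1# + # a) ^ suc N) (# a ^ suc N)
            (bin (suc N) (suc N)))
      ((- 1#) ⊡ ^-congˡ (suc N) (#-suc a) ⊞ (- 1#) ⊡ binomial (# a) (suc N) ⊞ (- (# a ^ suc N)) ⊡ bin-n (suc N))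

  -- For the weight 1 the differences telescope to p^(N + 1) = 0, so the moments solve the
  -- homogeneous Bernoulli recurrence and must vanish. The case N = 0 is included, its term at a = 0
  -- being 1.
  power-sum : ∀ N → N < m → ∑ p (λ a → # a ^ N) ≈ 0#
  power-sum N N<m = trans (∑-cong p λ a _ → sym (*-identityˡ _))
      (bernoulli-unique {moment (λ _ → 1#)} {λ _ → 0#} sums N N<m)
    where
    sums : ∀ N → N < m → bernoulli-sum (moment (λ _ → 1#)) N ≈ bernoulli-sum (λ _ → 0#) N
    sums N _ = begin
      bernoulli-sum (moment (λ _ → 1#)) N
        ≈⟨ moment-bernoulli-sum _ N ⟩
      ∑ p (λ a → 1# * (# (suc a) ^ suc N - # a ^ suc N))
        ≈⟨ +-identityˡ _ ⟨
      0# + ∑ p (λ a → 1# * (# (suc a) ^ suc N - # a ^ suc N))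
        ≈⟨ +-congʳ (zeroˡ _) ⟨
      # 0 ^ suc N + ∑ p (λ a → 1# * (# (suc a) ^ suc N - # a ^ suc N))
        ≈⟨ ∑-telescope p _ (λ a → # a ^ suc N)
            (λ a _ → solve 2 (λ s t → s := t :+ :# 1 :* (s :- t)) refl (# (suc a) ^ suc N) (# a ^ suc N)) ⟨
      # p ^ suc N
        ≈⟨ trans (*-congʳ char) (zeroˡ _) ⟩
      0#
        ≈⟨ ∑-0 (suc N) (λ j _ → zeroʳ _) ⟨
      bernoulli-sum (λ _ → 0#) N ∎

  #^-inv : ∀ d a → d ≤ n → a < m → # (suc a) ^ (m ∸ d) ≈ inv (suc a) ^ d
  #^-inv zero a _ a<m = #k*inv a a<m
  #^-inv (suc d) a d<n a<m = #-cancel a a<m (begin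
    # (suc a) ^ suc (n ∸ d)          ≡⟨ ≡.cong (# (suc a) ^_) (ℕₚ.+-∸-assoc 1 (ℕₚ.<⇒≤ d<n)) ⟨
    # (suc a) ^ (m ∸ d)              ≈⟨ #^-inv d a (ℕₚ.<⇒≤ d<n) a<m ⟩
    i ^ d                            ≈⟨ *-identityˡ _ ⟨
    1# * i ^ d                       ≈⟨ *-congʳ (#k*inv a a<m) ⟨
    # (suc a) * i * i ^ d            ≈⟨ *-assoc _ _ _ ⟩
    # (suc a) * i ^ suc d            ∎)
    where i = inv (suc a)

  0^ : ∀ {k} → 0 < k → 0# ^ k ≈ 0#
  0^ (s≤s _) = zeroˡ _

  inv-0 : inv 0 ≈ 0#
  inv-0 = 0^ (ℕₚ.≤-trans (s≤s z≤n) 3<n)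

  -- Negative powers are the positive powers k^(p - 1 - d); the bound d < p - 1 makes the added term
  -- at k = 0 vanish.
  sum-inv^ : ∀ d → 0 < d → d < m → ∑ m (λ k → inv (suc k) ^ d) ≈ 0#
  sum-inv^ (suc d) 0<d d<m = begin
    ∑ m (λ k → inv (suc k) ^ suc d)
      ≈⟨ ∑-cong m (λ k k<m → #^-inv (suc d) k (ℕₚ.≤-pred d<m) k<m) ⟨
    ∑ m (λ k → # (suc k) ^ (m ∸ suc d))
      ≈⟨ +-identityˡ _ ⟨
    0# + ∑ m (λ k → # (suc k) ^ (m ∸ suc d))
      ≈⟨ +-congʳ (0^ (ℕₚ.m<n⇒0<n∸m d<m)) ⟨
    # 0 ^ (m ∸ suc d) + ∑ m (λ k → # (suc k) ^ (m ∸ suc d))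
      ≈⟨ ∑-shift m _ ⟨
    ∑ p (λ k → # k ^ (m ∸ suc d))
      ≈⟨ power-sum (m ∸ suc d) (s≤s (ℕₚ.m∸n≤m n d)) ⟩
    0# ∎

  -- Harmonic sums modulo p

  H H₂ : ℕ → Carrier
  H zero     = 0#
  H (suc k)  = H k + inv (suc k)
  H₂ zero    = 0#
  H₂ (suc k) = H₂ k + inv (suc k) * inv (suc k)

  H≈∑ : ∀ k → H k ≈ ∑ k (λ j → inv (suc j) ^ 1)
  H≈∑ zero = refl
  H≈∑ (suc k) = +-cong (H≈∑ k) (sym (*-identityʳ _))

  H₂≈∑ : ∀ k → H₂ k ≈ ∑ k (λ j → inv (suc j) ^ 2)
  H₂≈∑ zero = refl
  H₂≈∑ (suc k) = +-cong (H₂≈∑ k) (*-congˡ (sym (*-identityʳ _)))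

  H-m : H m ≈ 0#
  H-m = trans (H≈∑ m) (sum-inv^ 1 z<s (s≤s (ℕₚ.≤-trans (s≤s z≤n) 3<n)))

  H₂-m : H₂ m ≈ 0#
  H₂-m = trans (H₂≈∑ m) (sum-inv^ 2 z<s (s≤s (ℕₚ.≤-trans (s≤s (s≤s z≤n)) 3<n)))

  ∑inv³ : ∑ m (λ k → inv (suc k) * inv (suc k) * inv (suc k)) ≈ 0#
  ∑inv³ = trans (∑-cong m λ k _ → (solve 1 (λ i → i :* i :* i := i :^ 3) refl (inv (suc k))))
      (sum-inv^ 3 z<s (s≤s (ℕₚ.≤-trans (s≤s (s≤s (s≤s z≤n))) 3<n)))

  -- By 1/(p - k) = -1/k, passing from (a, b + 1) to (a + 1, b) changes both sides by the same
  -- amount; the start is H_(p - 1) = 0.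
  H-reflect : ∀ a b → a ℕ.+ b ≡ m → H a ≈ H b
  H-reflect zero    b ≡.refl = sym H-m
  H-reflect (suc a) b e = lincomb (solve 4 (λ a i b j → a :+ i :- b := :# 1 :* (a :- (b :+ j))
      :+ :# 1 :* (j :- :- i)) refl (H a) (inv (suc a)) (H b) (inv (suc b)))
      (1# ⊡ H-reflect a (suc b) (≡.trans (ℕₚ.+-suc a b) e)
      ⊞ 1# ⊡ inv-reflect (suc b) (suc a) (≡.trans (ℕₚ.+-comm (suc b) (suc a))
      (≡.trans (ℕₚ.+-suc (suc a) b) (≡.cong suc e))))

  H₂-reflect : ∀ a b → a ℕ.+ b ≡ m → H₂ a ≈ - H₂ b
  H₂-reflect zero    b ≡.refl = lincomb (solve 1 (λ h → :# 0 :- :- h := :# 1 :* (h :- :# 0)) refl (H₂ m))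
      (1# ⊡ H₂-m)
  H₂-reflect (suc a) b e = lincomb (solve 4
      (λ a i b j → a :+ i :* i :- :- b := :# 1 :* (a :- :- (b :+ j :* j)) :+ :- (j :- i) :* (j :- :- i))
      refl (H₂ a) (inv (suc a)) (H₂ b) (inv (suc b)))
      (1# ⊡ H₂-reflect a (suc b) (≡.trans (ℕₚ.+-suc a b) e)
      ⊞ - (inv (suc b) - inv (suc a)) ⊡ inv-reflect (suc b) (suc a)
      (≡.trans (ℕₚ.+-comm (suc b) (suc a)) (≡.trans (ℕₚ.+-suc (suc a) b) (≡.cong suc e))))

  -- Newton's identities for h₂, e₂ and e₃ of 1, 1/2, …, 1/k.
  ∑H-inv : ∀ k → # 2 * ∑ k (λ j → H (suc j) * inv (suc j)) ≈ H k * H k + H₂ k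
  ∑H-inv zero = solve 1 (λ z → :# 2 :* :# 0 := :# 0 :* :# 0 :+ :# 0) refl 0#
  ∑H-inv (suc k) = lincomb (solve 4 (λ s h g i
      → :# 2 :* (s :+ (h :+ i) :* i) :- ((h :+ i) :* (h :+ i) :+ (g :+ i :* i))
      := :# 1 :* (:# 2 :* s :- (h :* h :+ g)))
      refl (∑ k (λ j → H (suc j) * inv (suc j))) (H k) (H₂ k) (inv (suc k))) (1# ⊡ ∑H-inv k)

  ∑inv-H : ∀ k → # 2 * ∑ k (λ j → inv (suc j) * H j) ≈ H k * H k - H₂ k
  ∑inv-H zero = solve 1 (λ z → :# 2 :* :# 0 := :# 0 :* :# 0 :- :# 0) refl 0#
  ∑inv-H (suc k) = lincomb (solve 4 (λ s h g i
      → :# 2 :* (s :+ i :* h) :- ((h :+ i) :* (h :+ i) :- (g :+ i :* i))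
      := :# 1 :* (:# 2 :* s :- (h :* h :- g))) refl (∑ k (λ j → inv (suc j) * H j)) (H k) (H₂ k) (inv (suc k)))
      (1# ⊡ ∑inv-H k)

  ∑e₂-inv : ∀ k → # 3 * ∑ k (λ j → (H j * H j - H₂ j) * inv (suc j)) ≈
            H k * H k * H k - # 3 * (H k * H₂ k) + # 2 * ∑ k (λ j → inv (suc j) * inv (suc j) * inv (suc j))
  ∑e₂-inv zero = solve 1 (λ z → :# 3 :* :# 0 := :# 0 :* :# 0 :* :# 0 :- :# 3 :* (:# 0 :* :# 0) :+ :# 2 :* :# 0)
      refl 0#
  ∑e₂-inv (suc k) = lincomb (solve 5 (λ s h g i t
      → :# 3 :* (s :+ (h :* h :- g) :* i) :-
      ((h :+ i) :* (h :+ i) :* (h :+ i) :- :# 3 :* ((h :+ i) :* (g :+ i :* i)) :+ :# 2 :* (t :+ i :* i :* i))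
      := :# 1 :* (:# 3 :* s :- (h :* h :* h :- :# 3 :* (h :* g) :+ :# 2 :* t)))
      refl (∑ k (λ j → (H j * H j - H₂ j) * inv (suc j))) (H k) (H₂ k) (inv (suc k))
      (∑ k (λ j → inv (suc j) * inv (suc j) * inv (suc j)))) (1# ⊡ ∑e₂-inv k)

  2-cancel : ∀ {a b} → # 2 * a ≈ # 2 * b → a ≈ b
  2-cancel = #-cancel 1 (s≤s (ℕₚ.≤-trans (s≤s z≤n) 3<n))

  3-cancel : ∀ {a b} → # 3 * a ≈ # 3 * b → a ≈ b
  3-cancel = #-cancel 2 (s≤s (ℕₚ.≤-trans (s≤s (s≤s z≤n)) 3<n))

  ∑inv-H-m : ∑ m (λ j → inv (suc j) * H j) ≈ 0#
  ∑inv-H-m = 2-cancel (lincomb (solve 3 (λ s h g → :# 2 :* s :- :# 2 :* :# 0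
      := :# 1 :* (:# 2 :* s :- (h :* h :- g)) :+ h :* (h :- :# 0) :+ :- :# 1 :* (g :- :# 0))
      refl (∑ m (λ j → inv (suc j) * H j)) (H m) (H₂ m)) (1# ⊡ ∑inv-H m ⊞ H m ⊡ H-m ⊞ - 1# ⊡ H₂-m))

  ∑e₂-inv-m : ∑ m (λ j → (H j * H j - H₂ j) * inv (suc j)) ≈ 0#
  ∑e₂-inv-m = 3-cancel (lincomb (solve 4 (λ s h g t → :# 3 :* s :- :# 3 :* :# 0
      := :# 1 :* (:# 3 :* s :- (h :* h :* h :- :# 3 :* (h :* g) :+ :# 2 :* t))
      :+ (h :* h :- :# 3 :* g) :* (h :- :# 0) :+ :# 2 :* (t :- :# 0))
      refl (∑ m (λ j → (H j * H j - H₂ j) * inv (suc j))) (H m) (H₂ m)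
      (∑ m (λ k → inv (suc k) * inv (suc k) * inv (suc k))))
      (1# ⊡ ∑e₂-inv m ⊞ (H m * H m - # 3 * H₂ m) ⊡ H-m ⊞ # 2 ⊡ ∑inv³))

  β : Carrier
  β = ∑ m (λ k → H (suc k) * inv (suc k) * inv (suc k))

  -- By summation by parts; with bernoulli-unique this identifies Bⱼ with ∑ aʲ H_a.
  moment-H : ∀ N → N < m → bernoulli-sum (moment H) N ≈ 0# ^ N
  moment-H N N<m = begin
    bernoulli-sum (moment H) N
      ≈⟨ moment-bernoulli-sum H N ⟩
    ∑ p (λ a → H a * (# (suc a) ^ suc N - # a ^ suc N))
      ≈⟨ abel ⟩
    H m * # p ^ suc N - ∑ m (λ a → # (suc a) ^ N)
      ≈⟨ lincomb (solve 4 (λ h q s z → h :* q :- s :- z := q :* (h :- :# 0) :+ :- :# 1 :* (z :+ s :- :# 0))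
          refl (H m) (# p ^ suc N) (∑ m (λ a → # (suc a) ^ N)) (0# ^ N))
          ((# p ^ suc N) ⊡ H-m ⊞ - 1# ⊡ trans (sym (∑-shift m _)) (power-sum N N<m)) ⟩
    0# ^ N ∎
    where
    step : ∀ a → a < m → H (suc a) * # (suc (suc a)) ^ suc N ≈ H a * # (suc a) ^ suc N +
        (H (suc a) * (# (suc (suc a)) ^ suc N - # (suc a) ^ suc N) + # (suc a) ^ N)
    step a a<m = lincomb (solve 5 (λ h i w q v
        → (h :+ i) :* w :- (h :* (q :* v) :+ ((h :+ i) :* (w :- q :* v) :+ v)) := v :* (q :* i :- :# 1))
        refl (H a) (inv (suc a)) (# (suc (suc a)) ^ suc N) (# (suc a)) (# (suc a) ^ N))
        ((# (suc a) ^ N) ⊡ #k*inv a a<m)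
    abel : ∑ p (λ a → H a * (# (suc a) ^ suc N - # a ^ suc N)) ≈ H m * # p ^ suc N - ∑ m (λ a → # (suc a) ^ N)
    abel = lincomb (solve 7 (λ t t1 u s e f g → t :- (e :- s) := :# 1 :* (t :- (:# 0 :* (f :- g) :+ t1))
        :+ :- :# 1 :* (u :- (t1 :+ s)) :+ :- :# 1 :* (e :- (:# 0 :* f :+ u)))
        refl (∑ p (λ a → H a * (# (suc a) ^ suc N - # a ^ suc N)))
        (∑ m (λ a → H (suc a) * (# (suc (suc a)) ^ suc N - # (suc a) ^ suc N)))
        (∑ m (λ a → H (suc a) * (# (suc (suc a)) ^ suc N - # (suc a) ^ suc N) + # (suc a) ^ N))
        (∑ m (λ a → # (suc a) ^ N)) (H m * # p ^ suc N) (# 1 ^ suc N) (# 0 ^ suc N))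
        (1# ⊡ ∑-shift m _ ⊞ - 1# ⊡ ∑-+ m _ _ ⊞ - 1# ⊡ ∑-telescope m _ (λ a → H a * # (suc a) ^ suc N) step)

  -- The exponent m ∸ 2 is p - 3, and a^(p - 3) is 1/a² for 0 < a < p.
  moment-H-β : moment H (m ∸ 2) ≈ β
  moment-H-β = begin
    moment H (m ∸ 2)
      ≈⟨ ∑-shift m _ ⟩
    0# * # 0 ^ (m ∸ 2) + ∑ m (λ a → H (suc a) * # (suc a) ^ (m ∸ 2))
      ≈⟨ trans (+-congʳ (zeroˡ _)) (+-identityˡ _) ⟩
    ∑ m (λ a → H (suc a) * # (suc a) ^ (m ∸ 2))
      ≈⟨ ∑-cong m (λ a a<m → trans (*-congˡ (#^-inv 2 a (ℕₚ.≤-trans (s≤s (s≤s z≤n)) 3<n) a<m))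
          (solve 2 (λ h i → h :* i :^ 2 := h :* i :* i) refl (H (suc a)) (inv (suc a)))) ⟩
    β ∎

  -- Polynomials of degree below p and their evaluation

  Seq : Set c
  Seq = ℕ → Carrier

  ev : Seq → Carrier → Carrier
  ev u x = ∑ p (λ k → u k * x ^ k)

  ev-cong : ∀ {u v} x → (∀ s → s < p → u s ≈ v s) → ev u x ≈ ev v x
  ev-cong x h = ∑-cong p λ k k<p → *-congʳ (h k k<p)

  -- Linear combinations are reified as lists so that a coefficientwise comparison (`ev-cong`)
  -- followed by one use of `ev-comb` turns an identity of sequences into one of values.
  comb : List (Carrier × Seq) → Seq
  comb []            s = 0#
  comb ((a , u) ∷ l) s = a * u s + comb l s

  comb-ev : Carrier → List (Carrier × Seq) → Carrier
  comb-ev x []            = 0#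
  comb-ev x ((a , u) ∷ l) = a * ev u x + comb-ev x l

  ev-comb : ∀ x l → ev (comb l) x ≈ comb-ev x l
  ev-comb x [] = ∑-0 p λ k _ → zeroˡ _
  ev-comb x ((a , u) ∷ l) = begin
    ∑ p (λ k → (a * u k + comb l k) * x ^ k)
      ≈⟨ ∑-cong p (λ k _ → (solve 4 (λ a u c x → (a :* u :+ c) :* x := a :* (u :* x) :+ c :* x)
          refl a (u k) (comb l k) (x ^ k))) ⟩
    ∑ p (λ k → a * (u k * x ^ k) + comb l k * x ^ k)
      ≈⟨ ∑-+ p _ _ ⟩
    ∑ p (λ k → a * (u k * x ^ k)) + ev (comb l) x
      ≈⟨ +-cong (∑-*ˡ p a _) (ev-comb x l) ⟩
    a * ev u x + comb-ev x l ∎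

  ev-argcong : ∀ u {y z} → y ≈ z → ev u y ≈ ev u z
  ev-argcong u h = ∑-cong p λ k _ → *-congˡ (^-congˡ k h)

  inv² inv³ H·inv H²·inv H₂·inv H·inv² δ₀ : Seq
  inv² k = inv k * inv k
  inv³ k = inv k * inv k * inv k
  H·inv k = H k * inv k
  H²·inv k = H k * H k * inv k
  H₂·inv k = H₂ k * inv k
  H·inv² k = H k * inv k * inv k
  δ₀ zero    = 1#
  δ₀ (suc _) = 0#

  -- The finite polylogarithms £₁, £₂, £₃. The extra term at k = 0 vanishes because `inv 0` does;
  -- starting at 0 suits the arithmetic of indices modulo p.
  L₁ L₂ L₃ : Carrier → Carrier
  L₁ = ev inv
  L₂ = ev inv²
  L₃ = ev inv³

  ev-suc : ∀ u y → u 0 ≈ 0# → ev u y ≈ ∑ m (λ k → u (suc k) * y ^ suc k)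
  ev-suc u y u0 = trans (∑-shift m _) (trans (+-congʳ (trans (*-congʳ u0) (zeroˡ _))) (+-identityˡ _))

  inv²-0 : inv² 0 ≈ 0#
  inv²-0 = trans (*-congʳ inv-0) (zeroˡ _)

  inv³-0 : inv³ 0 ≈ 0#
  inv³-0 = trans (*-congˡ inv-0) (zeroʳ _)

  -- Products of polynomials modulo zᵖ - X

  module Twisted (x X : Carrier) (x^p : x ^ p ≈ X) where
    -- Sequences on [0, p) represent elements of R[z]/(zᵖ − X); σ is multiplication by z.
    σ : Seq → Seq
    σ v zero    = X * v m
    σ v (suc s) = v s

    σ^ : ℕ → Seq → Seq
    σ^ zero    v = v
    σ^ (suc a) v = σ (σ^ a v)

    -- The product written as ∑ u_a zᵃ v. In this form multiplicativity of evaluation follows from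
    -- `ev-σ`; the formula for coefficients is `conv-split`.
    conv : Seq → Seq → Seq
    conv u v s = ∑ p (λ a → u a * σ^ a v s)

    ev-σ : ∀ v → x * ev v x ≈ ev (σ v) x
    ev-σ v = begin
      x * ev v x
        ≈⟨ ∑-*ˡ p x _ ⟨
      ∑ m (λ k → x * (v k * x ^ k)) + x * (v m * x ^ m)
        ≈⟨ +-cong (∑-cong m λ k _ → (solve 3 (λ x v w → x :* (v :* w) := v :* (x :* w)) refl x (v k) (x ^ k)))
            (lincomb (solve 4 (λ x v w X → x :* (v :* w) :- X :* v :* :# 1 := v :* (x :* w :- X))
            refl x (v m) (x ^ m) X) (v m ⊡ x^p)) ⟩
      ∑ m (λ k → v k * x ^ suc k) + X * v m * 1#
        ≈⟨ +-comm _ _ ⟩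
      X * v m * 1# + ∑ m (λ k → v k * x ^ suc k)
        ≈⟨ ∑-shift m _ ⟨
      ev (σ v) x ∎

    ev-σ^ : ∀ a v → x ^ a * ev v x ≈ ev (σ^ a v) x
    ev-σ^ zero    v = *-identityˡ _
    ev-σ^ (suc a) v = trans (*-assoc _ _ _) (trans (*-congˡ (ev-σ^ a v)) (ev-σ (σ^ a v)))

    ev-* : ∀ u v → ev u x * ev v x ≈ ev (conv u v) x
    ev-* u v = begin
      ev u x * ev v x
        ≈⟨ *-comm _ _ ⟩
      ev v x * ev u x
        ≈⟨ ∑-*ˡ p (ev v x) _ ⟨
      ∑ p (λ a → ev v x * (u a * x ^ a))
        ≈⟨ ∑-cong p (λ a _ → trans ((solve 3 (λ e u w → e :* (u :* w) := u :* (w :* e))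
            refl (ev v x) (u a) (x ^ a))) (trans (*-congˡ (ev-σ^ a v)) (sym (∑-*ˡ p (u a) _)))) ⟩
      ∑ p (λ a → ∑ p (λ s → u a * (σ^ a v s * x ^ s)))
        ≈⟨ ∑-swap p p _ ⟩
      ∑ p (λ s → ∑ p (λ a → u a * (σ^ a v s * x ^ s)))
        ≈⟨ ∑-cong p (λ s _ → trans (∑-cong p λ a _
            → (solve 3 (λ u v w → u :* (v :* w) := w :* (u :* v)) refl (u a) (σ^ a v s) (x ^ s)))
            (trans (∑-*ˡ p (x ^ s) _) (*-comm _ _))) ⟩
      ev (conv u v) x ∎

    σ^-low : ∀ a v t → σ^ a v (a ℕ.+ t) ≡ v t
    σ^-low zero    v t = ≡.refl
    σ^-low (suc a) v t = σ^-low a v t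

    -- Undoing s shifts leads to degree 0, the next shift wraps around and produces X, and the other
    -- j stay within range.
    σ^-high : ∀ s j v → j ≤ m → σ^ (suc s ℕ.+ j) v s ≡ X * v (m ∸ j)
    σ^-high zero    j v j≤m = ≡.cong (X *_)
        (≡.trans (≡.cong (σ^ j v) (≡.sym (ℕₚ.m+[n∸m]≡n j≤m))) (σ^-low j v (m ∸ j)))
    σ^-high (suc s) j v j≤m = σ^-high s j v j≤m

    -- Pairs with a + b = s come without a factor; pairs with a + b = s + p wrap around once and
    -- carry X. The number of the latter is r = p - 1 - s.
    conv-split : ∀ u v s r → s ℕ.+ r ≡ m →
      conv u v s ≈ ∑ (suc s) (λ a → u a * v (s ∸ a)) + X * ∑ r (λ j → u (suc s ℕ.+ j) * v (m ∸ j))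
    conv-split u v s r s+r≡m = begin
      ∑ p (λ a → u a * σ^ a v s)
        ≡⟨ ≡.cong (λ q → ∑ (suc q) (λ a → u a * σ^ a v s)) s+r≡m ⟨
      ∑ (suc s ℕ.+ r) (λ a → u a * σ^ a v s)
        ≈⟨ ∑-split (suc s) r _ ⟩
      ∑ (suc s) (λ a → u a * σ^ a v s) + ∑ r (λ j → u (suc s ℕ.+ j) * σ^ (suc s ℕ.+ j) v s)
        ≈⟨ +-cong (∑-cong (suc s) low) (trans (∑-cong r high) (∑-*ˡ r X _)) ⟩
      ∑ (suc s) (λ a → u a * v (s ∸ a)) + X * ∑ r (λ j → u (suc s ℕ.+ j) * v (m ∸ j)) ∎
      where
      low : ∀ a → a < suc s → u a * σ^ a v s ≈ u a * v (s ∸ a)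
      low a a≤s = *-congˡ (reflexive (≡.trans (≡.cong (σ^ a v) (≡.sym (ℕₚ.m+[n∸m]≡n (ℕₚ.≤-pred a≤s))))
          (σ^-low a v (s ∸ a))))
      high : ∀ j → j < r → u (suc s ℕ.+ j) * σ^ (suc s ℕ.+ j) v s ≈ X * (u (suc s ℕ.+ j) * v (m ∸ j))
      high j j<r = trans (*-congˡ (reflexive
          (σ^-high s j v (ℕₚ.≤-trans (ℕₚ.<⇒≤ j<r) (ℕₚ.≤-trans (ℕₚ.m≤n+m r s) (ℕₚ.≤-reflexive s+r≡m))))))
        ((solve 3 (λ u v X → u :* (X :* v) := X :* (u :* v)) refl (u (suc s ℕ.+ j)) (v (m ∸ j)) X))

    flip-high : ∀ {s r j} → s ℕ.+ r ≡ m → j < r → suc s ℕ.+ (r ∸ suc j) ≡ m ∸ j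
    flip-high {s} {r} {j} s+r≡m j<r = ℕₚ.+-cancelʳ-≡ j _ _ (≡.trans
      (≡.trans (≡.cong suc (ℕₚ.+-assoc s (r ∸ suc j) j)) (≡.trans (≡.sym (ℕₚ.+-suc s _))
        (≡.trans (≡.cong (s ℕ.+_) (≡.trans (≡.sym (ℕₚ.+-suc (r ∸ suc j) j)) (ℕₚ.m∸n+n≡m j<r))) s+r≡m)))
      (≡.sym (ℕₚ.m∸n+n≡m (ℕₚ.≤-trans (ℕₚ.<⇒≤ j<r) (ℕₚ.≤-trans (ℕₚ.m≤n+m r s) (ℕₚ.≤-reflexive s+r≡m))))))

    conv-comm : ∀ u v s r → s ℕ.+ r ≡ m → conv u v s ≈ conv v u s
    conv-comm u v s r s+r≡m = begin
      conv u v s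
        ≈⟨ conv-split u v s r s+r≡m ⟩
      ∑ (suc s) (λ a → u a * v (s ∸ a)) + X * ∑ r (λ j → u (suc s ℕ.+ j) * v (m ∸ j))
        ≈⟨ +-cong (trans (∑-rev (suc s) _) (∑-cong (suc s) low)) (*-congˡ (trans (∑-rev r _) (∑-cong r high))) ⟩
      ∑ (suc s) (λ a → v a * u (s ∸ a)) + X * ∑ r (λ j → v (suc s ℕ.+ j) * u (m ∸ j))
        ≈⟨ conv-split v u s r s+r≡m ⟨
      conv v u s ∎
      where
      low : ∀ a → a < suc s → u (s ∸ a) * v (s ∸ (s ∸ a)) ≈ v a * u (s ∸ a)
      low a a≤s = trans (*-congˡ (reflexive (≡.cong v (ℕₚ.m∸[m∸n]≡n (ℕₚ.≤-pred a≤s))))) (*-comm _ _)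
      high : ∀ j → j < r → u (suc s ℕ.+ (r ∸ suc j)) * v (m ∸ (r ∸ suc j)) ≈ v (suc s ℕ.+ j) * u (m ∸ j)
      high j j<r = trans (*-cong (reflexive (≡.cong u e)) (reflexive (≡.cong v e′))) (*-comm _ _)
        where
        e = flip-high s+r≡m j<r
        e′ : m ∸ (r ∸ suc j) ≡ suc s ℕ.+ j
        e′ = ≡.trans (≡.cong (_∸ (r ∸ suc j))
            (≡.trans (≡.sym s+r≡m) (≡.cong (s ℕ.+_)
            (≡.sym (≡.trans (≡.sym (ℕₚ.+-suc j _))
            (≡.trans (≡.cong (j ℕ.+_) (≡.sym (ℕₚ.+-∸-assoc 1 j<r))) (ℕₚ.m+[n∸m]≡n (ℕₚ.<⇒≤ j<r))))))))
            (≡.trans (≡.cong (_∸ (r ∸ suc j)) (≡.trans (ℕₚ.+-suc s _) (≡.cong suc (≡.sym (ℕₚ.+-assoc s j _)))))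
            (ℕₚ.m+n∸n≡m (suc s ℕ.+ j) (r ∸ suc j)))

    θ : Seq → Seq
    θ v s = # s * v s

    -- θ is z d/dz, and this is its Leibniz rule. Wrapped pairs have a + b = s + p, which is s in R;
    -- that is where p = 0 enters. For the weights 1/a and 1/b it is the partial fraction formula
    -- with denominators cleared.
    conv-θ : ∀ u v s r → s ℕ.+ r ≡ m → # s * conv u v s ≈ conv (θ u) v s + conv u (θ v) s
    conv-θ u v s r s+r≡m = begin
      # s * conv u v s
        ≈⟨ *-congˡ (conv-split u v s r s+r≡m) ⟩
      # s * (∑ (suc s) (λ a → u a * v (s ∸ a)) + X * ∑ r (λ j → u (suc s ℕ.+ j) * v (m ∸ j)))
        ≈⟨ solve 4 (λ s a X b → s :* (a :+ X :* b) := s :* a :+ X :* (s :* b))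
            refl (# s) (∑ (suc s) (λ a → u a * v (s ∸ a))) X (∑ r (λ j → u (suc s ℕ.+ j) * v (m ∸ j))) ⟩
      # s * ∑ (suc s) (λ a → u a * v (s ∸ a)) + X * (# s * ∑ r (λ j → u (suc s ℕ.+ j) * v (m ∸ j)))
        ≈⟨ +-cong (trans (sym (∑-*ˡ (suc s) _ _)) (trans (∑-cong (suc s) low) (∑-+ (suc s) _ _)))
            (*-congˡ (trans (sym (∑-*ˡ r _ _)) (trans (∑-cong r high) (∑-+ r _ _)))) ⟩
      (A₁ + A₂) + X * (B₁ + B₂)
        ≈⟨ solve 5 (λ a a2 b b2 X → a :+ a2 :+ X :* (b :+ b2) := a :+ X :* b :+ (a2 :+ X :* b2))
            refl A₁ A₂ B₁ B₂ X ⟩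
      (A₁ + X * B₁) + (A₂ + X * B₂)
        ≈⟨ +-cong (conv-split (θ u) v s r s+r≡m) (conv-split u (θ v) s r s+r≡m) ⟨
      conv (θ u) v s + conv u (θ v) s ∎
      where
      A₁ = ∑ (suc s) (λ a → θ u a * v (s ∸ a))
      A₂ = ∑ (suc s) (λ a → u a * θ v (s ∸ a))
      B₁ = ∑ r (λ j → θ u (suc s ℕ.+ j) * v (m ∸ j))
      B₂ = ∑ r (λ j → u (suc s ℕ.+ j) * θ v (m ∸ j))
      low : ∀ a → a < suc s → # s * (u a * v (s ∸ a)) ≈ θ u a * v (s ∸ a) + u a * θ v (s ∸ a)
      low a a≤s = lincomb (solve 5 (λ s a b u v → s :* (u :* v) :- (a :* u :* v :+ u :* (b :* v))
          := u :* v :* (s :- (a :+ b))) refl (# s) (# a) (# (s ∸ a)) (u a) (v (s ∸ a)))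
          ((u a * v (s ∸ a)) ⊡ trans (#-cong (≡.sym (ℕₚ.m+[n∸m]≡n (ℕₚ.≤-pred a≤s)))) (#-+ a (s ∸ a)))
      high : ∀ j → j < r → # s * (u (suc s ℕ.+ j) * v (m ∸ j)) ≈ θ u (suc s ℕ.+ j) * v (m ∸ j) + u
          (suc s ℕ.+ j) * θ v (m ∸ j)
      high j j<r = lincomb (solve 6 (λ s a b u v p → s :* (u :* v) :- (a :* u :* v :+ u :* (b :* v))
          := :- (u :* v) :* (a :+ b :- (p :+ s)) :+ :- (u :* v) :* (p :- :# 0))
          refl (# s) (# (suc s ℕ.+ j)) (# (m ∸ j)) (u (suc s ℕ.+ j)) (v (m ∸ j)) (# p))
          (- (u (suc s ℕ.+ j) * v (m ∸ j)) ⊡ trans (sym (#-+ (suc s ℕ.+ j) (m ∸ j)))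
          (trans (#-cong e) (#-+ p s)) ⊞ - (u (suc s ℕ.+ j) * v (m ∸ j)) ⊡ char)
        where
        e : suc s ℕ.+ j ℕ.+ (m ∸ j) ≡ p ℕ.+ s
        e = ≡.trans (ℕₚ.+-assoc (suc s) j _)
            (≡.trans (≡.cong (suc s ℕ.+_) (ℕₚ.m+[n∸m]≡n
            (ℕₚ.≤-trans (ℕₚ.<⇒≤ j<r) (ℕₚ.≤-trans (ℕₚ.m≤n+m r s) (ℕₚ.≤-reflexive s+r≡m)))))
          (≡.trans (≡.cong suc (ℕₚ.+-comm s m)) ≡.refl))

    conv-congʳ : ∀ u {v w} s r → s ℕ.+ r ≡ m → (∀ s → s < p → v s ≈ w s) → conv u v s ≈ conv u w s
    conv-congʳ u {v} {w} s r s+r≡m h = trans (conv-split u v s r s+r≡m) (trans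
      (+-cong (∑-cong (suc s) λ a _ → *-congˡ (h (s ∸ a) (s≤s (ℕₚ.≤-trans (ℕₚ.m∸n≤m s a) s≤m))))
          (*-congˡ (∑-cong r λ j _ → *-congˡ (h (m ∸ j) (s≤s (ℕₚ.m∸n≤m m j))))))
      (sym (conv-split u w s r s+r≡m)))
      where
      s≤m : s ≤ m
      s≤m = ℕₚ.≤-trans (ℕₚ.m≤m+n s r) (ℕₚ.≤-reflexive s+r≡m)

    conv-congˡ : ∀ {u v} w s → (∀ s → s < p → u s ≈ v s) → conv u w s ≈ conv v w s
    conv-congˡ w s h = ∑-cong p λ a a<p → *-congʳ (h a a<p)

    e₊ : Seq
    e₊ zero    = 0#
    e₊ (suc _) = 1#

    -- `e₊` is z + ... + z^(p - 1), without a constant term. Hence the coefficient of v at s itself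
    -- is left out, those below s count once and those above s count X times.
    conv-e₊ : ∀ v s r → s ℕ.+ r ≡ m → conv e₊ v s ≈ ∑ s v + X * (∑ p v - ∑ (suc s) v)
    conv-e₊ v s r s+r≡m = begin
      conv e₊ v s
        ≈⟨ conv-split e₊ v s r s+r≡m ⟩
      ∑ (suc s) (λ a → e₊ a * v (s ∸ a)) + X * ∑ r (λ j → 1# * v (m ∸ j))
        ≈⟨ +-cong low (*-congˡ high) ⟩
      ∑ s v + X * (∑ p v - ∑ (suc s) v) ∎
      where
      low : ∑ (suc s) (λ a → e₊ a * v (s ∸ a)) ≈ ∑ s v
      low = trans (∑-shift s _) (trans (+-cong (zeroˡ _)
          (trans (∑-cong s λ _ _ → *-identityˡ _) (sym (∑-rev s v)))) (+-identityˡ _))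
      total : ∑ p v ≈ ∑ (suc s) v + ∑ r (λ j → 1# * v (m ∸ j))
      total = trans (reflexive (≡.cong (λ q → ∑ (suc q) v) (≡.sym s+r≡m)))
          (trans (∑-split (suc s) r v) (+-congˡ (trans (∑-rev r _)
        (∑-cong r λ j j<r → trans (reflexive (≡.cong v (flip-high s+r≡m j<r))) (sym (*-identityˡ _))))))
      high : ∑ r (λ j → 1# * v (m ∸ j)) ≈ ∑ p v - ∑ (suc s) v
      high = lincomb (solve 3 (λ h t a → h :- (t :- a) := :- :# 1 :* (t :- (a :+ h)))
          refl (∑ r (λ j → 1# * v (m ∸ j))) (∑ p v) (∑ (suc s) v)) (- 1# ⊡ total)

    σ-cong : ∀ {v w} → (∀ s → s < p → v s ≈ w s) → ∀ s → s < p → σ v s ≈ σ w s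
    σ-cong h zero    _   = *-congˡ (h m (ℕₚ.n<1+n m))
    σ-cong h (suc s) s<p = h s (ℕₚ.<⇒≤ s<p)

    σ^-σ : ∀ a v s → s < p → σ^ a (σ v) s ≈ σ^ (suc a) v s
    σ^-σ zero    v s _   = refl
    σ^-σ (suc a) v s s<p = σ-cong (σ^-σ a v) s s<p

    conv-σ : ∀ u v s → suc s < p → conv u (σ v) (suc s) ≈ conv u v s
    conv-σ u v s s<p = ∑-cong p λ a _ → *-congˡ (σ^-σ a v (suc s) s<p)

    conv-+ʳ : ∀ u v w s r → s ℕ.+ r ≡ m → conv u (λ k → v k + w k) s ≈ conv u v s + conv u w s
    conv-+ʳ u v w s r s+r≡m = begin
      conv u (λ k → v k + w k) s
        ≈⟨ conv-split u _ s r s+r≡m ⟩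
      ∑ (suc s) (λ a → u a * (v (s ∸ a) + w (s ∸ a))) + X * ∑ r
          (λ j → u (suc s ℕ.+ j) * (v (m ∸ j) + w (m ∸ j)))
        ≈⟨ +-cong (trans (∑-cong (suc s) λ _ _ → distribˡ _ _ _) (∑-+ (suc s) _ _))
            (*-congˡ (trans (∑-cong r λ _ _ → distribˡ _ _ _) (∑-+ r _ _))) ⟩
      (A₁ + A₂) + X * (B₁ + B₂)
        ≈⟨ solve 5 (λ a a2 b b2 X → a :+ a2 :+ X :* (b :+ b2) := a :+ X :* b :+ (a2 :+ X :* b2))
            refl A₁ A₂ B₁ B₂ X ⟩
      (A₁ + X * B₁) + (A₂ + X * B₂)
        ≈⟨ +-cong (conv-split u v s r s+r≡m) (conv-split u w s r s+r≡m) ⟨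
      conv u v s + conv u w s ∎
      where
      A₁ = ∑ (suc s) (λ a → u a * v (s ∸ a))
      A₂ = ∑ (suc s) (λ a → u a * w (s ∸ a))
      B₁ = ∑ r (λ j → u (suc s ℕ.+ j) * v (m ∸ j))
      B₂ = ∑ r (λ j → u (suc s ℕ.+ j) * w (m ∸ j))

    -- Auxiliary unknowns: harmonic weights are what both multiplication and the substitution 1 - x
    -- produce. All four are eliminated in `L₁-square` and `L₁-cube`.
    A P S T : Carrier
    A = ev H·inv x
    P = ev H²·inv x
    S = ev H₂·inv x
    T = ev H·inv² x

    ev-δ₀ : ev δ₀ x ≈ 1#
    ev-δ₀ = trans (∑-shift m _) (trans (+-cong (*-identityˡ _) (∑-0 m λ _ _ → zeroˡ _)) (+-identityʳ _))

    θ-inv : ∀ s → s < p → θ inv s ≈ e₊ s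
    θ-inv zero    _ = zeroˡ _
    θ-inv (suc s) (s≤s s<m) = #k*inv s s<m

    θ-inv² : ∀ s → s < p → θ inv² s ≈ inv s
    θ-inv² zero    _ = trans (zeroˡ _) (sym inv-0)
    θ-inv² (suc s) (s≤s s<m) = lincomb (solve 2 (λ k i → k :* (i :* i) :- i := i :* (k :* i :- :# 1))
        refl (# (suc s)) (inv (suc s))) (inv (suc s) ⊡ #k*inv s s<m)

    θ-H·inv : ∀ s → s < p → θ H·inv s ≈ H s
    θ-H·inv zero    _ = zeroˡ _
    θ-H·inv (suc s) (s≤s s<m) = lincomb (solve 3 (λ k i h → k :* (h :* i) :- h := h :* (k :* i :- :# 1))
        refl (# (suc s)) (inv (suc s)) (H (suc s))) (H (suc s) ⊡ #k*inv s s<m)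

    ∑inv : ∀ k → ∑ (suc k) inv ≈ H k
    ∑inv zero = trans (+-identityˡ _) inv-0
    ∑inv (suc k) = +-congʳ (∑inv k)

    ∑inv² : ∀ k → ∑ (suc k) inv² ≈ H₂ k
    ∑inv² zero = trans (+-identityˡ _) (trans (*-congˡ inv-0) (zeroʳ _))
    ∑inv² (suc k) = +-congʳ (∑inv² k)

    ∑H·inv : ∀ k → # 2 * ∑ (suc k) H·inv ≈ H k * H k + H₂ k
    ∑H·inv k = trans (*-congˡ (trans (∑-shift k _) (trans (+-congʳ (zeroˡ _)) (+-identityˡ _)))) (∑H-inv k)

    co : ∀ {s} → s < p → s ℕ.+ (m ∸ s) ≡ m
    co (s≤s s≤m) = ℕₚ.m+[n∸m]≡n s≤m

    conv-0 : ∀ u v → conv u v 0 ≈ u 0 * v 0 + X * ∑ m (λ j → u (suc j) * v (m ∸ j))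
    conv-0 u v = trans (conv-split u v 0 m ≡.refl) (+-congʳ (+-identityˡ _))

    inv-m∸ : ∀ j → j < m → inv (m ∸ j) ≈ - inv (suc j)
    inv-m∸ j j<m = inv-reflect (m ∸ j) (suc j)
        (≡.trans (ℕₚ.+-suc (m ∸ j) j) (≡.cong suc (ℕₚ.m∸n+n≡m (ℕₚ.<⇒≤ j<m))))

    H-m∸ : ∀ j → j < m → H (m ∸ j) ≈ H j
    H-m∸ j j<m = H-reflect (m ∸ j) j (ℕₚ.m∸n+n≡m (ℕₚ.<⇒≤ j<m))

    w₁ w₂ w₃ : Seq
    w₁ = conv inv inv
    w₂ = conv inv inv²
    w₃ = conv inv H·inv

    -- In degree 0 the Leibniz rule degenerates, its left side being multiplied by 0. The pairs a +
    -- (p - a) are summed directly instead, giving -X ∑ 1/a² = 0. The same split between degree 0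
    -- and the others recurs for `w₂` and `w₃`.
    w₁-0 : w₁ 0 ≈ 0#
    w₁-0 = begin
      w₁ 0
        ≈⟨ conv-0 inv inv ⟩
      inv 0 * inv 0 + X * ∑ m (λ j → inv (suc j) * inv (m ∸ j))
        ≈⟨ +-congˡ (*-congˡ (trans (∑-cong m λ j j<m → lincomb
            (solve 2 (λ i k → i :* k :- :- :# 1 :* i :^ 2 := i :* (k :- :- i))
            refl (inv (suc j)) (inv (m ∸ j))) (inv (suc j) ⊡ inv-m∸ j j<m))
            (trans (∑-*ˡ m (- 1#) _) (*-congˡ (sum-inv^ 2 z<s (s≤s (ℕₚ.≤-trans (s≤s (s≤s z≤n)) 3<n))))))) ⟩
      inv 0 * inv 0 + X * (- 1# * 0#)
        ≈⟨ lincomb (solve 2 (λ i X → i :* i :+ X :* (:- :# 1 :* :# 0) :- :# 0 := i :* (i :- :# 0))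
            refl (inv 0) X) (inv 0 ⊡ inv-0) ⟩
      0# ∎

    -- Since θ turns `inv` into `e₊`, the Leibniz rule makes s · w₁(s) twice the coefficient of `e₊`
    -- · `inv`, that is 2 (H_(s - 1) + X (H_(p - 1) - H_s)), and H_(p - 1) = 0.
    w₁-suc : ∀ t → t < m → w₁ (suc t) ≈ # 2 * inv (suc t) * (H t - X * H (suc t))
    w₁-suc t t<m = lincomb (solve 14 (λ w k i h h1 X e f a b s s1 z y → w :- :# 2 :* i :* (h :- X :* h1)
        := :- w :* (k :* i :- :# 1) :+ i :* (k :* w :- (a :+ b)) :+ i :* (a :- e) :+ i :* (b :- f)
        :+ i :* (f :- e) :+ :# 2 :* i :* (e :- (s :+ X :* (z :- s1))) :+ :# 2 :* i :* (s :- h)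
        :+ :- :# 2 :* i :* X :* (s1 :- h1) :+ :# 2 :* i :* X :* (z :- y) :+ :# 2 :* i :* X :* (y :- :# 0))
        refl (w₁ (suc t)) (# (suc t)) (inv (suc t)) (H t) (H (suc t)) X (conv e₊ inv (suc t))
        (conv inv e₊ (suc t)) (conv (θ inv) inv (suc t)) (conv inv (θ inv) (suc t)) (∑ (suc t) inv)
        (∑ (suc (suc t)) inv) (∑ p inv) (H m))
        (- w₁ (suc t) ⊡ #k*inv t t<m ⊞ inv (suc t) ⊡ conv-θ inv inv (suc t) r q
        ⊞ inv (suc t) ⊡ conv-congˡ inv (suc t) θ-inv ⊞ inv (suc t) ⊡ conv-congʳ inv (suc t) r q θ-inv
        ⊞ inv (suc t) ⊡ conv-comm inv e₊ (suc t) r q ⊞ (# 2 * inv (suc t)) ⊡ conv-e₊ inv (suc t) r q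
        ⊞ (# 2 * inv (suc t)) ⊡ ∑inv t ⊞ (- # 2 * inv (suc t) * X) ⊡ ∑inv (suc t)
        ⊞ (# 2 * inv (suc t) * X) ⊡ ∑inv m ⊞ (# 2 * inv (suc t) * X) ⊡ H-m)
      where
      r = m ∸ suc t
      q = co (s≤s t<m)

    w₂-0 : w₂ 0 ≈ 0#
    w₂-0 = begin
      w₂ 0
        ≈⟨ conv-0 inv inv² ⟩
      inv 0 * inv² 0 + X * ∑ m (λ j → inv (suc j) * inv² (m ∸ j))
        ≈⟨ +-congˡ (*-congˡ (trans (∑-cong m λ j j<m → lincomb
            (solve 2 (λ i k → i :* (k :* k) :- i :* i :* i := i :* (k :- i) :* (k :- :- i))
            refl (inv (suc j)) (inv (m ∸ j))) ((inv (suc j) * (inv (m ∸ j) - inv (suc j))) ⊡ inv-m∸ j j<m))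
            ∑inv³)) ⟩
      inv 0 * inv² 0 + X * 0#
        ≈⟨ lincomb (solve 2 (λ i X → i :* (i :* i) :+ X :* :# 0 :- :# 0 := i :* i :* (i :- :# 0))
            refl (inv 0) X) ((inv 0 * inv 0) ⊡ inv-0) ⟩
      0# ∎

    -- θ lowers 1/k² to 1/k, so one of the two Leibniz terms is `w₁` again.
    w₂-suc : ∀ t → t < m → w₂ (suc t) ≈ inv (suc t) * (w₁ (suc t) + H₂ t - X * H₂ (suc t))
    w₂-suc t t<m = lincomb (solve 14 (λ w k i h h1 X e v a b s s1 z y → w :- i :* (v :+ h :- X :* h1)
        := :- w :* (k :* i :- :# 1) :+ i :* (k :* w :- (a :+ b)) :+ i :* (a :- e) :+ i :* (b :- v)
        :+ i :* (e :- (s :+ X :* (z :- s1))) :+ i :* (s :- h) :+ :- i :* X :* (s1 :- h1) :+ i :* X :* (z :- y)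
        :+ i :* X :* (y :- :# 0)) refl (w₂ (suc t)) (# (suc t)) (inv (suc t)) (H₂ t) (H₂ (suc t)) X
        (conv e₊ inv² (suc t)) (w₁ (suc t)) (conv (θ inv) inv² (suc t)) (conv inv (θ inv²) (suc t))
        (∑ (suc t) inv²) (∑ (suc (suc t)) inv²) (∑ p inv²) (H₂ m))
        (- w₂ (suc t) ⊡ #k*inv t t<m ⊞ inv (suc t) ⊡ conv-θ inv inv² (suc t) r q
        ⊞ inv (suc t) ⊡ conv-congˡ inv² (suc t) θ-inv ⊞ inv (suc t) ⊡ conv-congʳ inv (suc t) r q θ-inv²
        ⊞ inv (suc t) ⊡ conv-e₊ inv² (suc t) r q ⊞ inv (suc t) ⊡ ∑inv² t ⊞ (- inv (suc t) * X) ⊡ ∑inv² (suc t)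
        ⊞ (inv (suc t) * X) ⊡ ∑inv² m ⊞ (inv (suc t) * X) ⊡ H₂-m)
      where
      r = m ∸ suc t
      q = co (s≤s t<m)

    -- As polynomials modulo zᵖ - X, H = `inv` + z H, the wrapped coefficient being H_(p - 1) = 0.
    -- So consecutive coefficients of `inv` · H differ by a coefficient of `w₁`, and the formula
    -- follows by induction.
    conv-inv-H : ∀ s → s < p → conv inv H s ≈ (H s * H s - H₂ s) - X * (H s * H s + H₂ s)
    conv-inv-H zero _ = begin
      conv inv H 0
        ≈⟨ conv-0 inv H ⟩
      inv 0 * 0# + X * ∑ m (λ j → inv (suc j) * H (m ∸ j))
        ≈⟨ +-cong (zeroʳ _) (*-congˡ (trans (∑-cong m λ j j<m → *-congˡ (H-m∸ j j<m)) ∑inv-H-m)) ⟩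
      0# + X * 0#
        ≈⟨ solve 1 (λ X → :# 0 :+ X :* :# 0 := :# 0 :* :# 0 :- :# 0 :- X :* (:# 0 :* :# 0 :+ :# 0)) refl X ⟩
      (0# * 0# - 0#) - X * (0# * 0# + 0#) ∎
    conv-inv-H (suc t) (s≤s t<m) = lincomb (solve 9
        (λ g f w d e h k i X → g :- ((h :+ i) :* (h :+ i) :- (k :+ i :* i) :- X :* ((h :+ i) :* (h :+ i)
        :+ (k :+ i :* i))) := :# 1 :* (g :- f) :+ :# 1 :* (f :- (w :+ d))
        :+ :# 1 :* (w :- :# 2 :* i :* (h :- X :* (h :+ i))) :+ :# 1 :* (d :- e)
        :+ :# 1 :* (e :- (h :* h :- k :- X :* (h :* h :+ k))))
        refl (conv inv H (suc t)) (conv inv (λ k → inv k + σ H k) (suc t)) (w₁ (suc t))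
        (conv inv (σ H) (suc t)) (conv inv H t) (H t) (H₂ t) (inv (suc t)) X)
        (1# ⊡ conv-congʳ inv (suc t) r q H-σ ⊞ 1# ⊡ conv-+ʳ inv inv (σ H) (suc t) r q ⊞ 1# ⊡ w₁-suc t t<m
        ⊞ 1# ⊡ conv-σ inv H t (s≤s t<m) ⊞ 1# ⊡ conv-inv-H t (ℕₚ.<⇒≤ (s≤s t<m)))
      where
      r = m ∸ suc t
      q = co (s≤s t<m)
      H-σ : ∀ s → s < p → H s ≈ inv s + σ H s
      H-σ zero    _ = lincomb (solve 3 (λ i h X → :# 0 :- (i :+ X :* h) := :- :# 1 :* (i :- :# 0)
          :+ :- X :* (h :- :# 0)) refl (inv 0) (H m) X) (- 1# ⊡ inv-0 ⊞ - X ⊡ H-m)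
      H-σ (suc s) _ = +-comm _ _

    -- By H_(p - a) = H_(a - 1), the pair a + (p - a) contributes -X H_(a - 1)/a². Replacing H_(a -
    -- 1) by H_a - 1/a leaves -Xβ plus X ∑ 1/a³ = 0.
    w₃-0 : w₃ 0 ≈ - (X * β)
    w₃-0 = begin
      w₃ 0
        ≈⟨ conv-0 inv H·inv ⟩
      inv 0 * H·inv 0 + X * ∑ m (λ j → inv (suc j) * H·inv (m ∸ j))
        ≈⟨ +-congˡ (*-congˡ (trans (∑-cong m term) (trans (∑-+ m _ _) (+-cong ∑inv³ (∑-*ˡ m (- 1#) _))))) ⟩
      inv 0 * H·inv 0 + X * (0# + - 1# * β)
        ≈⟨ solve 3 (λ i X b → i :* (:# 0 :* i) :+ X :* (:# 0 :+ :- :# 1 :* b) := :- (X :* b)) refl (inv 0) X β ⟩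
      - (X * β) ∎
      where
      term : ∀ j → j < m → inv (suc j) * H·inv (m ∸ j) ≈ inv (suc j) * inv (suc j) * inv
          (suc j) + - 1# * (H (suc j) * inv (suc j) * inv (suc j))
      term j j<m = lincomb (solve 4 (λ i k g h
          → i :* (g :* k) :- (i :* i :* i :+ :- :# 1 :* ((h :+ i) :* i :* i)) := i :* g :* (k :- :- i)
          :+ :- i :* i :* (g :- h)) refl (inv (suc j)) (inv (m ∸ j)) (H (m ∸ j)) (H j))
          ((inv (suc j) * H (m ∸ j)) ⊡ inv-m∸ j j<m ⊞ (- inv (suc j) * inv (suc j)) ⊡ H-m∸ j j<m)

    w₃-suc : ∀ t → t < m → # 2 * w₃ (suc t) ≈ inv
        (suc t) * (# 3 * (H (suc t) * H (suc t)) - H₂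
        (suc t) - # 2 * (H (suc t) * inv (suc t)) - # 3 * (X * (H (suc t) * H (suc t) + H₂ (suc t))))
    w₃-suc t t<m = lincomb (solve 15 (λ w k i h g X e v a b s s1 z y y2
        → :# 2 :* w :- i :* (:# 3 :* ((h :+ i) :* (h :+ i)) :- (g
        :+ i :* i) :- :# 2 :* ((h :+ i) :* i) :- :# 3 :* (X :* ((h :+ i) :* (h :+ i) :+ (g :+ i :* i))))
        := :- :# 2 :* w :* (k :* i :- :# 1) :+ :# 2 :* i :* (k :* w :- (a :+ b)) :+ :# 2 :* i :* (a :- e)
        :+ :# 2 :* i :* (b :- v) :+ :# 2 :* i :* (e :- (s :+ X :* (z :- s1)))
        :+ i :* (:# 2 :* s :- (h :* h :+ g))
        :+ :- i :* X :* (:# 2 :* s1 :- ((h :+ i) :* (h :+ i) :+ (g :+ i :* i)))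
        :+ i :* X :* (:# 2 :* z :- (y :* y :+ y2)) :+ i :* X :* y :* (y :- :# 0) :+ i :* X :* (y2 :- :# 0)
        :+ :# 2 :* i :* (v :- ((h :+ i) :* (h :+ i) :- (g :+ i :* i) :- X :* ((h :+ i) :* (h :+ i)
        :+ (g :+ i :* i))))) refl (w₃ (suc t)) (# (suc t)) (inv (suc t)) (H t) (H₂ t) X (conv e₊ H·inv (suc t))
        (conv inv H (suc t)) (conv (θ inv) H·inv (suc t)) (conv inv (θ H·inv) (suc t)) (∑ (suc t) H·inv)
        (∑ (suc (suc t)) H·inv) (∑ p H·inv) (H m) (H₂ m))
        ((- # 2 * w₃ (suc t)) ⊡ #k*inv t t<m ⊞ (# 2 * inv (suc t)) ⊡ conv-θ inv H·inv (suc t) r q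
        ⊞ (# 2 * inv (suc t)) ⊡ conv-congˡ H·inv (suc t) θ-inv
        ⊞ (# 2 * inv (suc t)) ⊡ conv-congʳ inv (suc t) r q θ-H·inv
        ⊞ (# 2 * inv (suc t)) ⊡ conv-e₊ H·inv (suc t) r q ⊞ inv (suc t) ⊡ ∑H·inv t
        ⊞ (- inv (suc t) * X) ⊡ ∑H·inv (suc t) ⊞ (inv (suc t) * X) ⊡ ∑H·inv m ⊞ (inv (suc t) * X * H m) ⊡ H-m
        ⊞ (inv (suc t) * X) ⊡ H₂-m ⊞ (# 2 * inv (suc t)) ⊡ conv-inv-H (suc t) (s≤s t<m))
      where
      r = m ∸ suc t
      q = co (s≤s t<m)

    L₁² : L₁ x * L₁ x ≈ # 2 * (1# - X) * A - # 2 * L₂ x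
    L₁² = begin
      L₁ x * L₁ x
        ≈⟨ ev-* inv inv ⟩
      ev w₁ x
        ≈⟨ trans (ev-cong x term) (ev-comb x l) ⟩
      comb-ev x l
        ≈⟨ solve 3 (λ X a b → :# 2 :* (:# 1 :- X) :* a :+ (:- :# 2 :* b :+ :# 0)
            := :# 2 :* (:# 1 :- X) :* a :- :# 2 :* b) refl X A (L₂ x) ⟩
      # 2 * (1# - X) * A - # 2 * L₂ x ∎
      where
      l = (# 2 * (1# - X) , H·inv) ∷ (- # 2 , inv²) ∷ []
      term : ∀ s → s < p → w₁ s ≈ comb l s
      term zero    _ = lincomb (solve 3 (λ w i X
          → w :- (:# 2 :* (:# 1 :- X) :* (:# 0 :* i) :+ (:- :# 2 :* (i :* i) :+ :# 0)) := :# 1 :* (w :- :# 0)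
          :+ :# 2 :* i :* (i :- :# 0)) refl (w₁ 0) (inv 0) X) (1# ⊡ w₁-0 ⊞ (# 2 * inv 0) ⊡ inv-0)
      term (suc t) (s≤s t<m) = lincomb (solve 4
          (λ w i h X → w :- (:# 2 :* (:# 1 :- X) :* ((h :+ i) :* i) :+ (:- :# 2 :* (i :* i) :+ :# 0))
          := :# 1 :* (w :- :# 2 :* i :* (h :- X :* (h :+ i)))) refl (w₁ (suc t)) (inv (suc t)) (H t) X)
          (1# ⊡ w₁-suc t t<m)

    L₁L₂ : L₁ x * L₂ x ≈ (1# - X) * (# 2 * T + S) - # 3 * L₃ x
    L₁L₂ = begin
      L₁ x * L₂ x
        ≈⟨ ev-* inv inv² ⟩
      ev w₂ x
        ≈⟨ trans (ev-cong x term) (ev-comb x l) ⟩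
      comb-ev x l
        ≈⟨ solve 4 (λ X t s b → :# 2 :* (:# 1 :- X) :* t :+ ((:# 1 :- X) :* s :+ (:- :# 3 :* b :+ :# 0))
            := (:# 1 :- X) :* (:# 2 :* t :+ s) :- :# 3 :* b) refl X T S (L₃ x) ⟩
      (1# - X) * (# 2 * T + S) - # 3 * L₃ x ∎
      where
      l = (# 2 * (1# - X) , H·inv²) ∷ (1# - X , H₂·inv) ∷ (- # 3 , inv³) ∷ []
      term : ∀ s → s < p → w₂ s ≈ comb l s
      term zero    _ = lincomb (solve 3 (λ w i X
          → w :- (:# 2 :* (:# 1 :- X) :* (:# 0 :* i :* i)
          :+ ((:# 1 :- X) :* (:# 0 :* i) :+ (:- :# 3 :* (i :* i :* i) :+ :# 0))) := :# 1 :* (w :- :# 0)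
          :+ :# 3 :* i :* i :* (i :- :# 0)) refl (w₂ 0) (inv 0) X) (1# ⊡ w₂-0 ⊞ (# 3 * inv 0 * inv 0) ⊡ inv-0)
      term (suc t) (s≤s t<m) = lincomb (solve 6
          (λ w v i h g X → w :- (:# 2 :* (:# 1 :- X) :* ((h :+ i) :* i :* i)
          :+ ((:# 1 :- X) :* ((g :+ i :* i) :* i) :+ (:- :# 3 :* (i :* i :* i) :+ :# 0)))
          := :# 1 :* (w :- i :* (v :+ g :- X :* (g :+ i :* i)))
          :+ i :* (v :- :# 2 :* i :* (h :- X :* (h :+ i))))
          refl (w₂ (suc t)) (w₁ (suc t)) (inv (suc t)) (H t) (H₂ t) X)
          (1# ⊡ w₂-suc t t<m ⊞ inv (suc t) ⊡ w₁-suc t t<m)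

    L₁A : # 2 * (L₁ x * A) ≈ # 3 * P - S - # 2 * T - # 3 * (X * (P + S)) - # 2 * (X * β)
    L₁A = begin
      # 2 * (L₁ x * A)
        ≈⟨ *-congˡ (ev-* inv H·inv) ⟩
      # 2 * ev w₃ x
        ≈⟨ +-identityʳ _ ⟨
      # 2 * ev w₃ x + 0#
        ≈⟨ ev-comb x ((# 2 , w₃) ∷ []) ⟨
      ev (comb ((# 2 , w₃) ∷ [])) x
        ≈⟨ trans (ev-cong x term) (ev-comb x l) ⟩
      comb-ev x l
        ≈⟨ lincomb (solve 6 (λ X P S T b d → (:# 3 :- :# 3 :* X) :* P
            :+ ((:- :# 1 :- :# 3 :* X) :* S
            :+ (:- :# 2 :* T :+ (:- :# 2 :* (X :* b) :* d :+ :# 0)))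
            :- (:# 3 :* P :- S :- :# 2 :* T :- :# 3 :* (X :* (P :+ S)) :- :# 2 :* (X :* b))
            := :- :# 2 :* (X :* b) :* (d :- :# 1)) refl X P S T β (ev δ₀ x)) ((- # 2 * (X * β)) ⊡ ev-δ₀) ⟩
      # 3 * P - S - # 2 * T - # 3 * (X * (P + S)) - # 2 * (X * β) ∎
      where
      -- The other weights vanish at 0, so `δ₀` carries the exceptional coefficient of degree 0
      -- found in `w₃-0`.
      l = (# 3 - # 3 * X , H²·inv) ∷ (- 1# - # 3 * X , H₂·inv) ∷ (- # 2 , H·inv²) ∷ (- # 2 * (X * β) , δ₀) ∷ []
      term : ∀ s → s < p → comb ((# 2 , w₃) ∷ []) s ≈ comb l s
      term zero    _ = lincomb (solve 4 (λ w i X b → :# 2 :* w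
          :+ :# 0 :- ((:# 3 :- :# 3 :* X) :* (:# 0 :* :# 0 :* i)
          :+ ((:- :# 1 :- :# 3 :* X) :* (:# 0 :* i)
          :+ (:- :# 2 :* (:# 0 :* i :* i) :+ (:- :# 2 :* (X :* b) :* :# 1 :+ :# 0))))
          := :# 2 :* (w :- :- (X :* b))) refl (w₃ 0) (inv 0) X β) (# 2 ⊡ w₃-0)
      term (suc t) (s≤s t<m) = lincomb (solve 6
          (λ w i h g X b → :# 2 :* w :+ :# 0 :- ((:# 3 :- :# 3 :* X) :* (h :* h :* i)
          :+ ((:- :# 1 :- :# 3 :* X) :* (g :* i)
          :+ (:- :# 2 :* (h :* i :* i) :+ (:- :# 2 :* (X :* b) :* :# 0 :+ :# 0))))
          := :# 1 :* (:# 2 :* w :- i :* (:# 3 :* (h :* h) :- g :- :# 2 :* (h :* i) :- :# 3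
          :* (X :* (h :* h :+ g))))) refl (w₃ (suc t)) (inv (suc t)) (H (suc t)) (H₂ (suc t)) X β)
          (1# ⊡ w₃-suc t t<m)

    -- The reflection x ↦ 1 - x

    private
      z : Carrier
      z = - (1# - x)

    -- With z = x - 1 this interpolates between xᵏ - 1 and £_d(1 - x). By `F-suc`, F d k is the
    -- iterated sum of (x^(i_d) - 1)/(i₁ ⋯ i_d) over k ≥ i₁ ≥ ... ≥ i_d ≥ 1; by `F-m`, it is £_d(1 -
    -- x) at k = p - 1.
    F : ℕ → ℕ → Carrier
    F d k = ∑ k (λ j → bin k (suc j) * (z ^ suc j * inv (suc j) ^ d))

    F-0 : ∀ k → F 0 k ≈ x ^ k - 1#
    F-0 k = lincomb (solve 5 (λ f g w v b → f :- (w :- :# 1) := :# 1 :* (f :- g)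
        :+ :- :# 1 :* (b :- (:# 1 :* :# 1 :+ g)) :+ :- :# 1 :* (v :- b) :+ :- :# 1 :* (w :- v))
        refl (F 0 k) (∑ k (λ j → bin k (suc j) * z ^ suc j)) (x ^ k) ((1# + z) ^ k)
        (∑ (suc k) (λ j → bin k j * z ^ j)))
        (1# ⊡ ∑-cong k (λ _ _ → *-congˡ (*-identityʳ _)) ⊞ - 1# ⊡ ∑-shift k _ ⊞ - 1# ⊡ binomial z k
        ⊞ - 1# ⊡ ^-congˡ k ((solve 1 (λ x → x := :# 1 :+ :- (:# 1 :- x)) refl x)))

    -- Pascal's rule splits the binomial coefficient; in the new part, absorption trades one factor
    -- 1/(j + 1) for 1/(k + 1).
    F-suc : ∀ d k → k < m → F (suc d) (suc k) ≈ F (suc d) k + inv (suc k) * F d (suc k)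
    F-suc d k k<m = begin
      ∑ (suc k) (λ j → bin (suc k) (suc j) * (z ^ suc j * inv (suc j) ^ suc d))
        ≈⟨ ∑-cong (suc k) term ⟩
      ∑ (suc k) (λ j → bin k (suc j) * (z ^ suc j * inv (suc j) ^ suc d) + inv
          (suc k) * (bin (suc k) (suc j) * (z ^ suc j * inv (suc j) ^ d)))
        ≈⟨ ∑-+ (suc k) _ _ ⟩
      (F (suc d) k + bin k (suc k) * (z ^ suc k * inv (suc k) ^ suc d)) + ∑ (suc k)
          (λ j → inv (suc k) * (bin (suc k) (suc j) * (z ^ suc j * inv (suc j) ^ d)))
        ≈⟨ +-cong (trans (+-congˡ (trans (*-congʳ (bin-beyond k)) (zeroˡ _))) (+-identityʳ _))
            (∑-*ˡ (suc k) _ _) ⟩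
      F (suc d) k + inv (suc k) * F d (suc k) ∎
      where
      absorb : ∀ j → # (suc j) * bin (suc k) (suc j) ≈ # (suc k) * bin k j
      absorb j = trans (sym (#-* (suc j) (suc k C suc j)))
          (trans (#-cong (C-absorption k j)) (#-* (suc k) (k C j)))
      term : ∀ j → j < suc k → bin (suc k) (suc j) * (z ^ suc j * inv (suc j) ^ suc d) ≈
             bin k (suc j) * (z ^ suc j * inv (suc j) ^ suc d) + inv
                 (suc k) * (bin (suc k) (suc j) * (z ^ suc j * inv (suc j) ^ d))
      term j j≤k = lincomb (solve 9 (λ B b a w i v l J K
          → B :* (w :* (i :* v)) :- (b :* (w :* (i :* v)) :+ l :* (B :* (w :* v)))
          := w :* i :* v :* (B :- (a :+ b)) :+ :- a :* w :* i :* v :* (K :* l :- :# 1)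
          :+ :- l :* w :* i :* v :* (J :* B :- K :* a) :+ l :* B :* w :* v :* (J :* i :- :# 1))
          refl (bin (suc k) (suc j)) (bin k (suc j)) (bin k j) (z ^ suc j) (inv (suc j)) (inv (suc j) ^ d)
          (inv (suc k)) (# (suc j)) (# (suc k)))
          (((z ^ suc j) * inv (suc j) * (inv (suc j) ^ d)) ⊡ bin-pascal k j
          ⊞ (- bin k j * (z ^ suc j) * inv (suc j) * (inv (suc j) ^ d)) ⊡ #k*inv k k<m
          ⊞ (- inv (suc k) * (z ^ suc j) * inv (suc j) * (inv (suc j) ^ d)) ⊡ absorb j
          ⊞ (inv (suc k) * bin (suc k) (suc j) * (z ^ suc j) * (inv (suc j) ^ d)) ⊡ #k*inv j
          (ℕₚ.<-≤-trans j≤k k<m))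

    F-m : ∀ d → F d m ≈ ∑ m (λ j → inv (suc j) ^ d * (1# - x) ^ suc j)
    F-m d = ∑-cong m λ j j<m → lincomb (solve 5
        (λ b s w v i → b :* (w :* i) :- i :* v := w :* i :* (b :- s) :+ s :* i :* (w :- s :* v)
        :+ i :* v :* (s :* s :- :# 1)) refl (bin m (suc j)) (sgn (suc j)) (z ^ suc j) ((1# - x) ^ suc j)
        (inv (suc j) ^ d)) (((z ^ suc j) * (inv (suc j) ^ d)) ⊡ bin-m (suc j) j<m
        ⊞ (sgn (suc j) * (inv (suc j) ^ d)) ⊡ neg-^ (1# - x) (suc j)
        ⊞ ((inv (suc j) ^ d) * ((1# - x) ^ suc j)) ⊡ sgn² (suc j))

    -- The weight H² − H₂ is twice e₂(1, 1/2, …, 1/j).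
    module _ (t : Carrier) where
      δ G₁ G₂ G₃ : ℕ → Carrier
      δ k  = inv (suc k) * (t ^ suc k - 1#)
      G₁ k = ∑ k δ
      G₂ k = ∑ k (λ j → H j * δ j)
      G₃ k = ∑ k (λ j → (H j * H j - H₂ j) * δ j)

    F₁ : ∀ k → k ≤ m → F 1 k ≈ G₁ x k
    F₁ zero    _ = refl
    F₁ (suc k) k<m = lincomb (solve 6 (λ f1 f g i e w → f1 :- (g :+ i :* (w :- :# 1))
        := :# 1 :* (f1 :- (f :+ i :* e)) :+ i :* (e :- (w :- :# 1)) :+ :# 1 :* (f :- g))
        refl (F 1 (suc k)) (F 1 k) (G₁ x k) (inv (suc k)) (F 0 (suc k)) (x ^ suc k))
        (1# ⊡ F-suc 0 k k<m ⊞ inv (suc k) ⊡ F-0 (suc k) ⊞ 1# ⊡ F₁ k (ℕₚ.<⇒≤ k<m))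

    F₂ : ∀ k → k ≤ m → F 2 k ≈ H k * G₁ x k - G₂ x k
    F₂ zero    _ = solve 1 (λ z → :# 0 := :# 0 :* :# 0 :- :# 0) refl 0#
    F₂ (suc k) k<m = lincomb (solve 8 (λ f1 f e g d g2 i h → f1 :- ((h :+ i) :* (g :+ d) :- (g2 :+ h :* d))
        := :# 1 :* (f1 :- (f :+ i :* e)) :+ i :* (e :- (g :+ d)) :+ :# 1 :* (f :- (h :* g :- g2)))
        refl (F 2 (suc k)) (F 2 k) (F 1 (suc k)) (G₁ x k) (δ x k) (G₂ x k) (inv (suc k)) (H k))
        (1# ⊡ F-suc 1 k k<m ⊞ inv (suc k) ⊡ F₁ (suc k) k<m ⊞ 1# ⊡ F₂ k (ℕₚ.<⇒≤ k<m))

    -- In the iterated sum, `δ` at index j has the coefficient h₂(1/(j + 1), ..., 1/k). This equals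
    -- h₂ - h₁e₁ + e₂ with h taken of 1, ..., 1/k and e of 1, ..., 1/j; doubling gives the stated
    -- combination. `F₂` is the same with h₁ - e₁.
    F₃ : ∀ k → k ≤ m → # 2 * F 3 k ≈ (H k * H k + H₂ k) * G₁ x k - # 2 * (H k * G₂ x k) + G₃ x k
    F₃ zero    _ = solve 1 (λ z → :# 2 :* :# 0 := (:# 0 :* :# 0 :+ :# 0) :* :# 0 :- :# 2 :* (:# 0 :* :# 0)
        :+ :# 0) refl 0#
    F₃ (suc k) k<m = lincomb (solve 10 (λ f1 f e g d g2 g3 i h q
        → :# 2 :* f1 :- (((h :+ i) :* (h :+ i) :+ (q :+ i :* i)) :* (g
        :+ d) :- :# 2 :* ((h :+ i) :* (g2 :+ h :* d)) :+ (g3 :+ (h :* h :- q) :* d))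
        := :# 2 :* (f1 :- (f :+ i :* e)) :+ :# 2 :* i :* (e :- ((h :+ i) :* (g :+ d) :- (g2 :+ h :* d)))
        :+ :# 1 :* (:# 2 :* f :- ((h :* h :+ q) :* g :- :# 2 :* (h :* g2) :+ g3)))
        refl (F 3 (suc k)) (F 3 k) (F 2 (suc k)) (G₁ x k) (δ x k) (G₂ x k) (G₃ x k) (inv (suc k)) (H k) (H₂ k))
        (# 2 ⊡ F-suc 2 k k<m ⊞ (# 2 * inv (suc k)) ⊡ F₂ (suc k) k<m ⊞ 1# ⊡ F₃ k (ℕₚ.<⇒≤ k<m))

    ∑δ : ∀ t (w : Seq) → ∑ m (λ j → w j * δ t j) ≈ ∑ m (λ j → w j * inv (suc j) * t ^ suc j) - ∑ m
        (λ j → w j * inv (suc j))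
    ∑δ t w = trans (∑-cong m λ j _ → (solve 3
        (λ w i v → w :* (i :* (v :- :# 1)) := :# 1 :* (w :* i :* v) :+ :- :# 1 :* (w :* i))
        refl (w j) (inv (suc j)) (t ^ suc j))) (trans (∑-lin m 1# (- 1#) _ _)
      ((solve 2 (λ a b → :# 1 :* a :+ :- :# 1 :* b := a :- b)
          refl (∑ m (λ j → w j * inv (suc j) * t ^ suc j)) (∑ m (λ j → w j * inv (suc j))))))

    L₁-reflect : L₁ (1# - x) ≈ L₁ x
    L₁-reflect = begin
      L₁ (1# - x)
        ≈⟨ trans (ev-suc inv _ inv-0) (∑-cong m λ j _ → *-congʳ (sym (*-identityʳ _))) ⟩
      ∑ m (λ j → inv (suc j) ^ 1 * (1# - x) ^ suc j)
        ≈⟨ trans (sym (F-m 1)) (trans (F₁ m ℕₚ.≤-refl)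
            (trans (∑-cong m λ j _ → sym (*-identityˡ _)) (∑δ x (λ _ → 1#)))) ⟩
      ∑ m (λ j → 1# * inv (suc j) * x ^ suc j) - ∑ m (λ j → 1# * inv (suc j))
        ≈⟨ +-cong (trans (∑-cong m λ j _ → *-congʳ (*-identityˡ _)) (sym (ev-suc inv x inv-0)))
            (-‿cong (trans (∑-cong m λ j _ → trans (*-identityˡ _) (sym (*-identityʳ _)))
                (sum-inv^ 1 z<s (s≤s (ℕₚ.≤-trans (s≤s z≤n) 3<n))))) ⟩
      L₁ x - 0#
        ≈⟨ solve 1 (λ a → a :- :# 0 := a) refl (L₁ x) ⟩
      L₁ x ∎

    L₂-reflect : L₂ (1# - x) ≈ L₂ x - A
    L₂-reflect = begin
      L₂ (1# - x)
        ≈⟨ trans (ev-suc inv² _ inv²-0) (∑-cong m λ j _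
            → *-congʳ ((solve 1 (λ i → i :* i := i :^ 2) refl (inv (suc j))))) ⟩
      ∑ m (λ j → inv (suc j) ^ 2 * (1# - x) ^ suc j)
        ≈⟨ trans (sym (F-m 2)) (F₂ m ℕₚ.≤-refl) ⟩
      H m * G₁ x m - G₂ x m
        ≈⟨ lincomb (solve 6 (λ h g g2 a b b2 → h :* g :- g2 :- :- a := g :* (h :- :# 0)
            :+ :- :# 1 :* (g2 :- (a :- b)) :+ :# 1 :* (b :- b2) :+ :# 1 :* (b2 :- :# 0))
            refl (H m) (G₁ x m) (G₂ x m) (∑ m (λ j → H j * inv (suc j) * x ^ suc j))
            (∑ m (λ j → H j * inv (suc j))) (∑ m (λ j → inv (suc j) * H j)))
            (G₁ x m ⊡ H-m ⊞ - 1# ⊡ ∑δ x H ⊞ 1# ⊡ ∑-cong m (λ _ _ → *-comm _ _) ⊞ 1# ⊡ ∑inv-H-m) ⟩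
      - ∑ m (λ j → H j * inv (suc j) * x ^ suc j)
        ≈⟨ -‿cong (trans (∑-cong m λ j _ → (solve 3
            (λ h i w → h :* i :* w := :# 1 :* ((h :+ i) :* i :* w) :+ :- :# 1 :* (i :* i :* w))
            refl (H j) (inv (suc j)) (x ^ suc j))) (∑-lin m 1# (- 1#) _ _)) ⟩
      - (1# * ∑ m (λ j → H·inv (suc j) * x ^ suc j) + - 1# * ∑ m (λ j → inv² (suc j) * x ^ suc j))
        ≈⟨ lincomb (solve 4 (λ a b A L → :- (:# 1 :* a :+ :- :# 1 :* b) :- (L :- A) := :# 1 :* (A :- a)
            :+ :- :# 1 :* (L :- b)) refl (∑ m (λ j → H·inv (suc j) * x ^ suc j))
            (∑ m (λ j → inv² (suc j) * x ^ suc j)) A (L₂ x))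
            (1# ⊡ ev-suc H·inv x (zeroˡ _) ⊞ - 1# ⊡ ev-suc inv² x inv²-0) ⟩
      L₂ x - A ∎

    -- At k = p - 1 both H and H₂ vanish and only the e₂-weighted sum survives. It is kept in this
    -- form because it is used in two ways: rewritten with the weights at j + 1 in `L₃-reflect`, and
    -- reversed in `∑e₂-flip` to treat the argument 1 - 1/x.
    2L₃-as-G₃ : # 2 * L₃ (1# - x) ≈ ∑ m (λ j → (H j * H j - H₂ j) * inv (suc j) * x ^ suc j)
    2L₃-as-G₃ = begin
      # 2 * L₃ (1# - x)
        ≈⟨ *-congˡ (trans (ev-suc inv³ _ inv³-0)
            (∑-cong m λ j _ → *-congʳ ((solve 1 (λ i → i :* i :* i := i :^ 3) refl (inv (suc j)))))) ⟩
      # 2 * ∑ m (λ j → inv (suc j) ^ 3 * (1# - x) ^ suc j)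
        ≈⟨ trans (*-congˡ (sym (F-m 3))) (F₃ m ℕₚ.≤-refl) ⟩
      (H m * H m + H₂ m) * G₁ x m - # 2 * (H m * G₂ x m) + G₃ x m
        ≈⟨ lincomb (solve 7 (λ h q g g2 g3 a b → (h :* h :+ q) :* g :- :# 2 :* (h :* g2) :+ g3 :- a
            := (h :* g :- :# 2 :* g2) :* (h :- :# 0) :+ g :* (q :- :# 0) :+ :# 1 :* (g3 :- (a :- b))
            :+ :- :# 1 :* (b :- :# 0)) refl (H m) (H₂ m) (G₁ x m) (G₂ x m) (G₃ x m)
            (∑ m (λ j → (H j * H j - H₂ j) * inv (suc j) * x ^ suc j))
            (∑ m (λ j → (H j * H j - H₂ j) * inv (suc j))))
            ((H m * G₁ x m - # 2 * G₂ x m) ⊡ H-m ⊞ G₁ x m ⊡ H₂-m ⊞ 1# ⊡ ∑δ x (λ j → H j * H j - H₂ j)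
            ⊞ - 1# ⊡ ∑e₂-inv-m) ⟩
      ∑ m (λ j → (H j * H j - H₂ j) * inv (suc j) * x ^ suc j) ∎

    L₃-reflect : # 2 * L₃ (1# - x) ≈ P - S - # 2 * T + # 2 * L₃ x
    L₃-reflect = begin
      # 2 * L₃ (1# - x)
        ≈⟨ 2L₃-as-G₃ ⟩
      ∑ m (λ j → (H j * H j - H₂ j) * inv (suc j) * x ^ suc j)
        ≈⟨ ∑-cong m (λ j _ → *-congʳ ((solve 3
            (λ h g i → (h :* h :- g) :* i := :# 1 :* ((h :+ i) :* (h :+ i) :* i)
            :+ (:- :# 1 :* ((g :+ i :* i) :* i)
            :+ (:- :# 2 :* ((h :+ i) :* i :* i) :+ (:# 2 :* (i :* i :* i) :+ :# 0))))
            refl (H j) (H₂ j) (inv (suc j))))) ⟩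
      ∑ m (λ j → comb l (suc j) * x ^ suc j)
        ≈⟨ ev-suc (comb l) x (lincomb (solve 1
            (λ i → :# 1 :* (:# 0 :* :# 0 :* i)
            :+ (:- :# 1 :* (:# 0 :* i) :+ (:- :# 2 :* (:# 0 :* i :* i) :+ (:# 2 :* (i :* i :* i) :+ :# 0)))
            :- :# 0 := :# 2 :* i :* i :* (i :- :# 0)) refl (inv 0)) ((# 2 * inv 0 * inv 0) ⊡ inv-0)) ⟨
      ev (comb l) x
        ≈⟨ ev-comb x l ⟩
      comb-ev x l
        ≈⟨ solve 4 (λ P S T L → :# 1 :* P :+ (:- :# 1 :* S :+ (:- :# 2 :* T :+ (:# 2 :* L :+ :# 0)))
            := P :- S :- :# 2 :* T :+ :# 2 :* L) refl P S T (L₃ x) ⟩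
      P - S - # 2 * T + # 2 * L₃ x ∎
      where
      l = (1# , H²·inv) ∷ (- 1# , H₂·inv) ∷ (- # 2 , H·inv²) ∷ (# 2 , inv³) ∷ []

    -- The inversion x ↦ 1/x

    module Inversion (y : Carrier) (xy : x * y ≈ 1#) where
      x^k*y^k : ∀ k → x ^ k * y ^ k ≈ 1#
      x^k*y^k zero = *-identityˡ _
      x^k*y^k (suc k) = lincomb (solve 4 (λ x y v w → x :* v :* (y :* w) :- :# 1 := v :* w :* (x :* y :- :# 1)
          :+ :# 1 :* (v :* w :- :# 1)) refl x y (x ^ k) (y ^ k)) (((x ^ k) * (y ^ k)) ⊡ xy ⊞ 1# ⊡ x^k*y^k k)

      flip-sum : ∀ k → k < m → suc (n ∸ k) ℕ.+ suc k ≡ p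
      flip-sum k k<m = ≡.cong suc (≡.trans (ℕₚ.+-suc (n ∸ k) k) (≡.cong suc (ℕₚ.m∸n+n≡m (ℕₚ.≤-pred k<m))))

      X*y^ : ∀ k → k < m → X * y ^ suc (n ∸ k) ≈ x ^ suc k
      X*y^ k k<m = lincomb (solve 5 (λ X w v u q → X :* w :- v := :- w :* (q :- X) :+ w :* (q :- u :* v)
          :+ v :* (u :* w :- :# 1)) refl X (y ^ suc (n ∸ k)) (x ^ suc k) (x ^ suc (n ∸ k)) (x ^ p))
          (- (y ^ suc (n ∸ k)) ⊡ x^p ⊞ (y ^ suc (n ∸ k)) ⊡ trans (^-congʳ x (≡.sym (flip-sum k k<m)))
          (^-homo-* x (suc (n ∸ k)) (suc k)) ⊞ (x ^ suc k) ⊡ x^k*y^k (suc (n ∸ k)))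

      -- The substitution k ↦ p - k, using X · (1/x)^(p - k) = xᵏ.
      ∑-flip : ∀ (u v : ℕ → Carrier) → (∀ k → k < m → u (n ∸ k) ≈ v k) →
               X * ∑ m (λ k → u k * y ^ suc k) ≈ ∑ m (λ k → v k * x ^ suc k)
      ∑-flip u v h = begin
        X * ∑ m (λ k → u k * y ^ suc k)
          ≈⟨ trans (*-congˡ (∑-rev m _)) (sym (∑-*ˡ m X _)) ⟩
        ∑ m (λ k → X * (u (n ∸ k) * y ^ suc (n ∸ k)))
          ≈⟨ ∑-cong m (λ k k<m → lincomb (solve 5
              (λ X u v w t → X :* (u :* w) :- v :* t := u :* (X :* w :- t) :+ t :* (u :- v))
              refl X (u (n ∸ k)) (v k) (y ^ suc (n ∸ k)) (x ^ suc k))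
              (u (n ∸ k) ⊡ X*y^ k k<m ⊞ (x ^ suc k) ⊡ h k k<m)) ⟩
        ∑ m (λ k → v k * x ^ suc k) ∎

      inv-flip : ∀ k → k < m → inv (suc (n ∸ k)) ≈ - inv (suc k)
      inv-flip k k<m = inv-reflect (suc (n ∸ k)) (suc k) (flip-sum k k<m)

      H-sum : ∀ k → k < m → (n ∸ k) ℕ.+ suc k ≡ m
      H-sum k k<m = ≡.cong ℕ.pred (flip-sum k k<m)

      L₁-inversion : X * L₁ y ≈ - L₁ x
      L₁-inversion = begin
        X * L₁ y
          ≈⟨ *-congˡ (ev-suc inv y inv-0) ⟩
        X * ∑ m (λ k → inv (suc k) * y ^ suc k)
          ≈⟨ ∑-flip (λ k → inv (suc k)) (λ k → - inv (suc k)) inv-flip ⟩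
        ∑ m (λ k → - inv (suc k) * x ^ suc k)
          ≈⟨ trans (∑-cong m λ k _ → (solve 2 (λ i w → :- i :* w := :- :# 1 :* (i :* w))
              refl (inv (suc k)) (x ^ suc k))) (∑-*ˡ m (- 1#) _) ⟩
        - 1# * ∑ m (λ k → inv (suc k) * x ^ suc k)
          ≈⟨ lincomb (solve 2 (λ s L → :- :# 1 :* s :- :- L := :# 1 :* (L :- s))
              refl (∑ m (λ k → inv (suc k) * x ^ suc k)) (L₁ x)) (1# ⊡ ev-suc inv x inv-0) ⟩
        - L₁ x ∎

      L₂-inversion : X * L₂ y ≈ L₂ x
      L₂-inversion = begin
        X * L₂ y
          ≈⟨ *-congˡ (ev-suc inv² y inv²-0) ⟩
        X * ∑ m (λ k → inv² (suc k) * y ^ suc k)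
          ≈⟨ ∑-flip (λ k → inv² (suc k)) (λ k → inv² (suc k))
              (λ k k<m → lincomb (solve 2 (λ i j → i :* i :- j :* j := (i :- j) :* (i :- :- j))
              refl (inv (suc (n ∸ k))) (inv (suc k))) ((inv (suc (n ∸ k)) - inv (suc k)) ⊡ inv-flip k k<m)) ⟩
        ∑ m (λ k → inv² (suc k) * x ^ suc k)
          ≈⟨ ev-suc inv² x inv²-0 ⟨
        L₂ x ∎

      L₃-inversion : X * L₃ y ≈ - L₃ x
      L₃-inversion = begin
        X * L₃ y
          ≈⟨ *-congˡ (ev-suc inv³ y inv³-0) ⟩
        X * ∑ m (λ k → inv³ (suc k) * y ^ suc k)
          ≈⟨ ∑-flip (λ k → inv³ (suc k)) (λ k → - inv³ (suc k))
              (λ k k<m → lincomb (solve 2 (λ i j → i :* i :* i :- :- (j :* j :* j)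
              := (i :* i :- i :* j :+ j :* j) :* (i :- :- j)) refl (inv (suc (n ∸ k))) (inv (suc k)))
              ((inv (suc (n ∸ k)) * inv (suc (n ∸ k)) - inv (suc (n ∸ k)) * inv (suc k) + inv (suc k) * inv
              (suc k)) ⊡ inv-flip k k<m)) ⟩
        ∑ m (λ k → - inv³ (suc k) * x ^ suc k)
          ≈⟨ trans (∑-cong m λ k _ → (solve 2 (λ i w → :- i :* w := :- :# 1 :* (i :* w))
              refl (inv³ (suc k)) (x ^ suc k))) (∑-*ˡ m (- 1#) _) ⟩
        - 1# * ∑ m (λ k → inv³ (suc k) * x ^ suc k)
          ≈⟨ lincomb (solve 2 (λ s L → :- :# 1 :* s :- :- L := :# 1 :* (L :- s))
              refl (∑ m (λ k → inv³ (suc k) * x ^ suc k)) (L₃ x)) (1# ⊡ ev-suc inv³ x inv³-0) ⟩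
        - L₃ x ∎

      -- Reversal sends H_(k - 1) to H_k, H₂ likewise with a minus sign, and 1/k to -1/k. So the
      -- weight 2e₂ = H² - H₂ turns into -2h₂ = -(H² + H₂).
      ∑e₂-flip : X * ∑ m (λ j → (H j * H j - H₂ j) * inv (suc j) * y ^ suc j) ≈ - (P + S)
      ∑e₂-flip = begin
        X * ∑ m (λ j → (H j * H j - H₂ j) * inv (suc j) * y ^ suc j)
          ≈⟨ ∑-flip _ (λ k → comb l (suc k)) flip ⟩
        ∑ m (λ k → comb l (suc k) * x ^ suc k)
          ≈⟨ ev-suc (comb l) x ((solve 1 (λ i → :- :# 1 :* (:# 0 :* :# 0 :* i)
              :+ (:- :# 1 :* (:# 0 :* i) :+ :# 0) := :# 0) refl (inv 0))) ⟨
        ev (comb l) x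
          ≈⟨ ev-comb x l ⟩
        comb-ev x l
          ≈⟨ solve 2 (λ P S → :- :# 1 :* P :+ (:- :# 1 :* S :+ :# 0) := :- (P :+ S)) refl P S ⟩
        - (P + S) ∎
        where
        l = (- 1# , H²·inv) ∷ (- 1# , H₂·inv) ∷ []
        flip : ∀ k → k < m → (H (n ∸ k) * H (n ∸ k) - H₂ (n ∸ k)) * inv (suc (n ∸ k)) ≈ comb l (suc k)
        flip k k<m = lincomb (solve 6 (λ h h1 g g1 i j
            → (h :* h :- g) :* i :- (:- :# 1 :* (h1 :* h1 :* j) :+ (:- :# 1 :* (g1 :* j) :+ :# 0))
            := (h :* h :- g) :* (i :- :- j) :+ :- j :* (h :+ h1) :* (h :- h1) :+ j :* (g :- :- g1))
            refl (H (n ∸ k)) (H (suc k)) (H₂ (n ∸ k)) (H₂ (suc k)) (inv (suc (n ∸ k))) (inv (suc k)))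
            ((H (n ∸ k) * H (n ∸ k) - H₂ (n ∸ k)) ⊡ inv-flip k k<m
            ⊞ (- inv (suc k) * (H (n ∸ k) + H (suc k))) ⊡ H-reflect (n ∸ k) (suc k) (H-sum k k<m)
            ⊞ inv (suc k) ⊡ H₂-reflect (n ∸ k) (suc k) (H-sum k k<m))

    -- The duplication x ↦ x²

    ∑-even-odd : ∀ h f → ∑ (suc (h ℕ.+ h)) f ≈ ∑ (suc h) (λ j → f (j ℕ.+ j)) + ∑ h (λ j → f (suc (j ℕ.+ j)))
    ∑-even-odd zero    f = sym (+-identityʳ _)
    ∑-even-odd (suc h) f = begin
      ∑ (suc (suc h ℕ.+ suc h)) f
        ≡⟨ ≡.cong (λ q → ∑ (suc (suc q)) f) (ℕₚ.+-suc h h) ⟩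
      ∑ (suc (h ℕ.+ h)) f + f (suc (h ℕ.+ h)) + f (suc (suc (h ℕ.+ h)))
        ≈⟨ lincomb (solve 6 (λ t a b u v w → t :+ u :+ v :- (a :+ w :+ (b :+ u)) := :# 1 :* (t :- (a :+ b))
            :+ :- :# 1 :* (w :- v)) refl (∑ (suc (h ℕ.+ h)) f) (∑ (suc h) (λ j → f (j ℕ.+ j)))
            (∑ h (λ j → f (suc (j ℕ.+ j)))) (f (suc (h ℕ.+ h))) (f (suc (suc (h ℕ.+ h))))
            (f (suc h ℕ.+ suc h))) (1# ⊡ ∑-even-odd h f
            ⊞ - 1# ⊡ reflexive (≡.cong (λ q → f (suc q)) (ℕₚ.+-suc h h))) ⟩
      ∑ (suc (suc h)) (λ j → f (j ℕ.+ j)) + ∑ (suc h) (λ j → f (suc (j ℕ.+ j))) ∎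

    -- On the left the terms of even degree cancel the factor X; those of odd degree k pick it up and have degree k + p.
    duplication : ∀ h → p ≡ suc (h ℕ.+ h) → (u v : Seq) → (∀ j k → # k ≈ # (j ℕ.+ j) → u k ≈ v j) →
                  (1# + X) * ev u x + (1# - X) * ev u (- x) ≈ # 2 * ev v (x * x)
    duplication h p≡ u v uv = begin
      (1# + X) * ev u x + (1# - X) * ev u (- x)
        ≈⟨ ∑-lin p _ _ _ _ ⟨
      ∑ p g
        ≡⟨ ≡.cong (λ q → ∑ q g) p≡ ⟩
      ∑ (suc (h ℕ.+ h)) g
        ≈⟨ ∑-even-odd h g ⟩
      ∑ (suc h) (λ j → g (j ℕ.+ j)) + ∑ h (λ j → g (suc (j ℕ.+ j)))
        ≈⟨ +-cong (trans (∑-cong (suc h) λ j _ → even j) (∑-*ˡ (suc h) (# 2) _))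
            (trans (∑-cong h λ j _ → odd j) (∑-*ˡ h (# 2) _)) ⟩
      # 2 * ∑ (suc h) (λ j → v j * (x * x) ^ j) + # 2 * ∑ h (λ j → v (suc h ℕ.+ j) * (x * x) ^ (suc h ℕ.+ j))
        ≈⟨ distribˡ _ _ _ ⟨
      # 2 * (∑ (suc h) (λ j → v j * (x * x) ^ j) + ∑ h (λ j → v (suc h ℕ.+ j) * (x * x) ^ (suc h ℕ.+ j)))
        ≈⟨ *-congˡ (∑-split (suc h) h _) ⟨
      # 2 * ∑ (suc (h ℕ.+ h)) (λ j → v j * (x * x) ^ j)
        ≡⟨ ≡.cong (λ q → # 2 * ∑ q (λ j → v j * (x * x) ^ j)) p≡ ⟨
      # 2 * ev v (x * x) ∎
      where
      g : Seq
      g k = (1# + X) * (u k * x ^ k) + (1# - X) * (u k * (- x) ^ k)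
      sgn-even : ∀ j → sgn (j ℕ.+ j) ≈ 1#
      sgn-even j = trans (^-homo-* (- 1#) j j) (sgn² j)
      x²^ : ∀ j → (x * x) ^ j ≈ x ^ (j ℕ.+ j)
      x²^ j = trans (^-distrib-* x x j) (sym (^-homo-* x j j))
      even : ∀ j → g (j ℕ.+ j) ≈ # 2 * (v j * (x * x) ^ j)
      even j = lincomb (solve 7 (λ X u v w w1 t s → (:# 1 :+ X) :* (u :* w)
          :+ (:# 1 :- X) :* (u :* w1) :- :# 2 :* (v :* t) := (:# 1 :- X) :* u :* (w1 :- s :* w)
          :+ (:# 1 :- X) :* u :* w :* (s :- :# 1) :+ :# 2 :* w :* (u :- v) :+ :- :# 2 :* v :* (t :- w))
          refl X (u (j ℕ.+ j)) (v j) (x ^ (j ℕ.+ j)) ((- x) ^ (j ℕ.+ j)) ((x * x) ^ j) (sgn (j ℕ.+ j)))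
          (((1# - X) * u (j ℕ.+ j)) ⊡ neg-^ x (j ℕ.+ j)
          ⊞ ((1# - X) * u (j ℕ.+ j) * (x ^ (j ℕ.+ j))) ⊡ sgn-even j ⊞ (# 2 * (x ^ (j ℕ.+ j))) ⊡ uv j (j ℕ.+ j)
          refl ⊞ (- # 2 * v j) ⊡ x²^ j)
      -- The index h + 1 + j is half of k + p for the odd degree k = 2j + 1.
      shifted : ∀ j → (suc h ℕ.+ j) ℕ.+ (suc h ℕ.+ j) ≡ suc (j ℕ.+ j) ℕ.+ p
      shifted j = ≡.trans (solve-ℕ h j) (≡.cong (suc (j ℕ.+ j) ℕ.+_) (≡.sym p≡))
        where
        open import Data.Nat.Tactic.RingSolver using (solve-∀)
        solve-ℕ : ∀ h j → (suc h ℕ.+ j) ℕ.+ (suc h ℕ.+ j) ≡ suc (j ℕ.+ j) ℕ.+ suc (h ℕ.+ h)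
        solve-ℕ = solve-∀
      odd : ∀ j → g (suc (j ℕ.+ j)) ≈ # 2 * (v (suc h ℕ.+ j) * (x * x) ^ (suc h ℕ.+ j))
      odd j = lincomb (solve 9 (λ X u v w w1 t s r q → (:# 1 :+ X) :* (u :* w)
          :+ (:# 1 :- X) :* (u :* w1) :- :# 2 :* (v :* t) := (:# 1 :- X) :* u :* (w1 :- :- :# 1 :* s :* w)
          :+ :- (:# 1 :- X) :* u :* w :* (s :- :# 1) :+ :# 2 :* X :* w :* (u :- v) :+ :- :# 2 :* v :* (t :- r)
          :+ :- :# 2 :* v :* (r :- w :* q) :+ :- :# 2 :* v :* w :* (q :- X))
          refl X (u k) (v (suc h ℕ.+ j)) (x ^ k) ((- x) ^ k) ((x * x) ^ (suc h ℕ.+ j)) (sgn (j ℕ.+ j))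
          (x ^ (suc h ℕ.+ j ℕ.+ (suc h ℕ.+ j))) (x ^ p))
          (((1# - X) * u k) ⊡ neg-^ x k ⊞ (- (1# - X) * u k * (x ^ k)) ⊡ sgn-even j
          ⊞ (# 2 * X * (x ^ k)) ⊡ uv (suc h ℕ.+ j) k k≈ ⊞ (- # 2 * v (suc h ℕ.+ j)) ⊡ x²^ (suc h ℕ.+ j)
          ⊞ (- # 2 * v (suc h ℕ.+ j)) ⊡ trans (^-congʳ x (shifted j)) (^-homo-* x k p)
          ⊞ (- # 2 * v (suc h ℕ.+ j) * (x ^ k)) ⊡ x^p)
        where
        k = suc (j ℕ.+ j)
        k≈ : # k ≈ # ((suc h ℕ.+ j) ℕ.+ (suc h ℕ.+ j))
        k≈ = lincomb (solve 3 (λ a b p → a :- b := :- :# 1 :* (b :- (a :+ p)) :+ :- :# 1 :* (p :- :# 0))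
            refl (# k) (# ((suc h ℕ.+ j) ℕ.+ (suc h ℕ.+ j))) (# p))
            (- 1# ⊡ trans (#-cong (shifted j)) (#-+ k p) ⊞ - 1# ⊡ char)

    inv-double : ∀ j k → # k ≈ # (j ℕ.+ j) → inv k ≈ inv 2 * inv j
    inv-double j k h = trans (^-congˡ n (trans h
        (trans (#-+ j j) ((solve 1 (λ j → j :+ j := :# 2 :* j) refl (# j)))))) (^-distrib-* (# 2) (# j) n)

    2*inv2 : # 2 * inv 2 ≈ 1#
    2*inv2 = #k*inv 1 (s≤s (ℕₚ.≤-trans (s≤s z≤n) 3<n))

    L₂-duplication : ∀ h → p ≡ suc (h ℕ.+ h) → # 2 * ((1# + X) * L₂ x + (1# - X) * L₂ (- x)) ≈ L₂ (x * x)
    L₂-duplication h p≡ = lincomb (solve 7 (λ X a b e e2 c h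
        → :# 2 :* ((:# 1 :+ X) :* a :+ (:# 1 :- X) :* b) :- c
        := :# 2 :* ((:# 1 :+ X) :* a :+ (:# 1 :- X) :* b :- :# 2 :* e) :+ :# 4 :* (e :- e2)
        :+ :# 4 :* (e2 :- (h :* h :* c :+ :# 0)) :+ c :* (:# 2 :* h :+ :# 1) :* (:# 2 :* h :- :# 1))
        refl X (L₂ x) (L₂ (- x)) (ev (λ j → inv 2 * inv j * (inv 2 * inv j)) (x * x))
        (ev (comb ((inv² 2 , inv²) ∷ [])) (x * x)) (L₂ (x * x)) (inv 2))
        (# 2 ⊡ duplication h p≡ inv² _ (λ j k q → *-cong (inv-double j k q) (inv-double j k q))
        ⊞ # 4 ⊡ ev-cong (x * x) term ⊞ # 4 ⊡ ev-comb (x * x) ((inv² 2 , inv²) ∷ [])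
        ⊞ (L₂ (x * x) * (# 2 * inv 2 + 1#)) ⊡ 2*inv2)
      where
      term : ∀ s → s < p → inv 2 * inv s * (inv 2 * inv s) ≈ comb ((inv² 2 , inv²) ∷ []) s
      term s _ = solve 2 (λ h i → h :* i :* (h :* i) := h :* h :* (i :* i) :+ :# 0) refl (inv 2) (inv s)

    L₃-duplication : ∀ h → p ≡ suc (h ℕ.+ h) → # 4 * ((1# + X) * L₃ x + (1# - X) * L₃ (- x)) ≈ L₃ (x * x)
    L₃-duplication h p≡ = lincomb (solve 7 (λ X a b e e2 c h
        → :# 4 :* ((:# 1 :+ X) :* a :+ (:# 1 :- X) :* b) :- c
        := :# 4 :* ((:# 1 :+ X) :* a :+ (:# 1 :- X) :* b :- :# 2 :* e) :+ :# 8 :* (e :- e2)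
        :+ :# 8 :* (e2 :- (h :* h :* h :* c :+ :# 0))
        :+ c :* (:# 4 :* h :* h :+ :# 2 :* h :+ :# 1) :* (:# 2 :* h :- :# 1))
        refl X (L₃ x) (L₃ (- x)) (ev (λ j → inv 2 * inv j * (inv 2 * inv j) * (inv 2 * inv j)) (x * x))
        (ev (comb ((inv³ 2 , inv³) ∷ [])) (x * x)) (L₃ (x * x)) (inv 2))
        (# 4 ⊡ duplication h p≡ inv³ _ (λ j k q
        → *-cong (*-cong (inv-double j k q) (inv-double j k q)) (inv-double j k q))
        ⊞ # 8 ⊡ ev-cong (x * x) term ⊞ # 8 ⊡ ev-comb (x * x) ((inv³ 2 , inv³) ∷ [])
        ⊞ (L₃ (x * x) * (# 4 * inv 2 * inv 2 + # 2 * inv 2 + 1#)) ⊡ 2*inv2)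
      where
      term : ∀ s → s < p → inv 2 * inv s * (inv 2 * inv s) * (inv 2 * inv s) ≈ comb ((inv³ 2 , inv³) ∷ []) s
      term s _ = solve 2 (λ h i → h :* i :* (h :* i) :* (h :* i) := h :* h :* h :* (i :* i :* i) :+ :# 0)
          refl (inv 2) (inv s)

  -- The quadratic and the cubic identity for £₁

  L₁-square : ∀ x → L₁ x * L₁ x ≈ - # 2 * (x ^ p * L₂ x) - # 2 * ((1# - x ^ p) * L₂ (1# - x))
  L₁-square x = lincomb (solve 5 (λ l X a a2 A → l :* l :- (:- :# 2 :* (X :* a) :- :# 2 :* ((:# 1 :- X) :* a2))
      := :# 1 :* (l :* l :- (:# 2 :* (:# 1 :- X) :* A :- :# 2 :* a))
      :+ :- (:- :# 2 :* (:# 1 :- X)) :* (a2 :- (a :- A)))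
      refl (L₁ x) (x ^ p) (L₂ x) (L₂ (1# - x)) (Twisted.A x (x ^ p) refl))
      (1# ⊡ Twisted.L₁² x (x ^ p) refl ⊞ - (- # 2 * (1# - (x ^ p))) ⊡ Twisted.L₂-reflect x (x ^ p) refl)

  -- Multiplying `L₁²` by £₁(x) and inserting `L₁A` and `L₁L₂`, the unknowns collect to (1 - X)(3(P
  -- - S - 2T) - 3X(P + S) - 2Xβ) + 6£₃(x). The first combination is the one that `L₃-reflect`
  -- evaluates, the second the one that `∑e₂-flip` evaluates at 1/x.
  L₁-cube : ∀ x y → x * y ≈ 1# →
    L₁ x * L₁ x * L₁ x ≈ # 6 * (x ^ p * (1# - x ^ p) * (x ^ p * L₃ (1# - y))) + # 6 * (x ^ p * L₃ x) +
        # 6 * ((1# - x ^ p) * L₃ (1# - x))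
                         - # 2 * (x ^ p * (1# - x ^ p) * β)
  L₁-cube x y xy = lincomb (solve 12 (λ l X a w e c c2 A P S T b
      → l :* l :* l :- (:# 6 :* (X :* (:# 1 :- X) :* (X :* w)) :+ :# 6 :* (X :* c)
      :+ :# 6 :* ((:# 1 :- X) :* c2) :- :# 2 :* (X :* (:# 1 :- X) :* b))
      := l :* (l :* l :- (:# 2 :* (:# 1 :- X) :* A :- :# 2 :* a))
      :+ (:# 1 :- X) :* (:# 2 :* (l :* A) :-
      (:# 3 :* P :- S :- :# 2 :* T :- :# 3 :* (X :* (P :+ S)) :- :# 2 :* (X :* b)))
      :+ :- :# 2 :* (l :* a :- ((:# 1 :- X) :* (:# 2 :* T :+ S) :- :# 3 :* c))
      :+ :- :# 3 :* (:# 1 :- X) :* (:# 2 :* c2 :- (P :- S :- :# 2 :* T :+ :# 2 :* c))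
      :+ :- :# 3 :* X :* (:# 1 :- X) :* X :* (:# 2 :* w :- e)
      :+ :- :# 3 :* X :* (:# 1 :- X) :* (X :* e :- :- (P :+ S)))
      refl (L₁ x) (x ^ p) (L₂ x) (L₃ (1# - y)) (∑ m (λ j → (H j * H j - H₂ j) * inv (suc j) * y ^ suc j))
      (L₃ x) (L₃ (1# - x)) (Twisted.A x (x ^ p) refl) (Twisted.P x (x ^ p) refl) (Twisted.S x (x ^ p) refl)
      (Twisted.T x (x ^ p) refl) β) (L₁ x ⊡ Twisted.L₁² x (x ^ p) refl ⊞ (1# - (x ^ p)) ⊡ Twisted.L₁A x (x ^ p)
      refl ⊞ - # 2 ⊡ Twisted.L₁L₂ x (x ^ p) refl ⊞ (- # 3 * (1# - (x ^ p))) ⊡ Twisted.L₃-reflect x (x ^ p) refl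
      ⊞ (- # 3 * (x ^ p) * (1# - (x ^ p)) * (x ^ p)) ⊡ Twisted.2L₃-as-G₃ y (y ^ p) refl
      ⊞ (- # 3 * (x ^ p) * (1# - (x ^ p))) ⊡ Twisted.Inversion.∑e₂-flip x (x ^ p) refl y xy)

  L₁-reflect : ∀ x → L₁ (1# - x) ≈ L₁ x
  L₁-reflect x = Twisted.L₁-reflect x (x ^ p) refl

  -- Solving the linear systems at the golden ratio

  record Golden (x y X : Carrier) : Set ℓ where
    field
      x+y : x + y ≈ 1#
      x*y : x * y ≈ - 1#
      x^p : x ^ p ≈ X

  module GoldenValues {x y X Q : Carrier} (g : Golden x y X) (L₁x : L₁ x ≈ - Q) (h : ℕ)
      (p-odd : p ≡ suc (h ℕ.+ h)) where
    open Golden g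

    y≈ : 1# - x ≈ y
    y≈ = lincomb (solve 2 (λ x y → :# 1 :- x :- y := :- :# 1 :* (x :+ y :- :# 1)) refl x y) (- 1# ⊡ x+y)

    x² : 1# - - x ≈ x * x
    x² = lincomb (solve 2 (λ x y → :# 1 :- :- x :- x :* x := :- x :* (x :+ y :- :# 1)
        :+ :# 1 :* (x :* y :- :- :# 1)) refl x y) (- x ⊡ x+y ⊞ 1# ⊡ x*y)

    y² : 1# - - y ≈ y * y
    y² = lincomb (solve 2 (λ x y → :# 1 :- :- y :- y :* y := :- y :* (x :+ y :- :# 1)
        :+ :# 1 :* (x :* y :- :- :# 1)) refl x y) (- y ⊡ x+y ⊞ 1# ⊡ x*y)

    y^p : y ^ p ≈ 1# - X
    y^p = begin
      y ^ p              ≈⟨ ^-congˡ p (lincomb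
          (solve 2 (λ x y → y :- (:# 1 :+ :- x) := :# 1 :* (x :+ y :- :# 1)) refl x y) (1# ⊡ x+y)) ⟩
      (1# - x) ^ p       ≈⟨ [1+z]^p (- x) ⟩
      1# + (- x) ^ p     ≈⟨ +-congˡ (trans (neg-^p x) (-‿cong x^p)) ⟩
      1# - X             ∎

    -- X and 1 - X are the p-th powers of x and y, and their product is (-1)ᵖ = -1; so X is a root
    -- of the same quadratic as x.
    X² : X * X ≈ X + 1#
    X² = lincomb (solve 6 (λ X q w z s r → X :* X :- (X :+ :# 1) := X :* (q :- (:# 1 :- X)) :+ q :* (w :- X)
        :+ :# 1 :* (z :- w :* q) :+ :- :# 1 :* (z :- s) :+ :- :# 1 :* (s :- :- :# 1 :* r)
        :+ :# 1 :* (r :- :# 1)) refl X (y ^ p) (x ^ p) ((x * y) ^ p) ((- 1#) ^ p) (sgn m))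
        (X ⊡ y^p ⊞ (y ^ p) ⊡ x^p ⊞ 1# ⊡ ^-distrib-* x y p ⊞ - 1# ⊡ ^-congˡ p x*y ⊞ - 1# ⊡ refl ⊞ 1# ⊡ sgn-m)

    -x^p : (- x) ^ p ≈ - X
    -x^p = trans (neg-^p x) (-‿cong x^p)

    -x*y : - x * y ≈ 1#
    -x*y = lincomb (solve 2 (λ x y → :- x :* y :- :# 1 := :- :# 1 :* (x :* y :- :- :# 1)) refl x y) (- 1# ⊡ x*y)

    x*-y : x * - y ≈ 1#
    x*-y = lincomb (solve 2 (λ x y → x :* :- y :- :# 1 := :- :# 1 :* (x :* y :- :- :# 1)) refl x y) (- 1# ⊡ x*y)

    -- By xy = -1 the inverse of -x is y, so inversion links the conjugate y to -x.
    module I = Twisted.Inversion (- x) (- X) -x^p y -x*y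

    L₁-x : L₁ (- x) ≈ - (X * Q)
    L₁-x = lincomb (solve 6 (λ l X Q u v w → l :- :- (X :* Q) := :# 1 :* (:- X :* u :- :- l)
        :+ :- X :* (v :- u) :+ X :* (v :- w) :+ X :* (w :- :- Q))
        refl (L₁ (- x)) X Q (L₁ y) (L₁ (1# - x)) (L₁ x))
        (1# ⊡ I.L₁-inversion ⊞ - X ⊡ ev-argcong inv y≈ ⊞ X ⊡ L₁-reflect x ⊞ X ⊡ L₁x)

    L₂-square : Q * Q ≈ - # 2 * (X * L₂ x) - # 2 * ((1# - X) * L₂ y)
    L₂-square = lincomb (solve 7 (λ Q l X w a a2 a3
        → Q :* Q :- (:- :# 2 :* (X :* a) :- :# 2 :* ((:# 1 :- X) :* a3)) := (Q :- l) :* (l :- :- Q)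
        :+ :# 1 :* (l :* l :- (:- :# 2 :* (w :* a) :- :# 2 :* ((:# 1 :- w) :* a2)))
        :+ (:- :# 2 :* a :+ :# 2 :* a2) :* (w :- X) :+ :- :# 2 :* (:# 1 :- X) :* (a2 :- a3))
        refl Q (L₁ x) X (x ^ p) (L₂ x) (L₂ (1# - x)) (L₂ y))
        ((Q - L₁ x) ⊡ L₁x ⊞ 1# ⊡ L₁-square x ⊞ (- # 2 * L₂ x + # 2 * L₂ (1# - x)) ⊡ x^p
        ⊞ (- # 2 * (1# - X)) ⊡ ev-argcong inv² y≈)

    L₂-square′ : Q * Q * X * X ≈ # 2 * (X * L₂ (- x)) - # 2 * ((1# + X) * L₂ (x * x))
    L₂-square′ = lincomb (solve 7 (λ Q l X w a a2 a3
        → Q :* Q :* X :* X :- (:# 2 :* (X :* a) :- :# 2 :* ((:# 1 :+ X) :* a3))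
        := (X :* Q :- l) :* (l :- :- (X :* Q))
        :+ :# 1 :* (l :* l :- (:- :# 2 :* (w :* a) :- :# 2 :* ((:# 1 :- w) :* a2)))
        :+ (:- :# 2 :* a :+ :# 2 :* a2) :* (w :- :- X) :+ :- :# 2 :* (:# 1 :+ X) :* (a2 :- a3))
        refl Q (L₁ (- x)) X ((- x) ^ p) (L₂ (- x)) (L₂ (1# - - x)) (L₂ (x * x)))
        ((X * Q - L₁ (- x)) ⊡ L₁-x ⊞ 1# ⊡ L₁-square (- x) ⊞ (- # 2 * L₂ (- x) + # 2 * L₂ (1# - - x)) ⊡ -x^p
        ⊞ (- # 2 * (1# + X)) ⊡ ev-argcong inv² x²)

    -- Duplication relates £₂ at x, -x and x². Multiplying `L₂-square` by X, and using inversion for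
    -- y, yields 2(1 + X)£₂(x), exactly the term to be eliminated.
    c-b : L₂ (x * x) ≈ # 4 * ((1# - X) * L₂ (- x)) - Q * Q * X
    c-b = lincomb (solve 6 (λ X Q a b c a2 → c :- (:# 4 :* ((:# 1 :- X) :* b) :- Q :* Q :* X)
        := :- :# 1 :* (:# 2 :* ((:# 1 :+ X) :* a :+ (:# 1 :- X) :* b) :- c)
        :+ X :* (Q :* Q :- (:- :# 2 :* (X :* a) :- :# 2 :* ((:# 1 :- X) :* a2)))
        :+ :# 2 :* (:# 1 :- X) :* (:- X :* a2 :- b) :+ :- :# 2 :* a :* (X :* X :- (X :+ :# 1)))
        refl X Q (L₂ x) (L₂ (- x)) (L₂ (x * x)) (L₂ y))
        (- 1# ⊡ Twisted.L₂-duplication x X x^p h p-odd ⊞ X ⊡ L₂-square ⊞ (# 2 * (1# - X)) ⊡ I.L₂-inversion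
        ⊞ (- # 2 * L₂ x) ⊡ X²)

    X*L₂-neg : # 10 * (X * L₂ (- x)) ≈ - (Q * Q * (# 3 * X + 1#))
    X*L₂-neg = lincomb (solve 4 (λ X Q b c → :# 10 :* (X :* b) :- :- (Q :* Q :* (:# 3 :* X :+ :# 1))
        := :- :# 1 :* (Q :* Q :* X :* X :- (:# 2 :* (X :* b) :- :# 2 :* ((:# 1 :+ X) :* c)))
        :+ :# 2 :* (:# 1 :+ X) :* (c :- (:# 4 :* ((:# 1 :- X) :* b) :- Q :* Q :* X))
        :+ (:- Q :* Q :- :# 8 :* b) :* (X :* X :- (X :+ :# 1))) refl X Q (L₂ (- x)) (L₂ (x * x)))
        (- 1# ⊡ L₂-square′ ⊞ (# 2 * (1# + X)) ⊡ c-b ⊞ (- Q * Q - # 8 * L₂ (- x)) ⊡ X²)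

    -- By X² = X + 1, the inverse of X is X - 1.
    L₂-neg : # 10 * L₂ (- x) ≈ - (Q * Q * (X + # 2))
    L₂-neg = lincomb (solve 3 (λ X Q b → :# 10 :* b :- :- (Q :* Q :* (X :+ :# 2))
        := (X :- :# 1) :* (:# 10 :* (X :* b) :- :- (Q :* Q :* (:# 3 :* X :+ :# 1)))
        :+ :- (:# 10 :* b :+ :# 3 :* Q :* Q) :* (X :* X :- (X :+ :# 1))) refl X Q (L₂ (- x)))
        ((X - 1#) ⊡ X*L₂-neg ⊞ - (# 10 * L₂ (- x) + # 3 * Q * Q) ⊡ X²)

    L₂-sq : # 5 * L₂ (x * x) ≈ - (Q * Q * (X + # 2))
    L₂-sq = lincomb (solve 4 (λ X Q b c → :# 5 :* c :- :- (Q :* Q :* (X :+ :# 2))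
        := :# 5 :* (c :- (:# 4 :* ((:# 1 :- X) :* b) :- Q :* Q :* X))
        :+ :# 2 :* (:# 1 :- X) :* (:# 10 :* b :- :- (Q :* Q :* (X :+ :# 2)))
        :+ :# 2 :* Q :* Q :* (X :* X :- (X :+ :# 1))) refl X Q (L₂ (- x)) (L₂ (x * x)))
        (# 5 ⊡ c-b ⊞ (# 2 * (1# - X)) ⊡ L₂-neg ⊞ (# 2 * Q * Q) ⊡ X²)

    -- Duplication solved for £₂(x): the factor 2 - X is the inverse of 1 + X.
    L₂-val : # 10 * L₂ x ≈ Q * Q * (1# - # 2 * X)
    L₂-val = lincomb (solve 5 (λ X Q a b c → :# 10 :* a :- Q :* Q :* (:# 1 :- :# 2 :* X)
        := :# 5 :* (:# 2 :- X) :* (:# 2 :* ((:# 1 :+ X) :* a :+ (:# 1 :- X) :* b) :- c)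
        :+ (:# 2 :- X) :* (:# 5 :* c :- :- (Q :* Q :* (X :+ :# 2)))
        :+ :- (:# 2 :- X) :* (:# 1 :- X) :* (:# 10 :* b :- :- (Q :* Q :* (X :+ :# 2)))
        :+ (:# 10 :* a :+ Q :* Q :* (X :+ :# 1)) :* (X :* X :- (X :+ :# 1)))
        refl X Q (L₂ x) (L₂ (- x)) (L₂ (x * x)))
        ((# 5 * (# 2 - X)) ⊡ Twisted.L₂-duplication x X x^p h p-odd ⊞ (# 2 - X) ⊡ L₂-sq
        ⊞ (- (# 2 - X) * (1# - X)) ⊡ L₂-neg ⊞ (# 10 * L₂ x + Q * Q * (X + 1#)) ⊡ X²)

    x²y² : (x * x) * (y * y) ≈ 1#
    x²y² = lincomb (solve 2 (λ x y → x :* x :* (y :* y) :- :# 1 := (x :* y :- :# 1) :* (x :* y :- :- :# 1))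
        refl x y) ((x * y - 1#) ⊡ x*y)

    -- `L₁-cube` with 1/x = -y involves £₃ at x, y and 1 + y = y². Inversion replaces y² by x² and y
    -- by -x. Then £₃(x) and £₃(-x) occur only as X£₃(x) - (X - 1)²£₃(-x), which duplication,
    -- divided by X, expresses through £₃(x²). One equation for £₃(x²) remains.
    L₃-sq : # 15 * L₃ (x * x) ≈ - (# 2 * (X * (Q * Q * Q + # 2 * β)))
    L₃-sq = lincomb (solve 12 (λ X Q l v a b c a2 a3 w w2 B
        → :# 15 :* c :- :- (:# 2 :* (X :* (Q :* Q :* Q :+ :# 2 :* B)))
        := :# 2 :* X :* (l :* l :- l :* Q :+ Q :* Q) :* (l :- :- Q)
        :+ :- :# 2 :* X :* (l :* l :* l :- (:# 6 :* (v :* (:# 1 :- v) :* (v :* w)) :+ :# 6 :* (v :* a)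
        :+ :# 6 :* ((:# 1 :- v) :* a3) :- :# 2 :* (v :* (:# 1 :- v) :* B)))
        :+ :- :# 2 :* X :* (:# 6 :* w :* (v :* (:# 1 :- v) :+ X :* (:# 1 :- v) :- X :* X)
        :+ :# 6 :* a :- :# 6 :* a3 :- :# 2 :* B :* (:# 1 :- v :- X)) :* (v :- X)
        :+ :- :# 12 :* X :* X :* X :* (:# 1 :- X) :* (w :- w2) :+ :- :# 12 :* X :* (:# 1 :- X) :* (a3 :- a2)
        :+ :- :# 12 :* X :* (:# 1 :- X) :* (X :* X :* w2 :- :- c)
        :+ :# 12 :* (:# 1 :- X) :* (:- X :* a2 :- :- b)
        :+ :- :# 3 :* (:# 4 :* ((:# 1 :+ X) :* a :+ (:# 1 :- X) :* b) :- c)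
        :+ (:- :# 12 :* a :- :# 12 :* c :- :# 4 :* X :* B) :* (X :* X :- (X :+ :# 1)))
        refl X Q (L₁ x) (x ^ p) (L₃ x) (L₃ (- x)) (L₃ (x * x)) (L₃ y) (L₃ (1# - x)) (L₃ (1# - - y))
        (L₃ (y * y)) β) ((# 2 * X * (L₁ x * L₁ x - L₁ x * Q + Q * Q)) ⊡ L₁x
        ⊞ (- # 2 * X) ⊡ L₁-cube x (- y) x*-y
        ⊞ (- # 2 * X * (# 6 * L₃ (1# - - y) * ((x ^ p) * (1# - (x ^ p)) + X * (1# - (x ^ p)) - X * X) +
        # 6 * L₃ x - # 6 * L₃ (1# - x) - # 2 * β * (1# - (x ^ p) - X))) ⊡ x^p
        ⊞ (- # 12 * X * X * X * (1# - X)) ⊡ ev-argcong inv³ y² ⊞ (- # 12 * X * (1# - X)) ⊡ ev-argcong inv³ y≈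
        ⊞ (- # 12 * X * (1# - X)) ⊡ Twisted.Inversion.L₃-inversion (x * x) (X * X)
        (trans (^-distrib-* x x p) (*-cong x^p x^p)) (y * y) x²y² ⊞ (# 12 * (1# - X)) ⊡ I.L₃-inversion
        ⊞ - # 3 ⊡ Twisted.L₃-duplication x X x^p h p-odd
        ⊞ (- # 12 * L₃ x - # 12 * L₃ (x * x) - # 4 * X * β) ⊡ X²)

  -- The p-th power of the golden ratio and the Legendre symbol

  ∤-prime : ∀ k → 1 < k → k < p → ¬ k ∣ p
  ∤-prime k 1<k k<p k∣p = [ (λ k≡1 → ℕₚ.<⇒≢ 1<k (≡.sym k≡1)) , ℕₚ.<⇒≢ k<p ]′ (prime⇒irreducible p-prime k∣p)

  -- `legendre5` with `p % 5` abstracted, so that a known residue can be substituted by congruence;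
  -- 1, 4, 4, 1 are the squares of 1, 2, 3, 4 modulo 5.
  legendre-of-residue : ℕ → ℤ
  legendre-of-residue r = if r ℕ.≡ᵇ 0 then + 0 else
      (if (1 ℕ.≡ᵇ r) ∨ (4 ℕ.≡ᵇ r) ∨ (4 ℕ.≡ᵇ r) ∨ (1 ℕ.≡ᵇ r) then + 1 else -[1+ 0 ])

  legendre-residue : ∀ {r} → p % 5 ≡ r → legendre5 p ≡ legendre-of-residue r
  legendre-residue = ≡.cong legendre-of-residue

  -- t_k = ζᵏ + ζ⁻ᵏ for a fifth root of unity ζ with ζ + ζ⁻¹ = −x; in these terms (ζ + ζ⁻¹)ᵖ = ζᵖ + ζ⁻ᵖ.
  module Frobenius {x y : Carrier} (x+y : x + y ≈ 1#) (x*y : x * y ≈ - 1#) where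
    t : ℕ → Carrier
    t zero          = # 2
    t (suc zero)    = - x
    t (suc (suc k)) = - x * t (suc k) - t k

    x² : x * x ≈ x + 1#
    x² = lincomb (solve 2 (λ x y → x :* x :- (x :+ :# 1) := x :* (x :+ y :- :# 1)
        :+ :- :# 1 :* (x :* y :- :- :# 1)) refl x y) (x ⊡ x+y ⊞ - 1# ⊡ x*y)

    t-period : ∀ k → t (5 ℕ.+ k) ≈ t k
    t-period k = lincomb (solve 3 (λ x a b → :- x
        :* (:- x :* (:- x :* (:- x :* b :- a) :- b) :- (:- x :* b :- a)) :- (:- x :* (:- x :* b :- a) :- b)
        :- a := (b :* (x :* x :+ x :- :# 1) :+ a :* (x :+ :# 1)) :* (x :* x :- (x :+ :# 1)))
        refl x (t k) (t (suc k))) ((t (suc k) * (x * x + x - 1#) + t k * (x + 1#)) ⊡ x²)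

    t-period* : ∀ q k → t (q ℕ.* 5 ℕ.+ k) ≈ t k
    t-period* zero    k = refl
    t-period* (suc q) k = trans (t-period (q ℕ.* 5 ℕ.+ k)) (t-period* q k)

    -- `umbral-p` at j = 0 reads (-x)ᵖ t(p + e) = t(e) + t(e + 2p). The offset e makes p + e a
    -- multiple of 5, so that t(p + e) = 2, and e + 2p ≡ r modulo 5; hence 2(-x)ᵖ = 2t(r).
    frobenius : ∀ q r e → p ≡ q ℕ.* 5 ℕ.+ r → r ℕ.+ e ≡ 5 → t e ≈ t r → x ^ p ≈ - t r
    frobenius q r e p≡ r+e te = 2-cancel (lincomb
        (solve 10 (λ u w v s a a2 a3 b d d2 → :# 2 :* v :- :# 2 :* :- b := :# 2 :* (w :- :- v)
        :+ :# 1 :* (u :- w :* s) :+ :- :# 1 :* (u :- (a :+ d)) :+ w :* (s :- :# 2)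
        :+ :- :# 1 :* (a :- :# 1 :* a2) :+ :- :# 1 :* (a2 :- a3) :+ :- :# 1 :* (a3 :- b)
        :+ :- :# 1 :* (d :- :# 1 :* d2) :+ :- :# 1 :* (d2 :- b))
        refl (D p 0) ((- x) ^ p) (x ^ p) (t (p ℕ.+ (e ℕ.+ 0))) (D 0 0) (t (e ℕ.+ 0)) (t e) (t r) (D 0 p)
        (t (e ℕ.+ (p ℕ.+ p)))) (# 2 ⊡ neg-^p x ⊞ 1# ⊡ refl ⊞ - 1# ⊡ umbral-p D step 0 ⊞ ((- x) ^ p) ⊡ s≈2
        ⊞ - 1# ⊡ refl ⊞ - 1# ⊡ reflexive (≡.cong t (ℕₚ.+-identityʳ e)) ⊞ - 1# ⊡ te ⊞ - 1# ⊡ refl ⊞ - 1# ⊡ d≈b))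
      where
      D : ℕ → ℕ → Carrier
      D k j = (- x) ^ k * t (k ℕ.+ (e ℕ.+ (j ℕ.+ j)))
      -- The recurrence of t read as -x · t(i + 1) = t(i) + t(i + 2): multiplication by ζ + ζ⁻¹
      -- shifts the index both ways.
      step : ∀ k j → D (suc k) j ≈ D k j + D k (suc j)
      step k j = lincomb (solve 5 (λ x w a b c → :- x :* w :* b :- (w :* a :+ w :* c)
          := :- w :* (c :- (:- x :* b :- a)))
          refl x ((- x) ^ k) (t i) (t (suc i)) (t (k ℕ.+ (e ℕ.+ (suc j ℕ.+ suc j)))))
          (- ((- x) ^ k) ⊡ reflexive (≡.cong t (index k e j)))
        where
        i = k ℕ.+ (e ℕ.+ (j ℕ.+ j))
        index : ∀ k e j → k ℕ.+ (e ℕ.+ (suc j ℕ.+ suc j)) ≡ suc (suc (k ℕ.+ (e ℕ.+ (j ℕ.+ j))))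
        index = solve-∀
      p+e : p ℕ.+ (e ℕ.+ 0) ≡ suc q ℕ.* 5 ℕ.+ 0
      p+e = ≡.trans (≡.cong (ℕ._+ (e ℕ.+ 0)) p≡)
          (≡.trans (assoc q r e) (≡.trans (≡.cong (q ℕ.* 5 ℕ.+_) r+e) (five q)))
        where
        assoc : ∀ q r e → q ℕ.* 5 ℕ.+ r ℕ.+ (e ℕ.+ 0) ≡ q ℕ.* 5 ℕ.+ (r ℕ.+ e)
        assoc = solve-∀
        five : ∀ q → q ℕ.* 5 ℕ.+ 5 ≡ suc q ℕ.* 5 ℕ.+ 0
        five = solve-∀
      s≈2 : t (p ℕ.+ (e ℕ.+ 0)) ≈ # 2
      s≈2 = trans (reflexive (≡.cong t p+e)) (t-period* (suc q) 0)
      e+2p : e ℕ.+ (p ℕ.+ p) ≡ suc (q ℕ.+ q) ℕ.* 5 ℕ.+ r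
      e+2p = ≡.trans (≡.cong (λ w → e ℕ.+ (w ℕ.+ w)) p≡)
          (≡.trans (assoc q r e) (≡.trans (≡.cong (λ w → (q ℕ.+ q) ℕ.* 5 ℕ.+ w ℕ.+ r) r+e) (five q r)))
        where
        assoc : ∀ q r e → e ℕ.+ ((q ℕ.* 5 ℕ.+ r) ℕ.+ (q ℕ.* 5 ℕ.+ r)) ≡ (q ℕ.+ q) ℕ.* 5 ℕ.+ (r ℕ.+ e) ℕ.+ r
        assoc = solve-∀
        five : ∀ q r → (q ℕ.+ q) ℕ.* 5 ℕ.+ 5 ℕ.+ r ≡ suc (q ℕ.+ q) ℕ.* 5 ℕ.+ r
        five = solve-∀
      d≈b : t (e ℕ.+ (p ℕ.+ p)) ≈ t r
      d≈b = trans (reflexive (≡.cong t e+2p)) (t-period* (suc (q ℕ.+ q)) r)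

    t₂ : t 2 ≈ - y
    t₂ = lincomb (solve 2 (λ x y → :- x :* :- x :- :# 2 :- :- y := :# 1 :* (x :* x :- (x :+ :# 1))
        :+ :# 1 :* (x :+ y :- :# 1)) refl x y) (1# ⊡ x² ⊞ 1# ⊡ x+y)
    t₃ : t 3 ≈ - y
    t₃ = lincomb (solve 2 (λ x y → :- x :* (:- x :* :- x :- :# 2) :- :- x :- :- y
        := (:- x :- :# 1) :* (x :* x :- (x :+ :# 1)) :+ :# 1 :* (x :+ y :- :# 1)) refl x y)
        ((- x - 1#) ⊡ x² ⊞ 1# ⊡ x+y)
    t₄ : t 4 ≈ - x
    t₄ = lincomb (solve 1 (λ x → :- x :* (:- x :* (:- x :* :- x :- :# 2) :- :- x) :- (:- x :* :- x :- :# 2)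
        :- :- x := x :* x :* (x :* x :- (x :+ :# 1)) :+ x :* (x :* x :- (x :+ :# 1))
        :+ :- :# 2 :* (x :* x :- (x :+ :# 1))) refl x) ((x * x) ⊡ x² ⊞ x ⊡ x² ⊞ - # 2 ⊡ x²)

    x^p-1 : ∀ q → p ≡ q ℕ.* 5 ℕ.+ 1 → x ^ p ≈ x
    x^p-1 q e = trans (frobenius q 1 4 e ≡.refl t₄) (-‿involutive x)
    x^p-2 : ∀ q → p ≡ q ℕ.* 5 ℕ.+ 2 → x ^ p ≈ y
    x^p-2 q e = trans (frobenius q 2 3 e ≡.refl (trans t₃ (sym t₂))) (trans (-‿cong t₂) (-‿involutive y))
    x^p-3 : ∀ q → p ≡ q ℕ.* 5 ℕ.+ 3 → x ^ p ≈ y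
    x^p-3 q e = trans (frobenius q 3 2 e ≡.refl (trans t₂ (sym t₃))) (trans (-‿cong t₃) (-‿involutive y))
    x^p-4 : ∀ q → p ≡ q ℕ.* 5 ℕ.+ 4 → x ^ p ≈ x
    x^p-4 q e = trans (frobenius q 4 1 e ≡.refl (sym t₄)) (trans (-‿cong t₄) (-‿involutive x))

    frobenius-legendre : (legendre5 p ≡ + 1 × x ^ p ≈ x) ⊎ (legendre5 p ≡ -[1+ 0 ] × x ^ p ≈ y)
    frobenius-legendre = cases (p % 5) ≡.refl (m≡m%n+[m/n]*n p 5) (m%n<n p 5)
      where
      q = p / 5
      cases : ∀ r → p % 5 ≡ r → p ≡ r ℕ.+ q ℕ.* 5 → r < 5
          → (legendre5 p ≡ + 1 × x ^ p ≈ x) ⊎ (legendre5 p ≡ -[1+ 0 ] × x ^ p ≈ y)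
      cases 0 _ p≡ _ = ⊥-elim (∤-prime 5 (s≤s (s≤s z≤n)) (s≤s (s≤s 3<n)) (divides q p≡))
      cases 1 e p≡ _ = inj₁ (legendre-residue e , x^p-1 q (≡.trans p≡ (ℕₚ.+-comm 1 (q ℕ.* 5))))
      cases 2 e p≡ _ = inj₂ (legendre-residue e , x^p-2 q (≡.trans p≡ (ℕₚ.+-comm 2 (q ℕ.* 5))))
      cases 3 e p≡ _ = inj₂ (legendre-residue e , x^p-3 q (≡.trans p≡ (ℕₚ.+-comm 3 (q ℕ.* 5))))
      cases 4 e p≡ _ = inj₁ (legendre-residue e , x^p-4 q (≡.trans p≡ (ℕₚ.+-comm 4 (q ℕ.* 5))))
      cases (suc (suc (suc (suc (suc _))))) _ _ (s≤s (s≤s (s≤s (s≤s (s≤s ())))))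

  -- The congruences over a ring of characteristic p

  module Congruences (h : ℕ) (p-odd : p ≡ suc (h ℕ.+ h)) (r : ℕ → Carrier)
      (r-inv : ∀ k → k < m → # (suc k) * r k ≈ 1#) where
    £ : ℕ → Carrier → Carrier
    £ d z = ∑ m (λ k → r k ^ d * z ^ suc k)

    r≈inv : ∀ k → k < m → r k ≈ inv (suc k)
    r≈inv k k<m = inv-unique k (r k) k<m (r-inv k k<m)

    £₂≈L₂ : ∀ z → £ 2 z ≈ L₂ z
    £₂≈L₂ z = trans (∑-cong m λ k k<m → *-congʳ
        (lincomb (solve 2 (λ r i → r :^ 2 :- i :* i := (r :+ i) :* (r :- i)) refl (r k) (inv (suc k)))
        ((r k + inv (suc k)) ⊡ r≈inv k k<m))) (sym (ev-suc inv² z inv²-0))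

    £₃≈L₃ : ∀ z → £ 3 z ≈ L₃ z
    £₃≈L₃ z = trans (∑-cong m λ k k<m → *-congʳ
        (lincomb (solve 2 (λ r i → r :^ 3 :- i :* i :* i := (r :* r :+ r :* i :+ i :* i) :* (r :- i))
        refl (r k) (inv (suc k))) ((r k * r k + r k * inv (suc k) + inv (suc k) * inv (suc k)) ⊡ r≈inv k k<m)))
        (sym (ev-suc inv³ z inv³-0))

    -- C(p - 1, k) contributes (-1)ᵏ and (-x)^(k + 1) the opposite sign, so each term becomes -x^(k
    -- + 1)/(k + 1). This identifies the reduction of the expansion of q_L.
    quotient≈-L₁ : ∀ x → ∑ m (λ k → r k * (bin m k * (- x) ^ suc k)) ≈ - L₁ x
    quotient≈-L₁ x = begin
      ∑ m (λ k → r k * (bin m k * (- x) ^ suc k))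
        ≈⟨ ∑-cong m (λ k k<m → lincomb (solve 6
            (λ r b i s w z → r :* (b :* z) :- :- :# 1 :* (i :* w) := b :* z :* (r :- i) :+ i :* z :* (b :- s)
            :+ i :* s :* (z :- :- :# 1 :* s :* w) :+ :- i :* w :* (s :* s :- :# 1))
            refl (r k) (bin m k) (inv (suc k)) (sgn k) (x ^ suc k) ((- x) ^ suc k))
            ((bin m k * ((- x) ^ suc k)) ⊡ r≈inv k k<m ⊞ (inv (suc k) * ((- x) ^ suc k)) ⊡ bin-m k (ℕₚ.<⇒≤ k<m)
            ⊞ (inv (suc k) * sgn k) ⊡ neg-^ x (suc k) ⊞ (- inv (suc k) * (x ^ suc k)) ⊡ sgn² k)) ⟩
      ∑ m (λ k → - 1# * (inv (suc k) * x ^ suc k))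
        ≈⟨ ∑-*ˡ m (- 1#) _ ⟩
      - 1# * ∑ m (λ k → inv (suc k) * x ^ suc k)
        ≈⟨ lincomb (solve 2 (λ s l → :- :# 1 :* s :- :- l := :# 1 :* (l :- s))
            refl (∑ m (λ k → inv (suc k) * x ^ suc k)) (L₁ x)) (1# ⊡ ev-suc inv x inv-0) ⟩
      - L₁ x ∎

    bernoulli≈β : ∀ b → (∀ N → N < m → bernoulli-sum b N ≈ 0# ^ N) → b (m ∸ 2) ≈ β
    bernoulli≈β b b-rec = trans (bernoulli-unique (λ N N<m → trans (b-rec N N<m) (sym (moment-H N N<m)))
        (m ∸ 2) (s≤s (ℕₚ.m∸n≤m n 1))) moment-H-β

    swap-sign : ∀ k s e → - k * s * e ≈ k * - (s * e)
    swap-sign k s e = solve 3 (λ k s e → :- k :* s :* e := k :* :- (s :* e)) refl k s e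

    scale₊ : ∀ s k e → 1# + s * k * e ≈ 1# + k * (s * e)
    scale₊ s k e = solve 3 (λ s k e → :# 1 :+ s :* k :* e := :# 1 :+ k :* (s :* e)) refl s k e

    scale₋ : ∀ s k e → 1# - s * k * e ≈ 1# + k * - (s * e)
    scale₋ s k e = solve 3 (λ s k e → :# 1 :- s :* k :* e := :# 1 :+ k :* :- (s :* e)) refl s k e

    -- Here u stands for ±√5 (p/5). The rational constants of the statement are parameters known
    -- only through integer equations, so that the literals can be inserted afterwards.
    module Values {x y X Q u : Carrier} (g : Golden x y X) (L₁x : L₁ x ≈ - Q) (2X : # 2 * X ≈ 1# + u) where
      open GoldenValues g L₁x h p-odd

      £₂[x] : ∀ {k v q₂} → # 10 * k ≈ - 1# → v ≈ k * u → q₂ ≈ Q * Q → £ 2 x ≈ v * q₂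
      £₂[x] {k} {v} {q₂} hk hv hq = lincomb
          (solve 8 (λ l a k v q Q X u → l :- v :* q := :# 1 :* (l :- a) :+ a :* (:# 10 :* k :- :- :# 1)
          :+ :- q :* (v :- k :* u) :+ :- k :* u :* (q :- Q :* Q)
          :+ :- k :* (:# 10 :* a :- Q :* Q :* (:# 1 :- :# 2 :* X))
          :+ k :* Q :* Q :* (:# 2 :* X :- (:# 1 :+ u))) refl (£ 2 x) (L₂ x) k v q₂ Q X u)
          (1# ⊡ £₂≈L₂ x ⊞ L₂ x ⊡ hk ⊞ - q₂ ⊡ hv ⊞ (- k * u) ⊡ hq ⊞ - k ⊡ L₂-val ⊞ (k * Q * Q) ⊡ 2X)

      £₂[x²] : ∀ {k k₅ v q₂} → # 2 * k ≈ - 1# → # 5 * k₅ ≈ 1# → v ≈ 1# + k₅ * u → q₂ ≈ Q * Q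
          → £ 2 (x ^ 2) ≈ k * v * q₂
      £₂[x²] {k} {k₅} {v} {q₂} hk hk₅ hv hq = lincomb
          (solve 10 (λ l a a2 k k5 v q Q X u → l :- k :* v :* q := :# 1 :* (l :- a) :+ :# 1 :* (a :- a2)
          :+ a2 :* (:# 2 :* k :- :- :# 1) :+ (:# 2 :* k :* a2 :+ k :* Q :* Q) :* (:# 5 :* k5 :- :# 1)
          :+ :- k :* q :* (v :- (:# 1 :+ k5 :* u)) :+ :- k :* (:# 1 :+ k5 :* u) :* (q :- Q :* Q)
          :+ :- :# 2 :* k :* k5 :* (:# 5 :* a2 :- :- (Q :* Q :* (X :+ :# 2)))
          :+ k :* k5 :* Q :* Q :* (:# 2 :* X :- (:# 1 :+ u)))
          refl (£ 2 (x ^ 2)) (L₂ (x ^ 2)) (L₂ (x * x)) k k₅ v q₂ Q X u)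
          (1# ⊡ £₂≈L₂ (x ^ 2) ⊞ 1# ⊡ ev-argcong inv² ((solve 1 (λ x → x :^ 2 := x :* x) refl x))
          ⊞ L₂ (x * x) ⊡ hk ⊞ (# 2 * k * L₂ (x * x) + k * Q * Q) ⊡ hk₅ ⊞ (- k * q₂) ⊡ hv
          ⊞ (- k * (1# + k₅ * u)) ⊡ hq ⊞ (- # 2 * k * k₅) ⊡ L₂-sq ⊞ (k * k₅ * Q * Q) ⊡ 2X)

      £₂[-x] : ∀ {c k k₅ v q₂} → c ≈ - 1# → # 4 * k ≈ - 1# → # 5 * k₅ ≈ 1# → v ≈ 1# + k₅ * u → q₂ ≈ Q * Q
          → £ 2 (c * x) ≈ k * v * q₂
      £₂[-x] {c} {k} {k₅} {v} {q₂} hc hk hk₅ hv hq = lincomb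
          (solve 10 (λ l a a2 k k5 v q Q X u → l :- k :* v :* q := :# 1 :* (l :- a) :+ :# 1 :* (a :- a2)
          :+ a2 :* (:# 4 :* k :- :- :# 1) :+ (:# 4 :* k :* a2 :+ k :* Q :* Q) :* (:# 5 :* k5 :- :# 1)
          :+ :- k :* q :* (v :- (:# 1 :+ k5 :* u)) :+ :- k :* (:# 1 :+ k5 :* u) :* (q :- Q :* Q)
          :+ :- :# 2 :* k :* k5 :* (:# 10 :* a2 :- :- (Q :* Q :* (X :+ :# 2)))
          :+ k :* k5 :* Q :* Q :* (:# 2 :* X :- (:# 1 :+ u)))
          refl (£ 2 (c * x)) (L₂ (c * x)) (L₂ (- x)) k k₅ v q₂ Q X u)
          (1# ⊡ £₂≈L₂ (c * x) ⊞ 1# ⊡ ev-argcong inv²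
          (lincomb (solve 2 (λ c x → c :* x :- :- x := x :* (c :- :- :# 1)) refl c x) (x ⊡ hc)) ⊞ L₂ (- x) ⊡ hk
          ⊞ (# 4 * k * L₂ (- x) + k * Q * Q) ⊡ hk₅ ⊞ (- k * q₂) ⊡ hv ⊞ (- k * (1# + k₅ * u)) ⊡ hq
          ⊞ (- # 2 * k * k₅) ⊡ L₂-neg ⊞ (k * k₅ * Q * Q) ⊡ 2X)

      £₃[x²] : ∀ {k k₂ v q₃ B} → # 15 * k ≈ - # 2 → # 2 * k₂ ≈ 1# → v ≈ 1# + u → q₃ ≈ Q * Q * Q → B ≈ β →
               £ 3 (x ^ 2) ≈ k * v * (k₂ * q₃ + B)
      £₃[x²] {k} {k₂} {v} {q₃} {B} hk hk₂ hv hq hB = 2-cancel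
          (lincomb (solve 12 (λ l a a2 k k2 v q B b Q X u → :# 2 :* l :- :# 2 :* (k :* v :* (k2 :* q :+ B))
          := :# 2 :* (l :- a) :+ :# 2 :* (a :- a2) :+ a2 :* (:# 15 :* k :- :- :# 2)
          :+ :- k :* v :* q :* (:# 2 :* k2 :- :# 1) :+ :- k :* (q :+ :# 2 :* B) :* (v :- (:# 1 :+ u))
          :+ :- k :* (:# 1 :+ u) :* (q :- Q :* Q :* Q) :+ :- :# 2 :* k :* (:# 1 :+ u) :* (B :- b)
          :+ :- k :* (:# 15 :* a2 :- :- (:# 2 :* (X :* (Q :* Q :* Q :+ :# 2 :* b))))
          :+ k :* (Q :* Q :* Q :+ :# 2 :* b) :* (:# 2 :* X :- (:# 1 :+ u)))
          refl (£ 3 (x ^ 2)) (L₃ (x ^ 2)) (L₃ (x * x)) k k₂ v q₃ B β Q X u)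
          (# 2 ⊡ £₃≈L₃ (x ^ 2) ⊞ # 2 ⊡ ev-argcong inv³ ((solve 1 (λ x → x :^ 2 := x :* x) refl x))
          ⊞ L₃ (x * x) ⊡ hk ⊞ (- k * v * q₃) ⊡ hk₂ ⊞ (- k * (q₃ + # 2 * B)) ⊡ hv ⊞ (- k * (1# + u)) ⊡ hq
          ⊞ (- # 2 * k * (1# + u)) ⊡ hB ⊞ - k ⊡ L₃-sq ⊞ (k * (Q * Q * Q + # 2 * β)) ⊡ 2X))

-- Rational numbers integral at p

module Rationals where
  open import Data.Rational using (mkℚ; toℚᵘ; ↥_; ↧ₙ_)
  open import Data.Rational.Unnormalised as ℚᵘ using (mkℚᵘ; *≡*)
  import Data.Rational.Unnormalised.Properties as ℚᵘₚ
  import Data.Nat.Coprimality as Coprime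
  import Data.Integer.Properties as ℤₚ
  open ≡
  open RingCalculus ℚₚ.+-*-commutativeRing using
      (solve; _:=_; _:+_; _:*_; _:-_; :-_; :#; lincomb; _⊡_; _⊞_; _+_; _*_; -_; 1#)

  -- A quotient with a variable numerator does not reduce; the constructor form lets sums and
  -- products of such quotients compute.
  ℤ→ℚ≡mkℚ : ∀ z → ℤ→ℚ z ≡ mkℚ z 0 (Coprime.sym (Coprime.1-coprimeTo ℤ.∣ z ∣))
  ℤ→ℚ≡mkℚ z = ℚₚ.fromℚᵘ-toℚᵘ (mkℚ z 0 (Coprime.sym (Coprime.1-coprimeTo ℤ.∣ z ∣)))

  ℤ→ℚ-+ : ∀ a b → ℤ→ℚ (a ℤ.+ b) ≡ ℤ→ℚ a ℚ.+ ℤ→ℚ b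
  ℤ→ℚ-+ a b = sym (trans (cong₂ ℚ._+_ (ℤ→ℚ≡mkℚ a) (ℤ→ℚ≡mkℚ b))
      (cong ℤ→ℚ (cong₂ ℤ._+_ (ℤₚ.*-identityʳ a) (ℤₚ.*-identityʳ b))))

  ℤ→ℚ-* : ∀ a b → ℤ→ℚ (a ℤ.* b) ≡ ℤ→ℚ a ℚ.* ℤ→ℚ b
  ℤ→ℚ-* a b = sym (cong₂ ℚ._*_ (ℤ→ℚ≡mkℚ a) (ℤ→ℚ≡mkℚ b))

  ℕ→ℚ-* : ∀ a b → ℕ→ℚ (a ℕ.* b) ≡ ℕ→ℚ a ℚ.* ℕ→ℚ b
  ℕ→ℚ-* a b = trans (cong ℤ→ℚ (ℤₚ.pos-* a b)) (ℤ→ℚ-* (+ a) (+ b))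

  recip-inverse : ∀ k → ℕ→ℚ (suc k) ℚ.* recipℕ (suc k) ≡ 1ℚ
  recip-inverse k = ℚₚ.toℚᵘ-injective (begin
    toℚᵘ (ℕ→ℚ (suc k) ℚ.* recipℕ (suc k))             ≈⟨ ℚₚ.toℚᵘ-homo-* (ℕ→ℚ (suc k)) (recipℕ (suc k)) ⟩
    toℚᵘ (ℕ→ℚ (suc k)) ℚᵘ.* toℚᵘ (recipℕ (suc k))    ≈⟨ ℚᵘₚ.*-cong (ℚₚ.toℚᵘ-fromℚᵘ (mkℚᵘ (+ suc k) 0))
        (ℚₚ.toℚᵘ-fromℚᵘ (mkℚᵘ (+ 1) k)) ⟩
    mkℚᵘ (+ suc k) 0 ℚᵘ.* mkℚᵘ (+ 1) k                ≈⟨ *≡*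
        (cong (λ j → + suc j) (trans (ℕₚ.*-identityʳ (k ℕ.* 1))
        (trans (ℕₚ.*-identityʳ k) (sym (trans (ℕₚ.+-identityʳ (k ℕ.+ 0)) (ℕₚ.+-identityʳ k)))))) ⟩
    toℚᵘ 1ℚ                                           ∎)
    where open import Relation.Binary.Reasoning.Setoid ℚᵘₚ.≃-setoid

  denominator-clears : ∀ r → r ℚ.* ℕ→ℚ (↧ₙ r) ≡ ℤ→ℚ (↥ r)
  denominator-clears r@(mkℚ n d c) = ℚₚ.toℚᵘ-injective (begin
    toℚᵘ (r ℚ.* ℕ→ℚ (suc d))              ≈⟨ ℚₚ.toℚᵘ-homo-* r (ℕ→ℚ (suc d)) ⟩
    toℚᵘ r ℚᵘ.* toℚᵘ (ℕ→ℚ (suc d))        ≈⟨ ℚᵘₚ.*-congˡ {toℚᵘ r} (ℚₚ.toℚᵘ-fromℚᵘ (mkℚᵘ (+ suc d) 0)) ⟩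
    mkℚᵘ n d ℚᵘ.* mkℚᵘ (+ suc d) 0        ≈⟨ *≡*
        (trans (ℤₚ.*-identityʳ (n ℤ.* + suc d)) (cong (λ j → n ℤ.* + suc j) (sym (ℕₚ.*-identityʳ d)))) ⟩
    mkℚᵘ n 0                              ≈⟨ ℚₚ.toℚᵘ-fromℚᵘ (mkℚᵘ n 0) ⟨
    toℚᵘ (ℤ→ℚ n)                          ∎)
    where open import Relation.Binary.Reasoning.Setoid ℚᵘₚ.≃-setoid

  -- If r = n/d₀ in lowest terms, clearing denominators gives n d = z d₀ with d₀ prime to n.
  denominator-minimal : ∀ r d z → r ℚ.* ℕ→ℚ d ≡ ℤ→ℚ z → ↧ₙ r ∣ d
  denominator-minimal r@(mkℚ n d-1 c) d z eq = Coprime.coprime-divisor (Coprime.sym (Coprime.recompute c))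
      (divides ℤ.∣ z ∣ abs)
    where
    open import Relation.Binary.Reasoning.Setoid ℚᵘₚ.≃-setoid
    cleared : mkℚᵘ n d-1 ℚᵘ.* mkℚᵘ (+ d) 0 ℚᵘ.≃ mkℚᵘ z 0
    cleared = begin
      toℚᵘ r ℚᵘ.* mkℚᵘ (+ d) 0       ≈⟨ ℚᵘₚ.*-congˡ {toℚᵘ r} (ℚₚ.toℚᵘ-fromℚᵘ (mkℚᵘ (+ d) 0)) ⟨
      toℚᵘ r ℚᵘ.* toℚᵘ (ℕ→ℚ d)       ≈⟨ ℚₚ.toℚᵘ-homo-* r (ℕ→ℚ d) ⟨
      toℚᵘ (r ℚ.* ℕ→ℚ d)             ≡⟨ cong toℚᵘ eq ⟩
      toℚᵘ (ℤ→ℚ z)                   ≈⟨ ℚₚ.toℚᵘ-fromℚᵘ (mkℚᵘ z 0) ⟩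
      mkℚᵘ z 0                       ∎
    cross : n ℤ.* + d ℤ.* + 1 ≡ z ℤ.* + (suc d-1 ℕ.* 1)
    cross with cleared
    ... | *≡* e = e
    abs : ℤ.∣ n ∣ ℕ.* d ≡ ℤ.∣ z ∣ ℕ.* suc d-1
    abs = trans (sym (ℤₚ.abs-* n (+ d))) (trans (cong ℤ.∣_∣ (trans (sym (ℤₚ.*-identityʳ (n ℤ.* + d))) cross))
      (trans (ℤₚ.abs-* z _) (cong (ℤ.∣ z ∣ ℕ.*_) (ℕₚ.*-identityʳ (suc d-1)))))

  -- Any denominator prime to p will do, reduced or not. Sums and products are thus treated with the
  -- product of the two denominators.
  integral : ∀ {p} r d z → ¬ p ∣ d → r ℚ.* ℕ→ℚ d ≡ ℤ→ℚ z → pIntegralℚ p r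
  integral r d z p∤d eq p∣den = p∤d (∣-trans p∣den (denominator-minimal r d z eq))

  module _ {p} (p-prime : Prime p) where
    ∤-* : ∀ {a b} → ¬ p ∣ a → ¬ p ∣ b → ¬ p ∣ a ℕ.* b
    ∤-* {a} {b} p∤a p∤b p∣ab = [ p∤a , p∤b ]′ (euclidsLemma a b p-prime p∣ab)

    integral-+ : ∀ r s → pIntegralℚ p r → pIntegralℚ p s → pIntegralℚ p (r ℚ.+ s)
    integral-+ r s ir is = integral (r ℚ.+ s) (↧ₙ r ℕ.* ↧ₙ s) (↥ r ℤ.* + ↧ₙ s ℤ.+ ↥ s ℤ.* + ↧ₙ r) (∤-* ir is)
        (lincomb (solve 10 (λ r s b d a c bd t u v → (r :+ s) :* bd :- t := (r :+ s) :* (bd :- b :* d)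
        :+ :- :# 1 :* (t :- (u :+ v)) :+ :- :# 1 :* (u :- a :* d) :+ :- :# 1 :* (v :- c :* b)
        :+ d :* (r :* b :- a) :+ b :* (s :* d :- c))
        refl r s (ℕ→ℚ (↧ₙ r)) (ℕ→ℚ (↧ₙ s)) (ℤ→ℚ (↥ r)) (ℤ→ℚ (↥ s)) (ℕ→ℚ (↧ₙ r ℕ.* ↧ₙ s))
        (ℤ→ℚ (↥ r ℤ.* + ↧ₙ s ℤ.+ ↥ s ℤ.* + ↧ₙ r)) (ℤ→ℚ (↥ r ℤ.* + ↧ₙ s)) (ℤ→ℚ (↥ s ℤ.* + ↧ₙ r)))
        ((r + s) ⊡ ℕ→ℚ-* (↧ₙ r) (↧ₙ s) ⊞ - 1# ⊡ ℤ→ℚ-+ (↥ r ℤ.* + ↧ₙ s) (↥ s ℤ.* + ↧ₙ r)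
        ⊞ - 1# ⊡ ℤ→ℚ-* (↥ r) (+ ↧ₙ s) ⊞ - 1# ⊡ ℤ→ℚ-* (↥ s) (+ ↧ₙ r) ⊞ ℕ→ℚ (↧ₙ s) ⊡ denominator-clears r
        ⊞ ℕ→ℚ (↧ₙ r) ⊡ denominator-clears s))

    integral-* : ∀ r s → pIntegralℚ p r → pIntegralℚ p s → pIntegralℚ p (r ℚ.* s)
    integral-* r s ir is = integral (r ℚ.* s) (↧ₙ r ℕ.* ↧ₙ s) (↥ r ℤ.* ↥ s) (∤-* ir is)
        (lincomb (solve 8 (λ r s b d a c bd t → r :* s :* bd :- t := r :* s :* (bd :- b :* d)
        :+ :- :# 1 :* (t :- a :* c) :+ s :* d :* (r :* b :- a) :+ a :* (s :* d :- c))
        refl r s (ℕ→ℚ (↧ₙ r)) (ℕ→ℚ (↧ₙ s)) (ℤ→ℚ (↥ r)) (ℤ→ℚ (↥ s)) (ℕ→ℚ (↧ₙ r ℕ.* ↧ₙ s)) (ℤ→ℚ (↥ r ℤ.* ↥ s)))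
        ((r * s) ⊡ ℕ→ℚ-* (↧ₙ r) (↧ₙ s) ⊞ - 1# ⊡ ℤ→ℚ-* (↥ r) (↥ s) ⊞ (s * ℕ→ℚ (↧ₙ s)) ⊡ denominator-clears r
        ⊞ ℤ→ℚ (↥ r) ⊡ denominator-clears s))

    integral-neg : ∀ r → pIntegralℚ p r → pIntegralℚ p (ℚ.- r)
    integral-neg (mkℚ (+ 0) d _) ir = ir
    integral-neg (mkℚ (+ (suc n)) d _) ir = ir
    integral-neg (mkℚ (ℤ.-[1+_] n) d _) ir = ir

-- The tabulated Bernoulli numbers

module BernoulliNumbers where
  open import Data.Bool.Properties using (T-≡)
  open import Function.Bundles using (Equivalence)
  open ≡
  open ≡-Reasoning
  open BinomialCoefficients
  open Rationals
  open RingCalculus ℚₚ.+-*-commutativeRing using (solve; _:=_; _:+_; _:*_; _:-_; :-_; :#; lincomb; _⊡_; -_)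

  ≤⇒≤ᵇ≡true : ∀ {a b} → a ≤ b → (a ℕ.≤ᵇ b) ≡ true
  ≤⇒≤ᵇ≡true a≤b = Equivalence.to T-≡ (ℕₚ.≤⇒≤ᵇ a≤b)

  1+n≤ᵇn : ∀ k → (suc k ℕ.≤ᵇ k) ≡ false
  1+n≤ᵇn k with suc k ℕ.≤ᵇ k in eq
  ... | false = refl
  ... | true  = ⊥-elim (ℕₚ.1+n≰n (ℕₚ.≤ᵇ⇒≤ (suc k) k (Equivalence.from T-≡ eq)))

  n≡ᵇn : ∀ k → (k ℕ.≡ᵇ k) ≡ true
  n≡ᵇn k = Equivalence.to T-≡ (ℕₚ.≡⇒≡ᵇ k k refl)

  -- Each row of the table copies the previous one and adds only its diagonal entry.
  bTable-stable : ∀ k j → j ≤ k → bTable k j ≡ bernoulli j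
  bTable-stable zero    zero    z≤n = refl
  bTable-stable (suc k) j j≤1+k with ℕₚ.m≤n⇒m<n∨m≡n j≤1+k
  ... | inj₂ refl = refl
  ... | inj₁ (s≤s j≤k) = trans (cong (λ t → if t then bTable k j else (if j ℕ.≡ᵇ suc k then _ else 0ℚ))
      (≤⇒≤ᵇ≡true j≤k)) (bTable-stable k j j≤k)

  bernoulli-suc : ∀ k → bernoulli (suc k) ≡ ℚ.-
      (recipℕ (suc (suc k)) ℚ.* sumTo (suc k) (λ j → ℕ→ℚ (suc (suc k) C j) ℚ.* bTable k j))
  bernoulli-suc k = trans
    (cong (λ t → if t then bTable k (suc k) else (if suc k ℕ.≡ᵇ suc k then b else 0ℚ)) (1+n≤ᵇn k))
    (cong (λ t → if t then b else 0ℚ) (n≡ᵇn k))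
    where b = ℚ.- (recipℕ (suc (suc k)) ℚ.* sumTo (suc k) (λ j → ℕ→ℚ (suc (suc k) C j) ℚ.* bTable k j))

  sumTo-cong : ∀ k f g → (∀ j → j < k → f j ≡ g j) → sumTo k f ≡ sumTo k g
  sumTo-cong zero    f g h = refl
  sumTo-cong (suc k) f g h = cong₂ ℚ._+_ (sumTo-cong k f g λ j j<k → h j (ℕₚ.m<n⇒m<1+n j<k)) (h k (ℕₚ.n<1+n k))

  bernoulli-recurrence : ∀ k → sumTo (suc (suc k)) (λ j → ℕ→ℚ (suc (suc k) C j) ℚ.* bernoulli j) ≡ 0ℚ
  bernoulli-recurrence k = begin
    sumTo (suc k) term ℚ.+ ℕ→ℚ (suc (suc k) C suc k) ℚ.* bernoulli (suc k)
      ≡⟨ cong₂ (λ s b → s ℚ.+ ℕ→ℚ (suc (suc k) C suc k) ℚ.* b)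
          (sumTo-cong (suc k) term term′ λ j j<1+k
          → cong (ℕ→ℚ (suc (suc k) C j) ℚ.*_) (sym (bTable-stable k j (ℕₚ.≤-pred j<1+k)))) (bernoulli-suc k) ⟩
    S ℚ.+ ℕ→ℚ (suc (suc k) C suc k) ℚ.* (ℚ.- (recipℕ (suc (suc k)) ℚ.* S))
      ≡⟨ cong (λ c → S ℚ.+ ℕ→ℚ c ℚ.* (ℚ.- (recipℕ (suc (suc k)) ℚ.* S))) ([1+n]Cn≡1+n (suc k)) ⟩
    S ℚ.+ ℕ→ℚ (suc (suc k)) ℚ.* (ℚ.- (recipℕ (suc (suc k)) ℚ.* S))
      ≡⟨ cancel S (ℕ→ℚ (suc (suc k))) (recipℕ (suc (suc k))) (recip-inverse (suc k)) ⟩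
    0ℚ ∎
    where
    term term′ : ℕ → ℚ
    term j = ℕ→ℚ (suc (suc k) C j) ℚ.* bernoulli j
    term′ j = ℕ→ℚ (suc (suc k) C j) ℚ.* bTable k j
    S = sumTo (suc k) term′
    cancel : ∀ s a i → a ℚ.* i ≡ 1ℚ → s ℚ.+ a ℚ.* (ℚ.- (i ℚ.* s)) ≡ 0ℚ
    cancel s a i ai≡1 = lincomb (solve 3 (λ s a i → s :+ a :* :- (i :* s) :- :# 0 := :- s :* (a :* i :- :# 1))
        refl s a i) (- s ⊡ ai≡1)

-- The ring ℚ(√5)

module QuadraticField where
  open import Algebra.Structures (_≡_ {A = Q5}) using (IsAbelianGroup; IsCommutativeRing)
  open ≡
  open RingCalculus ℚₚ.+-*-commutativeRing using (solve; _:=_; _:+_; _:*_; :#)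

  5ℚ : ℚ
  5ℚ = + 5 ℚ./ 1

  ⊝_ : Q5 → Q5
  ⊝ (a +√5· b) = (ℚ.- a) +√5· (ℚ.- b)

  ⊕-isAbelianGroup : IsAbelianGroup _⊕_ (ι 0ℚ) ⊝_
  ⊕-isAbelianGroup = record
    { isGroup = record
      { isMonoid = record
        { isSemigroup = record
          { isMagma = record { isEquivalence = isEquivalence ; ∙-cong = cong₂ _⊕_ }
          ; assoc = λ (a +√5· b) (c +√5· d) (e +√5· f) → cong₂ _+√5·_ (ℚₚ.+-assoc a c e) (ℚₚ.+-assoc b d f)
          }
        ; identity = (λ (a +√5· b) → cong₂ _+√5·_ (ℚₚ.+-identityˡ a) (ℚₚ.+-identityˡ b))
                   , (λ (a +√5· b) → cong₂ _+√5·_ (ℚₚ.+-identityʳ a) (ℚₚ.+-identityʳ b))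
        }
      ; inverse = (λ (a +√5· b) → cong₂ _+√5·_ (ℚₚ.+-inverseˡ a) (ℚₚ.+-inverseˡ b))
                , (λ (a +√5· b) → cong₂ _+√5·_ (ℚₚ.+-inverseʳ a) (ℚₚ.+-inverseʳ b))
      ; ⁻¹-cong = cong ⊝_
      }
    ; comm = λ (a +√5· b) (c +√5· d) → cong₂ _+√5·_ (ℚₚ.+-comm a c) (ℚₚ.+-comm b d)
    }

  ⊗-assoc : ∀ x y z → (x ⊗ y) ⊗ z ≡ x ⊗ (y ⊗ z)
  ⊗-assoc (a +√5· b) (c +√5· d) (e +√5· f) = cong₂ _+√5·_
    ((solve 7 (λ a b c d e f k → (a :* c :+ k :* (b :* d)) :* e :+ k :* ((a :* d :+ b :* c) :* f)
        := a :* (c :* e :+ k :* (d :* f)) :+ k :* (b :* (c :* f :+ d :* e))) refl a b c d e f 5ℚ))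
    ((solve 7 (λ a b c d e f k → (a :* c :+ k :* (b :* d)) :* f :+ (a :* d :+ b :* c) :* e
        := a :* (c :* f :+ d :* e) :+ b :* (c :* e :+ k :* (d :* f))) refl a b c d e f 5ℚ))

  ⊗-comm : ∀ x y → x ⊗ y ≡ y ⊗ x
  ⊗-comm (a +√5· b) (c +√5· d) = cong₂ _+√5·_
    ((solve 5 (λ a b c d k → a :* c :+ k :* (b :* d) := c :* a :+ k :* (d :* b)) refl a b c d 5ℚ))
    ((solve 4 (λ a b c d → a :* d :+ b :* c := c :* b :+ d :* a) refl a b c d))

  ⊗-identityˡ : ∀ x → ι 1ℚ ⊗ x ≡ x
  ⊗-identityˡ (a +√5· b) = cong₂ _+√5·_
    ((solve 3 (λ a b k → :# 1 :* a :+ k :* (:# 0 :* b) := a) refl a b 5ℚ))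
    ((solve 2 (λ a b → :# 1 :* b :+ :# 0 :* a := b) refl a b))

  ⊗-distribˡ-⊕ : ∀ x y z → x ⊗ (y ⊕ z) ≡ (x ⊗ y) ⊕ (x ⊗ z)
  ⊗-distribˡ-⊕ (a +√5· b) (c +√5· d) (e +√5· f) = cong₂ _+√5·_
    ((solve 7 (λ a b c d e f k → a :* (c :+ e) :+ k :* (b :* (d :+ f)) := a :* c :+ k :* (b :* d)
        :+ (a :* e :+ k :* (b :* f))) refl a b c d e f 5ℚ))
    ((solve 6 (λ a b c d e f → a :* (d :+ f) :+ b :* (c :+ e) := a :* d :+ b :* c :+ (a :* f :+ b :* e))
        refl a b c d e f))

  Q5-isCommutativeRing : IsCommutativeRing _⊕_ _⊗_ ⊝_ (ι 0ℚ) (ι 1ℚ)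
  Q5-isCommutativeRing = record
    { isRing = record
      { +-isAbelianGroup = ⊕-isAbelianGroup
      ; *-cong = cong₂ _⊗_
      ; *-assoc = ⊗-assoc
      ; *-identity = ⊗-identityˡ , (λ x → trans (⊗-comm x (ι 1ℚ)) (⊗-identityˡ x))
      ; distrib = ⊗-distribˡ-⊕ , (λ x y z → trans (⊗-comm (y ⊕ z) x)
          (trans (⊗-distribˡ-⊕ x y z) (cong₂ _⊕_ (⊗-comm x y) (⊗-comm x z))))
      }
    ; *-comm = ⊗-comm
    }

  Q5-ring : CommutativeRing 0ℓ 0ℓ
  Q5-ring = record { isCommutativeRing = Q5-isCommutativeRing }

  ι-⊗ : ∀ a b → ι a ⊗ ι b ≡ ι (a ℚ.* b)
  ι-⊗ a b = cong₂ _+√5·_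
    ((solve 3 (λ a b k → a :* b :+ k :* (:# 0 :* :# 0) := a :* b) refl a b 5ℚ))
    ((solve 2 (λ a b → a :* :# 0 :+ :# 0 :* b := :# 0) refl a b))

-- The local ring at p, with congruence modulo p as equality

module Localisation (p : ℕ) (p-prime : Prime p) where
  open Rationals
  open QuadraticField
  open RingCalculus Q5-ring

  integral-small : ∀ r d z → suc d ℕ.< p → r ℚ.* ℕ→ℚ (suc d) ≡ ℤ→ℚ z → pIntegralℚ p r
  integral-small r d z d<p = integral r (suc d) z (λ p∣d → ℕₚ.<⇒≱ d<p (∣⇒≤ p∣d))

  integral-ℤ : ∀ z → pIntegralℚ p (ℤ→ℚ z)
  integral-ℤ z = integral-small (ℤ→ℚ z) 0 z (ℕ.nonTrivial⇒n>1 p {{prime⇒nonTrivial p-prime}})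
      (ℚₚ.*-identityʳ (ℤ→ℚ z))

  integral-recip : ∀ k → suc k ℕ.< p → pIntegralℚ p (recipℕ (suc k))
  integral-recip k k<p = integral-small (recipℕ (suc k)) k (+ 1) k<p
      (≡.trans (ℚₚ.*-comm (recipℕ (suc k)) (ℕ→ℚ (suc k))) (recip-inverse k))

  -- Without eta and with operations given by copatterns, sums and products of elements do not unfold during unification.
  record Local : Set where
    no-eta-equality
    constructor local
    field
      value          : Q5
      value-integral : pIntegral p value
  open Local public

  integral-ι : ∀ r → pIntegralℚ p r → Local
  value          (integral-ι r ir) = ι r
  value-integral (integral-ι r ir) = ir , integral-ℤ (+ 0)

  infixl 6 _+ᴸ_
  infixl 7 _*ᴸ_

  _+ᴸ_ _*ᴸ_ : Local → Local → Local
  value (x +ᴸ y) = value x ⊕ value y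
  value-integral (x +ᴸ y) with value-integral x | value-integral y
  ... | ia , ib | ic , id = integral-+ p-prime (re (value x)) (re (value y)) ia ic , integral-+ p-prime
      (im (value x)) (im (value y)) ib id
  value (x *ᴸ y) = value x ⊗ value y
  value-integral (x *ᴸ y) with value-integral x | value-integral y
  ... | ia , ib | ic , id =
      integral-+ p-prime (a ℚ.* c) (5ℚ ℚ.* (b ℚ.* d)) (integral-* p-prime a c ia ic)
        (integral-* p-prime 5ℚ (b ℚ.* d) (integral-ℤ (+ 5)) (integral-* p-prime b d ib id))
    , integral-+ p-prime (a ℚ.* d) (b ℚ.* c) (integral-* p-prime a d ia id) (integral-* p-prime b c ib ic)
    where
    a = re (value x)
    b = im (value x)
    c = re (value y)
    d = im (value y)

  -ᴸ_ : Local → Local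
  value (-ᴸ x) = ⊝ value x
  value-integral (-ᴸ x) = integral-neg p-prime (re (value x)) (proj₁ (value-integral x)) , integral-neg p-prime
      (im (value x)) (proj₂ (value-integral x))

  0ᴸ 1ᴸ : Local
  0ᴸ = integral-ι 0ℚ (integral-ℤ (+ 0))
  1ᴸ = integral-ι 1ℚ (integral-ℤ (+ 1))

  record _≋_ (x y : Local) : Set where
    constructor congruent
    field
      congruence : value x ≡ value y [mod p ]
  open _≋_ public

  private
    P : Q5
    P = ι (ℕ→ℚ p)

  exact : ∀ {x y} → value x ≡ value y → x ≋ y
  exact {x} {y} e = congruent (value 0ᴸ , value-integral 0ᴸ ,
      (lincomb (solve 3 (λ x y P → x :- y :- P :* :# 0 := :# 1 :* (x :- y)) refl (value x) (value y) P)
      (1# ⊡ e)))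

  ≋-sym : ∀ {x y} → x ≋ y → y ≋ x
  ≋-sym {x} {y} (congruent (c , ic , e)) = congruent (value (-ᴸ local c ic) , value-integral (-ᴸ local c ic) ,
    lincomb (solve 4 (λ x y c P → y :- x :- P :* :- c := :- :# 1 :* (x :- y :- P :* c))
        refl (value x) (value y) c P) (- 1# ⊡ e))

  ≋-trans : ∀ {x y z} → x ≋ y → y ≋ z → x ≋ z
  ≋-trans {x} {y} {z} (congruent (c , ic , e)) (congruent (d , id , f)) = congruent
      (value s , value-integral s ,
    lincomb (solve 6 (λ x y z c d P → x :- z :- P :* (c :+ d) := :# 1 :* (x :- y :- P :* c)
        :+ :# 1 :* (y :- z :- P :* d)) refl (value x) (value y) (value z) c d P) (1# ⊡ e ⊞ 1# ⊡ f))
    where s = local c ic +ᴸ local d id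

  +ᴸ-cong : ∀ {x y u v} → x ≋ y → u ≋ v → (x +ᴸ u) ≋ (y +ᴸ v)
  +ᴸ-cong {x} {y} {u} {v} (congruent (c , ic , e)) (congruent (d , id , f)) = congruent
      (value s , value-integral s ,
    lincomb (solve 7 (λ x y u v c d P → x :+ u :- (y :+ v) :- P :* (c :+ d) := :# 1 :* (x :- y :- P :* c)
        :+ :# 1 :* (u :- v :- P :* d)) refl (value x) (value y) (value u) (value v) c d P) (1# ⊡ e ⊞ 1# ⊡ f))
    where s = local c ic +ᴸ local d id

  *ᴸ-cong : ∀ {x y u v} → x ≋ y → u ≋ v → (x *ᴸ u) ≋ (y *ᴸ v)
  *ᴸ-cong {x} {y} {u} {v} (congruent (c , ic , e)) (congruent (d , id , f)) = congruent
      (value s , value-integral s ,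
    lincomb (solve 7 (λ x y u v c d P → x :* u :- y :* v :- P :* (c :* u :+ y :* d) := u :* (x :- y :- P :* c)
        :+ y :* (u :- v :- P :* d)) refl (value x) (value y) (value u) (value v) c d P)
        (value u ⊡ e ⊞ value y ⊡ f))
    where s = (local c ic *ᴸ u) +ᴸ (y *ᴸ local d id)

  -ᴸ-cong : ∀ {x y} → x ≋ y → (-ᴸ x) ≋ (-ᴸ y)
  -ᴸ-cong {x} {y} (congruent (c , ic , e)) = congruent (value (-ᴸ local c ic) , value-integral (-ᴸ local c ic) ,
    lincomb (solve 4 (λ x y c P → :- x :- :- y :- P :* :- c := :- :# 1 :* (x :- y :- P :* c))
        refl (value x) (value y) c P) (- 1# ⊡ e))

  -- Elements keep their exact values in ℚ(√5), and the setoid equality is congruence modulo p. So p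
  -- is 0 in this ring, and every equality derived in it already is a congruence of the kind in the
  -- statement.
  Local-ring : CommutativeRing 0ℓ 0ℓ
  Local-ring = record
    { Carrier = Local ; _≈_ = _≋_ ; _+_ = _+ᴸ_ ; _*_ = _*ᴸ_ ; -_ = -ᴸ_ ; 0# = 0ᴸ ; 1# = 1ᴸ
    ; isCommutativeRing = record
      { isRing = record
        { +-isAbelianGroup = record
          { isGroup = record
            { isMonoid = record
              { isSemigroup = record
                { isMagma = record
                  { isEquivalence = record { refl = exact refl ; sym = ≋-sym ; trans = ≋-trans }
                  ; ∙-cong = +ᴸ-cong }
                ; assoc = λ x y z → exact (+-assoc (value x) (value y) (value z)) }
              ; identity = (λ x → exact (+-identityˡ (value x))) , (λ x → exact (+-identityʳ (value x))) }
            ; inverse = (λ x → exact (-‿inverseˡ (value x))) , (λ x → exact (-‿inverseʳ (value x)))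
            ; ⁻¹-cong = -ᴸ-cong }
          ; comm = λ x y → exact (+-comm (value x) (value y)) }
        ; *-cong = *ᴸ-cong
        ; *-assoc = λ x y z → exact (*-assoc (value x) (value y) (value z))
        ; *-identity = (λ x → exact (*-identityˡ (value x))) , (λ x → exact (*-identityʳ (value x)))
        ; distrib = (λ x y z → exact (distribˡ (value x) (value y) (value z))) ,
            (λ x y z → exact (distribʳ (value x) (value y) (value z))) }
      ; *-comm = λ x y → exact (*-comm (value x) (value y)) } }

-- Specialisation to φ₊ and φ₋

module Assembly (n : ℕ) (p-prime : Prime (suc (suc n))) (3<n : 3 < n) where
  open import Data.Nat.DivMod using (_/_; _%_; m≡m%n+[m/n]*n; m%n<n)
  open Rationals
  open BernoulliNumbers
  open QuadraticField
  open Localisation (suc (suc n)) p-prime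
  module KR = RingCalculus Q5-ring
  module KS = FiniteSums Q5-ring
  open RingCalculus Local-ring
  open FiniteSums Local-ring
  open import Relation.Binary.Reasoning.Setoid setoid

  KR-# : ∀ k → KR.# k ≡ ι (ℕ→ℚ k)
  KR-# zero    = ≡.refl
  KR-# (suc k) = ≡.trans (KR.#-suc k) (≡.trans (≡.cong (ι 1ℚ ⊕_) (KR-# k))
      (≡.cong ι (≡.sym (ℤ→ℚ-+ (+ 1) (+ k)))))

  #-value-KR : ∀ k → value (# k) ≡ KR.# k
  #-value-KR zero          = ≡.refl
  #-value-KR (suc zero)    = ≡.refl
  #-value-KR (suc (suc k)) = ≡.cong (_⊕ ι 1ℚ) (#-value-KR (suc k))

  #-value : ∀ k → value (# k) ≡ ι (ℕ→ℚ k)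
  #-value k = ≡.trans (#-value-KR k) (KR-# k)

  char : # (suc (suc n)) ≈ 0#
  char = congruent (value 1# , value-integral 1# , KR.trans (≡.cong (_⊖ ι 0ℚ) (#-value (suc (suc n))))
      (KR.solve 1 (λ P → P KR.:- KR.:# 0 KR.:= P KR.:* KR.:# 1) ≡.refl (ι (ℕ→ℚ (suc (suc n))))))

  open PrimeCharacteristic Local-ring n p-prime char 3<n

  ∑-value : ∀ k f g → (∀ j → j < k → value (f j) ≡ g j) → value (∑ k f) ≡ sumTo5 k g
  ∑-value zero    f g h = ≡.refl
  ∑-value (suc k) f g h = ≡.cong₂ _⊕_ (∑-value k f g λ j j<k → h j (ℕₚ.m<n⇒m<1+n j<k)) (h k (ℕₚ.n<1+n k))

  KS-∑ : ∀ k f → KS.∑ k f ≡ sumTo5 k f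
  KS-∑ zero    f = ≡.refl
  KS-∑ (suc k) f = ≡.cong (_⊕ f k) (KS-∑ k f)

  sumTo5-ι : ∀ k f → sumTo5 k (λ j → ι (f j)) ≡ ι (sumTo k f)
  sumTo5-ι zero    f = ≡.refl
  sumTo5-ι (suc k) f = ≡.cong (_⊕ ι (f k)) (sumTo5-ι k f)

  ^-value : ∀ z k → value (z ^ k) ≡ value z ^5 k
  ^-value z zero    = ≡.refl
  ^-value z (suc k) = ≡.cong (value z ⊗_) (^-value z k)

  KR-^ : ∀ z k → z KR.^ k ≡ z ^5 k
  KR-^ z zero    = ≡.refl
  KR-^ z (suc k) = ≡.cong (z ⊗_) (KR-^ z k)

  ι-^ : ∀ a k → ι a ^5 k ≡ ι (a ^ℚ k)
  ι-^ a zero    = ≡.refl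
  ι-^ a (suc k) = ≡.trans (≡.cong (ι a ⊗_) (ι-^ a k)) (ι-⊗ a (a ^ℚ k))

  -- Integrality at p of 1/k and B_k is available in a bounded range, whereas the abstract part
  -- takes total sequences of ring elements; outside the range the value is 0.
  module Truncated (f : ℕ → ℚ) (b : ℕ) (f-integral : ∀ k → k < b → pIntegralℚ p (f k)) where
    choose : ∀ k → Dec (k < b) → Local
    choose k (yes k<b) = integral-ι (f k) (f-integral k k<b)
    choose k (no  _)   = 0ᴸ

    seq : ℕ → Local
    seq k = choose k (k ℕ.<? b)

    seq-value : ∀ k → k < b → value (seq k) ≡ ι (f k)
    seq-value k k<b with k ℕ.<? b
    ... | yes _   = ≡.refl
    ... | no  k≮b = ⊥-elim (k≮b k<b)

  open Truncated (λ k → recipℕ (suc k)) m (λ k k<m → integral-recip k (s≤s k<m)) using () renaming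
      (seq to r; seq-value to r-value)

  r-inv : ∀ k → k < m → # (suc k) * r k ≈ 1#
  r-inv k k<m = exact (≡.trans (≡.cong₂ _⊗_ (#-value (suc k)) (r-value k k<m))
      (≡.trans (ι-⊗ (ℕ→ℚ (suc k)) (recipℕ (suc k))) (≡.cong ι (recip-inverse k))))

  integral-sumTo : ∀ k f → (∀ j → j < k → pIntegralℚ p (f j)) → pIntegralℚ p (sumTo k f)
  integral-sumTo zero    f h = integral-ℤ (+ 0)
  integral-sumTo (suc k) f h = integral-+ p-prime (sumTo k f) (f k)
      (integral-sumTo k f λ j j<k → h j (ℕₚ.m<n⇒m<1+n j<k)) (h k (ℕₚ.n<1+n k))

  -- Computing B_(k + 1) from the earlier numbers divides only by k + 2, and k + 1 < p - 1 keeps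
  -- this below p.
  integral-bernoulli : ∀ k → k < m → pIntegralℚ p (bernoulli k)
  integral-bernoulli = <-rec (λ k → k < m → pIntegralℚ p (bernoulli k)) step
    where
    step : ∀ k → (∀ {j} → j < k → j < m → pIntegralℚ p (bernoulli j)) → k < m → pIntegralℚ p (bernoulli k)
    step zero    _  _   = integral-ℤ (+ 1)
    step (suc k) ih k<m = ≡.subst (pIntegralℚ p) (≡.sym (bernoulli-suc k))
      (integral-neg p-prime (recipℕ (suc (suc k)) ℚ.* S)
          (integral-* p-prime (recipℕ (suc (suc k))) S (integral-recip (suc k) (s≤s k<m))
        (integral-sumTo (suc k) _ λ j j<1+k
            → integral-* p-prime (ℕ→ℚ (suc (suc k) C j)) (bTable k j) (integral-ℤ (+ (suc (suc k) C j)))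
          (≡.subst (pIntegralℚ p) (≡.sym (bTable-stable k j (ℕₚ.≤-pred j<1+k)))
              (ih j<1+k (ℕₚ.<-trans j<1+k k<m))))))
      where S = sumTo (suc k) (λ j → ℕ→ℚ (suc (suc k) C j) ℚ.* bTable k j)

  open Truncated bernoulli m integral-bernoulli using () renaming (seq to B; seq-value to B-value)

  B-sum : ∀ k → k < m → value (bernoulli-sum B k) ≡ ι (sumTo (suc k) (λ j → ℕ→ℚ (suc k C j) ℚ.* bernoulli j))
  B-sum k k<m = ≡.trans
    (∑-value (suc k) _ (λ j → ι (ℕ→ℚ (suc k C j) ℚ.* bernoulli j))
        (λ j j<1+k → ≡.trans (≡.cong₂ _⊗_ (#-value (suc k C j)) (B-value j (ℕₚ.<-≤-trans j<1+k k<m)))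
        (ι-⊗ (ℕ→ℚ (suc k C j)) (bernoulli j))))
    (sumTo5-ι (suc k) (λ j → ℕ→ℚ (suc k C j) ℚ.* bernoulli j))

  B-recurrence : ∀ k → k < m → bernoulli-sum B k ≈ 0# ^ k
  B-recurrence zero    k<m = exact (B-sum zero k<m)
  B-recurrence (suc k) k<m = trans (exact (≡.trans (B-sum (suc k) k<m) (≡.cong ι (bernoulli-recurrence k))))
      (sym (zeroˡ (0# ^ k)))

  p-odd : p ≡ suc (p / 2 ℕ.+ p / 2)
  p-odd with p % 2 in eq | m≡m%n+[m/n]*n p 2 | m%n<n p 2
  ... | 0 | e | _ = ⊥-elim (∤-prime 2 (s≤s (s≤s z≤n)) (s≤s (s≤s (ℕₚ.≤-trans (s≤s z≤n) 3<n)))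
      (divides (p / 2) e))
  ... | 1 | e | _ = ≡.trans e (≡.cong suc (≡.trans (ℕₚ.*-comm (p / 2) 2)
      (≡.cong (p / 2 ℕ.+_) (ℕₚ.+-identityʳ (p / 2)))))
  ... | suc (suc _) | _ | s≤s (s≤s ())

  open Congruences (p / 2) p-odd r r-inv

  finPolylog-£ : ∀ d z → finPolylog p d (value z) ≡ value (£ d z)
  finPolylog-£ d z = ≡.sym (∑-value m _ (λ k → ι (recipℕ (suc k) ^ℚ d) ⊗ (value z ^5 suc k)) λ k k<m →
    ≡.cong₂ _⊗_ (≡.trans (^-value (r k) d) (≡.trans (≡.cong (_^5 d) (r-value k k<m)) (ι-^ (recipℕ (suc k)) d)))
        (^-value z (suc k)))

  £-congruence : ∀ d z {w} → £ d z ≈ w → finPolylog p d (value z) ≡ value w [mod p ]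
  £-congruence d z {w} h = ≡.subst (λ v → v ≡ value w [mod p ]) (≡.sym (finPolylog-£ d z)) (congruence h)

  2<p : 2 < p
  2<p = s≤s (s≤s (ℕₚ.≤-trans (s≤s z≤n) 3<n))

  integral-½ : pIntegralℚ p ½
  integral-½ = integral-recip 1 2<p

  φ₊ᴸ φ₋ᴸ √5ᴸ εᴸ : Local
  φ₊ᴸ = local φ₊ (integral-½ , integral-½)
  φ₋ᴸ = local φ₋ (integral-½ , integral-neg p-prime ½ integral-½)
  √5ᴸ = local √5 (integral-ℤ (+ 0) , integral-ℤ (+ 1))
  εᴸ = integral-ι (ℤ→ℚ (legendre5 p)) (integral-ℤ (legendre5 p))

  φ₊+φ₋ : φ₊ᴸ + φ₋ᴸ ≈ 1#
  φ₊+φ₋ = exact ≡.refl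
  φ₊*φ₋ : φ₊ᴸ * φ₋ᴸ ≈ - 1#
  φ₊*φ₋ = exact ≡.refl

  module Conjugates (x y : Local) (x+y : value x ⊕ value y ≡ ι 1ℚ) (x*y : value x ⊗ value y ≡ ⊝ ι 1ℚ) where
    -- The expansion is exact in ℚ(√5), where 1/p exists, and its right side is the value of an
    -- element integral at p. Integrality of q_L, without which it has no reduction, is read off
    -- from this.
    q-expansion : ι (qL p) ≡ value (∑ m (λ k → r k * (bin m k * (- x) ^ suc k)))
    q-expansion = ≡.trans (≡.sym (ι-⊗ (ℕ→ℚ (lucas p ∸ 1)) (recipℕ p)))
        (≡.trans (≡.cong (_⊗ ι (recipℕ p)) (≡.sym (KR-# (lucas p ∸ 1))))
      (≡.trans (LucasQuotient.lucas-quotient Q5-ring {value x} {value y} x+y x*y m (p / 2) p-odd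
          (λ k → ι (recipℕ (suc k)))
          (λ k _ → ≡.trans (≡.cong (_⊗ ι (recipℕ (suc k))) (KR-# (suc k)))
              (≡.trans (ι-⊗ (ℕ→ℚ (suc k)) (recipℕ (suc k))) (≡.cong ι (recip-inverse k)))))
        (≡.trans (KS-∑ m _) (≡.sym (∑-value m _ _ λ k k<m
            → ≡.cong₂ _⊗_ (r-value k k<m) (≡.cong₂ _⊗_ (#-value-KR (m C k))
            (≡.trans (^-value (- x) (suc k)) (≡.sym (KR-^ (⊝ value x) (suc k))))))))))

    integral-qL : pIntegralℚ p (qL p)
    integral-qL = ≡.subst (λ w → pIntegralℚ p (re w)) (≡.sym q-expansion)
        (proj₁ (value-integral (∑ m (λ k → r k * (bin m k * (- x) ^ suc k)))))

    L₁≈-q : (iq : pIntegralℚ p (qL p)) → L₁ x ≈ - integral-ι (qL p) iq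
    L₁≈-q iq = begin
      L₁ x                                                   ≈⟨ -‿involutive (L₁ x) ⟨
      - - L₁ x                                               ≈⟨ -‿cong (quotient≈-L₁ x) ⟨
      - ∑ m (λ k → r k * (bin m k * (- x) ^ suc k))          ≈⟨ -‿cong
          (exact {integral-ι (qL p) iq} q-expansion) ⟨
      - integral-ι (qL p) iq                                 ∎

  module φ₊-facts = Conjugates φ₊ᴸ φ₋ᴸ ≡.refl ≡.refl
  module φ₋-facts = Conjugates φ₋ᴸ φ₊ᴸ ≡.refl ≡.refl

  integral-qL : pIntegralℚ p (qL p)
  integral-qL = φ₊-facts.integral-qL

  qᴸ q²ᴸ q³ᴸ Bᴸ : Local
  qᴸ = integral-ι (qL p) integral-qL
  q²ᴸ = integral-ι (qL p ℚ.* qL p) (integral-* p-prime (qL p) (qL p) integral-qL integral-qL)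
  q³ᴸ = integral-ι (qL p ℚ.* qL p ℚ.* qL p)
      (integral-* p-prime (qL p ℚ.* qL p) (qL p)
      (integral-* p-prime (qL p) (qL p) integral-qL integral-qL) integral-qL)
  Bᴸ = integral-ι (bernoulli (p ∸ 3)) (integral-bernoulli (p ∸ 3) (s≤s (ℕₚ.m∸n≤m n 1)))

  q² : q²ᴸ ≈ qᴸ * qᴸ
  q² = exact (≡.sym (ι-⊗ (qL p) (qL p)))

  q³ : q³ᴸ ≈ qᴸ * qᴸ * qᴸ
  q³ = exact (≡.sym (≡.trans (≡.cong (_⊗ ι (qL p)) (ι-⊗ (qL p) (qL p))) (ι-⊗ (qL p ℚ.* qL p) (qL p))))

  Bᴸ≈β : Bᴸ ≈ β
  Bᴸ≈β = trans (exact (≡.sym (B-value (p ∸ 3) (s≤s (ℕₚ.m∸n≤m n 1))))) (bernoulli≈β B B-recurrence)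

  -- The p-th power of φ₊ is φ₊ or φ₋, that is (1 ± √5)/2, according to the symbol. Once the symbol
  -- is a known integer, both sides are closed terms and agree by evaluation.
  φ₊-frobenius : # 2 * φ₊ᴸ ^ p ≈ 1# + √5ᴸ * εᴸ
  φ₊-frobenius =
    [ (λ (l , h) → trans (*-congˡ h) (exact (≡.cong (λ w → ι 1ℚ ⊕ √5 ⊗ ι (ℤ→ℚ w)) (≡.sym l))))
    , (λ (l , h) → trans (*-congˡ h) (exact (≡.cong (λ w → ι 1ℚ ⊕ √5 ⊗ ι (ℤ→ℚ w)) (≡.sym l))))
    ]′ (Frobenius.frobenius-legendre {φ₊ᴸ} {φ₋ᴸ} φ₊+φ₋ φ₊*φ₋)

  φ₋-frobenius : # 2 * φ₋ᴸ ^ p ≈ 1# - √5ᴸ * εᴸ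
  φ₋-frobenius =
    [ (λ (l , h) → trans (*-congˡ h) (exact (≡.cong (λ w → ι 1ℚ ⊖ √5 ⊗ ι (ℤ→ℚ w)) (≡.sym l))))
    , (λ (l , h) → trans (*-congˡ h) (exact (≡.cong (λ w → ι 1ℚ ⊖ √5 ⊗ ι (ℤ→ℚ w)) (≡.sym l))))
    ]′ (Frobenius.frobenius-legendre {φ₋ᴸ} {φ₊ᴸ} (trans (+-comm φ₋ᴸ φ₊ᴸ) φ₊+φ₋) (trans (*-comm φ₋ᴸ φ₊ᴸ) φ₊*φ₋))

  golden₊ : Golden φ₊ᴸ φ₋ᴸ (φ₊ᴸ ^ p)
  golden₊ = record { x+y = φ₊+φ₋ ; x*y = φ₊*φ₋ ; x^p = refl }

  golden₋ : Golden φ₋ᴸ φ₊ᴸ (φ₋ᴸ ^ p)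
  golden₋ = record { x+y = trans (+-comm φ₋ᴸ φ₊ᴸ) φ₊+φ₋ ; x*y = trans (*-comm φ₋ᴸ φ₊ᴸ) φ₊*φ₋ ; x^p = refl }

  module V₊ = Values {φ₊ᴸ} {φ₋ᴸ} {φ₊ᴸ ^ p} {qᴸ} {√5ᴸ * εᴸ} golden₊ (φ₊-facts.L₁≈-q integral-qL) φ₊-frobenius
  module V₋ = Values {φ₋ᴸ} {φ₊ᴸ} {φ₋ᴸ ^ p} {qᴸ} { - (√5ᴸ * εᴸ)} golden₋
      (φ₋-facts.L₁≈-q integral-qL) φ₋-frobenius

  integral-⅕ : pIntegralℚ p (+ 1 ℚ./ 5)
  integral-⅕ = integral-recip 4 (s≤s (s≤s 3<n))

  −1/10 1/10 −½ −¼ ⅕ −1ᴸ −2/15 ½ᴸ : Local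
  −1/10 = integral-ι (-[1+ 0 ] ℚ./ 10) (integral-neg p-prime (+ 1 ℚ./ 10)
      (integral-* p-prime ½ (+ 1 ℚ./ 5) integral-½ integral-⅕))
  1/10 = integral-ι (+ 1 ℚ./ 10) (integral-* p-prime ½ (+ 1 ℚ./ 5) integral-½ integral-⅕)
  −½ = integral-ι (-[1+ 0 ] ℚ./ 2) (integral-neg p-prime ½ integral-½)
  −¼ = integral-ι (-[1+ 0 ] ℚ./ 4) (integral-neg p-prime (+ 1 ℚ./ 4)
      (integral-* p-prime ½ ½ integral-½ integral-½))
  ⅕ = integral-ι (+ 1 ℚ./ 5) integral-⅕
  −1ᴸ = integral-ι (-[1+ 0 ] ℚ./ 1) (integral-ℤ -[1+ 0 ])
  −2/15 = integral-ι (-[1+ 1 ] ℚ./ 15) (integral-* p-prime (-[1+ 1 ] ℚ./ 3) (+ 1 ℚ./ 5)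
      (integral-* p-prime (-[1+ 1 ] ℚ./ 1) (+ 1 ℚ./ 3) (integral-ℤ -[1+ 1 ])
      (integral-recip 2 (s≤s (s≤s (ℕₚ.≤-trans (s≤s (s≤s z≤n)) 3<n))))) integral-⅕)
  ½ᴸ = integral-ι (+ 1 ℚ./ 2) integral-½

  £₂[φ₊] : £ 2 φ₊ᴸ ≈ −1/10 * √5ᴸ * εᴸ * q²ᴸ
  £₂[φ₊] = V₊.£₂[x] {k = −1/10} (exact ≡.refl) (*-assoc −1/10 √5ᴸ εᴸ) q²

  £₂[φ₋] : £ 2 φ₋ᴸ ≈ 1/10 * √5ᴸ * εᴸ * q²ᴸ
  -- For the conjugate, u is -√5 (p/5); its sign is moved into the coefficient, which turns -1/10
  -- into 1/10.
  £₂[φ₋] = V₋.£₂[x] {k = −1/10} (exact ≡.refl)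
      (trans (*-congʳ (*-congʳ (exact {1/10} { - −1/10} ≡.refl))) (swap-sign −1/10 √5ᴸ εᴸ)) q²

  £₂[φ₊²] : £ 2 (φ₊ᴸ ^ 2) ≈ −½ * (1# + √5ᴸ * ⅕ * εᴸ) * q²ᴸ
  £₂[φ₊²] = V₊.£₂[x²] {k = −½} {k₅ = ⅕} (exact ≡.refl) (exact ≡.refl) (scale₊ √5ᴸ ⅕ εᴸ) q²

  £₂[φ₋²] : £ 2 (φ₋ᴸ ^ 2) ≈ −½ * (1# - √5ᴸ * ⅕ * εᴸ) * q²ᴸ
  £₂[φ₋²] = V₋.£₂[x²] {k = −½} {k₅ = ⅕} (exact ≡.refl) (exact ≡.refl) (scale₋ √5ᴸ ⅕ εᴸ) q²

  £₂[−φ₊] : £ 2 (−1ᴸ * φ₊ᴸ) ≈ −¼ * (1# + √5ᴸ * ⅕ * εᴸ) * q²ᴸ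
  £₂[−φ₊] = V₊.£₂[-x] {k = −¼} {k₅ = ⅕} (exact ≡.refl) (exact ≡.refl) (exact ≡.refl) (scale₊ √5ᴸ ⅕ εᴸ) q²

  £₂[−φ₋] : £ 2 (−1ᴸ * φ₋ᴸ) ≈ −¼ * (1# - √5ᴸ * ⅕ * εᴸ) * q²ᴸ
  £₂[−φ₋] = V₋.£₂[-x] {k = −¼} {k₅ = ⅕} (exact ≡.refl) (exact ≡.refl) (exact ≡.refl) (scale₋ √5ᴸ ⅕ εᴸ) q²

  £₃[φ₊²] : £ 3 (φ₊ᴸ ^ 2) ≈ −2/15 * (1# + √5ᴸ * εᴸ) * (½ᴸ * q³ᴸ + Bᴸ)
  £₃[φ₊²] = V₊.£₃[x²] {k = −2/15} {k₂ = ½ᴸ} (exact ≡.refl) (exact ≡.refl) refl q³ Bᴸ≈β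

  £₃[φ₋²] : £ 3 (φ₋ᴸ ^ 2) ≈ −2/15 * (1# - √5ᴸ * εᴸ) * (½ᴸ * q³ᴸ + Bᴸ)
  £₃[φ₋²] = V₋.£₃[x²] {k = −2/15} {k₂ = ½ᴸ} (exact ≡.refl) (exact ≡.refl) refl q³ Bᴸ≈β

open import Data.Nat using (ℕ; _<_; _∸_)
open import Data.Nat.Primality using (Prime)
open import Data.Integer using (+_; -[1+_])
open import Data.Rational using (ℚ; _/_; _*_; _+_; -_; 1ℚ)
open import Data.Product using (_×_)

theorem4p4 : (p : ℕ) → Prime p → 5 < p →
  let ε = ι (ℤ→ℚ (legendre5 p))
      q = qL p
      q² = ι (q * q)
      q³ = ι (q * q * q)
      s5 = √5 ⊗ ι (+ 1 / 5)
  in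
  -- £₂(φ±) ≡ ∓ (√5/10) (p/5) q_L²
  (finPolylog p 2 φ₊ ≡ ι (-[1+ 0 ] / 10) ⊗ √5 ⊗ ε ⊗ q² [mod p ])
  × (finPolylog p 2 φ₋ ≡ ι (+ 1 / 10) ⊗ √5 ⊗ ε ⊗ q² [mod p ])
  -- £₂(φ±²) ≡ -½ (1 ± (√5/5)(p/5)) q_L²
  × (finPolylog p 2 (φ₊ ^5 2) ≡ ι (-[1+ 0 ] / 2) ⊗ (ι 1ℚ ⊕ s5 ⊗ ε) ⊗ q² [mod p ])
  × (finPolylog p 2 (φ₋ ^5 2) ≡ ι (-[1+ 0 ] / 2) ⊗ (ι 1ℚ ⊖ s5 ⊗ ε) ⊗ q² [mod p ])
  -- £₂(-φ±) ≡ -¼ (1 ± (√5/5)(p/5)) q_L²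
  × (finPolylog p 2 (ι (-[1+ 0 ] / 1) ⊗ φ₊) ≡ ι (-[1+ 0 ] / 4) ⊗ (ι 1ℚ ⊕ s5 ⊗ ε) ⊗ q² [mod p ])
  × (finPolylog p 2 (ι (-[1+ 0 ] / 1) ⊗ φ₋) ≡ ι (-[1+ 0 ] / 4) ⊗ (ι 1ℚ ⊖ s5 ⊗ ε) ⊗ q² [mod p ])
  -- £₃(φ±²) ≡ -(2/15) (1 ± √5 (p/5)) (½ q_L³ + B_{p-3})
  × (finPolylog p 3 (φ₊ ^5 2) ≡ ι (-[1+ 1 ] / 15) ⊗ (ι 1ℚ ⊕ √5 ⊗ ε) ⊗ (ι (+ 1 / 2) ⊗ q³ ⊕ ι (bernoulli (p ∸ 3))) [mod p ])
  × (finPolylog p 3 (φ₋ ^5 2) ≡ ι (-[1+ 1 ] / 15) ⊗ (ι 1ℚ ⊖ √5 ⊗ ε) ⊗ (ι (+ 1 / 2) ⊗ q³ ⊕ ι (bernoulli (p ∸ 3))) [mod p ])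
-- With p = n + 2, the hypothesis 5 < p is 3 < n. The values of the elements below unfold to the
-- expressions of the statement, for instance `value (φ₊ᴸ ^ 2)` to `φ₊ ^5 2`.
theorem4p4 (suc (suc n)) p-prime (s≤s (s≤s 3<n)) =
    £-congruence 2 φ₊ᴸ £₂[φ₊]
  , £-congruence 2 φ₋ᴸ £₂[φ₋]
  , £-congruence 2 (φ₊ᴸ ^ 2) £₂[φ₊²]
  , £-congruence 2 (φ₋ᴸ ^ 2) £₂[φ₋²]
  , £-congruence 2 (−1ᴸ *ᴸ φ₊ᴸ) £₂[−φ₊]
  , £-congruence 2 (−1ᴸ *ᴸ φ₋ᴸ) £₂[−φ₋]
  , £-congruence 3 (φ₊ᴸ ^ 2) £₃[φ₊²]
  , £-congruence 3 (φ₋ᴸ ^ 2) £₃[φ₋²]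
  where
  open Assembly n p-prime 3<n
  open Localisation (suc (suc n)) p-prime using (_*ᴸ_; Local-ring)
  open RingCalculus Local-ring using (_^_)
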